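{- Let $m$ be a fixed positive integer, $p\in[1/2,1)$, $q=1-p$ and $\rho=p/q$. The asymptotic probability (as $n\to\infty$) that a random tournament with ties $t$ within the Erdős–Rényi model $T(n,p)$ has $m$ strongly connected components satisfies $$\mathbb P(t\text{ has }m\text{ strongly connected components})\approx\sum_{k\ge0}Q_{k,m}(\rho)\cdot\binom nk\cdot\frac{q^{nk}}{q^{k(k+1)/2}},$$ where $$Q_{k,m}(\rho)=m\Big(\mathfrak{it}^{(m-1)}_k-2\,\mathfrak{it}^{(m)}_k+\mathfrak{it}^{(m+1)}_k\Big).$$ In particular, $$\mathbb P(t\text{ is strongly connected})\approx1-\sum_{k\ge0}\Big(2\,\mathfrak{it}^{(1)}_k-\mathfrak{it}^{(2)}_k\Big)\cdot\binom nk\cdot\frac{q^{nk}}{q^{k(k+1)/2}}.$$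
   Context: A tournament with ties on $[n]=\{1,\dots,n\}$ is a directed graph with vertex set $[n]$ in which every pair of distinct vertices is joined either by exactly one directed edge or by two oppositely directed edges. For $p\in[1/2,1]$, in the Erdős–Rényi model $T(n,p)$ each pair of vertices $i\ne j$ is joined, independently of other pairs, by a single edge from $i$ to $j$ with probability $q$, by a single edge from $j$ to $i$ with probability $q$, and by two edges (both directions) with probability $p-q$. The weight of a tournament with ties $t$ is $w(t)=(\rho-1)^{\ell}$, where $\ell$ is the number of pairs of vertices joined by two edges (with $0^0=1$). For $j\ge1$, $\mathfrak{it}^{(j)}_k=\mathfrak{it}^{(j)}_k(\rho)$ is the sum of the weights of all tournaments with ties on $[k]$ having exactly $j$ strongly connected components (so $\mathfrak{it}^{(j)}_0=0$); by convention $\mathfrak{it}^{(0)}_0=1$ and $\mathfrak{it}^{(0)}_k=0$ for $k>0$. Notation $\approx$: $p_n\approx\sum_{k\ge0}c_kg_k(n)$ (here $g_k(n)=\binom nk q^{nk-k(k+1)/2}$) means that $g_{k+1}(n)=o(g_k(n))$ for every $k$ and, for every integer $r\ge0$, $p_n=\sum_{k=0}^rc_kg_k(n)+O(g_{r+1}(n))$ as $n\to\infty$; the constant $1$ in the second expansion belongs to the $k=0$ term. -}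

module Defs where

open import Level using (0ℓ) renaming (_⊔_ to _⊔ˡ_; suc to lsuc)
open import Algebra.Bundles using (CommutativeRing)
open import Algebra.Apartness.Bundles using (HeytingField; HeytingCommutativeRing)
open import Algebra.Core using (Op₂)
import Algebra.Properties.Semiring.Exp as Exp
import Algebra.Properties.Semiring.Mult as Mult
open import Data.Bool.Base using (Bool; true; false; T; _∧_)
import Data.Bool.Properties as Bool
open import Data.Fin.Base as Fin using (Fin; toℕ)
open import Data.Fin.Properties as Fin using (all?; any?; toℕ-injective; toℕ<n)
open import Data.Fin.Subset using (Subset)
open import Data.List.Base as List
  using (List; []; _∷_; allFin; cartesianProduct; cartesianProductWith; deduplicate; filter; foldr; length; upTo)
open import Data.Nat.Base as ℕ using (ℕ; zero; suc; z≤n; s≤s)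
import Data.Nat.Combinatorics as ℕ
import Data.Nat.DivMod as ℕ
import Data.Nat.Properties as ℕ
open import Data.Product.Base using (_×_; _,_; ∃; ∃-syntax; proj₁; uncurry)
open import Data.Sum.Base using (_⊎_; inj₁; inj₂)
open import Data.Vec.Base as Vec using (Vec; lookup; tabulate)
import Data.Vec.Properties as Vec
open import Relation.Binary.Core using (Rel)
open import Relation.Binary.Lattice.Definitions using (Supremum)
open import Relation.Binary.Construct.Closure.ReflexiveTransitive using (Star; ε; _◅_; _◅◅_)
open import Relation.Binary.Definitions using (Decidable)
open import Relation.Binary.PropositionalEquality using (_≡_; _≢_; refl; sym; trans)
open import Relation.Binary.Structures using (IsStrictPartialOrder)
import Relation.Unary as U
open import Relation.Nullary using (¬_; Dec; does)
open import Relation.Nullary.Decidable using (map′; _×-dec_; _⊎-dec_; _→-dec_; ¬?; T?)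

-- The standard library has no type of real numbers, so ℝ is given
-- axiomatically, as an Archimedean, Cauchy complete ordered field. The
-- axioms are those of the constructive reals: x ≤ y means ¬ y < x, the
-- order need not be decidable, and maxima are part of the structure
-- because they cannot be defined by cases. Classically these axioms
-- determine ℝ up to unique isomorphism.

record Reals c ℓ₁ ℓ₂ : Set (lsuc (c ⊔ˡ ℓ₁ ⊔ˡ ℓ₂)) where
  field
    heytingField : HeytingField c ℓ₁ ℓ₂

  open HeytingField heytingField public hiding (zero)

  commutativeRing : CommutativeRing c ℓ₁
  commutativeRing = HeytingCommutativeRing.commutativeRing heytingCommutativeRing

  open CommutativeRing commutativeRing public using (semiring)
  open Exp semiring public using (_^_)
  open Mult semiring public using () renaming (_×_ to _·_)

  infix 4 _<_ _≤_
  infixl 6 _⊔_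

  field
    _<_                  : Rel Carrier ℓ₂
    isStrictPartialOrder : IsStrictPartialOrder _≈_ _<_
    <⇒#                  : ∀ {x y} → x < y → x # y
    #⇒<⊎>                : ∀ {x y} → x # y → x < y ⊎ y < x
    +-monoˡ-<            : ∀ {x y} z → x < y → x + z < y + z
    *-pos                : ∀ {x y} → 0# < x → 0# < y → 0# < x * y

  _≤_ : Rel Carrier ℓ₂
  x ≤ y = ¬ y < x

  field
    _⊔_      : Op₂ Carrier
    supremum : Supremum _≤_ _⊔_

  ∣_∣ : Carrier → Carrier
  ∣ x ∣ = x ⊔ (- x)

  fromℕ : ℕ → Carrier
  fromℕ n = n · 1#

  field
    archimedean : ∀ x → ∃[ n ] x < fromℕ n
    complete    : ∀ (u : ℕ → Carrier) →
      (∀ ε → 0# < ε → ∃[ N ] ∀ m n → N ℕ.≤ m → N ℕ.≤ n → ∣ u m - u n ∣ < ε) →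
      ∃[ x ] ∀ ε → 0# < ε → ∃[ N ] ∀ n → N ℕ.≤ n → ∣ u n - x ∣ < ε

Digraph : ℕ → Set
Digraph n = Vec (Vec Bool n) n

module _ {n : ℕ} (t : Digraph n) where

  adj : Fin n → Fin n → Bool
  adj i j = lookup (lookup t i) j

  Edge : Rel (Fin n) 0ℓ
  Edge i j = T (adj i j)

  Reachable : Rel (Fin n) 0ℓ
  Reachable = Star Edge

  MutuallyReachable : Rel (Fin n) 0ℓ
  MutuallyReachable i j = Reachable i j × Reachable j i

  StronglyConnected : Set
  StronglyConnected = ∀ i j → Reachable i j

  IsTournamentWithTies : Set
  IsTournamentWithTies = (∀ i → ¬ Edge i i) × (∀ i j → i ≢ j → Edge i j ⊎ Edge j i)

  -- Reachability is decidable by the Floyd–Warshall recursion: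
  -- `Via k i j` says that there is a walk from i to j whose interior
  -- vertices are all smaller than k.

  Via : ℕ → Rel (Fin n) 0ℓ
  Via zero    i j = i ≡ j ⊎ Edge i j
  Via (suc k) i j = Via k i j ⊎ ∃[ v ] (toℕ v ≡ k × Via k i v × Via k v j)

  via? : ∀ k → Decidable (Via k)
  via? zero    i j = (i Fin.≟ j) ⊎-dec T? (adj i j)
  via? (suc k) i j =
    via? k i j ⊎-dec any? (λ v → (toℕ v ℕ.≟ k) ×-dec (via? k i v ×-dec via? k v j))

  via⇒reachable : ∀ k {i j} → Via k i j → Reachable i j
  via⇒reachable zero    (inj₁ refl)            = ε
  via⇒reachable zero    (inj₂ e)               = e ◅ ε
  via⇒reachable (suc k) (inj₁ r)               = via⇒reachable k r
  via⇒reachable (suc k) (inj₂ (v , _ , r , s)) = via⇒reachable k r ◅◅ via⇒reachable k s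

  via-base : ∀ k {i j} → i ≡ j ⊎ Edge i j → Via k i j
  via-base zero    r = r
  via-base (suc k) r = inj₁ (via-base k r)

  via-into : ∀ k {i v} → toℕ v ≡ k → Via (suc k) i v → Via k i v
  via-into k v≡k (inj₁ r)                = r
  via-into k v≡k (inj₂ (w , w≡k , r , _)) with refl ← toℕ-injective (trans v≡k (sym w≡k)) = r

  via-from : ∀ k {v j} → toℕ v ≡ k → Via (suc k) v j → Via k v j
  via-from k v≡k (inj₁ s)                = s
  via-from k v≡k (inj₂ (w , w≡k , _ , s)) with refl ← toℕ-injective (trans v≡k (sym w≡k)) = s

  via-trans : ∀ k {i v j} → toℕ v ℕ.< k → Via k i v → Via k v j → Via k i j
  via-trans (suc k) {v = v} (s≤s v≤k) r s with ℕ.m≤n⇒m<n∨m≡n v≤k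
  ... | inj₂ v≡k = inj₂ (v , v≡k , via-into k v≡k r , via-from k v≡k s)
  via-trans (suc k) _ (inj₁ r) (inj₁ s) | inj₁ v<k = inj₁ (via-trans k v<k r s)
  via-trans (suc k) _ (inj₁ r) (inj₂ (w , w≡k , s₁ , s₂)) | inj₁ v<k =
    inj₂ (w , w≡k , via-trans k v<k r s₁ , s₂)
  via-trans (suc k) _ (inj₂ (w , w≡k , r₁ , r₂)) (inj₁ s) | inj₁ v<k =
    inj₂ (w , w≡k , r₁ , via-trans k v<k r₂ s)
  via-trans (suc k) _ (inj₂ (w , w≡k , r₁ , _)) (inj₂ (w′ , w′≡k , _ , s₂)) | inj₁ _
    with refl ← toℕ-injective (trans w≡k (sym w′≡k)) = inj₂ (w , w≡k , r₁ , s₂)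

  reachable⇒via : ∀ {i j} → Reachable i j → Via n i j
  reachable⇒via ε                 = via-base n (inj₁ refl)
  reachable⇒via (_◅_ {j = v} e p) = via-trans n (toℕ<n v) (via-base n (inj₂ e)) (reachable⇒via p)

  reachable? : Decidable Reachable
  reachable? i j = map′ (via⇒reachable n) reachable⇒via (via? n i j)

  mutuallyReachable? : Decidable MutuallyReachable
  mutuallyReachable? i j = reachable? i j ×-dec reachable? j i

  stronglyConnected? : Dec StronglyConnected
  stronglyConnected? = all? λ i → all? λ j → reachable? i j

  isTournamentWithTies? : Dec IsTournamentWithTies
  isTournamentWithTies? =
    all? (λ i → ¬? (T? (adj i i))) ×-dec
    all? (λ i → all? λ j → ¬? (i Fin.≟ j) →-dec (T? (adj i j) ⊎-dec T? (adj j i)))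

  component : Fin n → Subset n
  component i = tabulate λ j → does (mutuallyReachable? i j)

  components : List (Subset n)
  components = deduplicate (Vec.≡-dec Bool._≟_) (List.map component (allFin n))

  numComponents : ℕ
  numComponents = length components

vectors : ∀ {a} {A : Set a} → List A → (n : ℕ) → List (Vec A n)
vectors xs zero    = Vec.[] ∷ []
vectors xs (suc n) = cartesianProductWith Vec._∷_ xs (vectors xs n)

digraphs : ∀ n → List (Digraph n)
digraphs n = vectors (vectors (true ∷ false ∷ []) n) n

tournaments : ∀ n → List (Digraph n)
tournaments n = filter isTournamentWithTies? (digraphs n)

pairs : ∀ n → List (Fin n × Fin n)
pairs n = filter (uncurry Fin._<?_) (cartesianProduct (allFin n) (allFin n))

numTies : ∀ {n} → Digraph n → ℕ
numTies {n} t = length (filter (λ (i , j) → T? (adj t i j ∧ adj t j i)) (pairs n))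

HasComponents : ℕ → ∀ {n} → Digraph n → Set
HasComponents m t = numComponents t ≡ m

hasComponents? : ∀ m {n} → U.Decidable (HasComponents m {n})
hasComponents? m t = numComponents t ℕ.≟ m

module RealNotation {c ℓ₁ ℓ₂} (ℝ : Reals c ℓ₁ ℓ₂) where
  open Reals ℝ
  open CommutativeRing commutativeRing using (ring; +-group)
  open import Algebra.Properties.Ring ring using (-1*x≈-x; -‿involutive)
  open HeytingField heytingField using () renaming (refl to ≈-refl; sym to ≈-sym; trans to ≈-trans)
  private module < = IsStrictPartialOrder isStrictPartialOrder
  open import Algebra.Apartness.Properties.HeytingCommutativeRing heytingCommutativeRing using (1#0)

  recip : ∀ x → 0# < x → Carrier
  recip x 0<x = proj₁ (#⇒invertible (#-sym (<⇒# 0<x)))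

  x<y⇒0<y-x : ∀ {x y} → x < y → 0# < y - x
  x<y⇒0<y-x {x} x<y = <.<-respˡ-≈ (-‿inverseʳ x) (+-monoˡ-< (- x) x<y)

  0<1 : 0# < 1#
  0<1 with #⇒<⊎> 1#0
  ... | inj₂ 0<1 = 0<1
  ... | inj₁ 1<0 = <.<-respʳ-≈ -1*-1≈1 (*-pos 0<-1 0<-1)
    where
    0<-1 : 0# < - 1#
    0<-1 = <.<-respʳ-≈ (+-identityˡ (- 1#)) (x<y⇒0<y-x 1<0)
    -1*-1≈1 : - 1# * - 1# ≈ 1#
    -1*-1≈1 = ≈-trans (-1*x≈-x (- 1#)) (-‿involutive 1#)

  0<2 : 0# < 1# + 1#
  0<2 = <.trans 0<1 (<.<-respˡ-≈ (+-identityˡ 1#) (+-monoˡ-< 1# 0<1))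

  ½ : Carrier
  ½ = recip (1# + 1#) 0<2

  ^-pos : ∀ {x} → 0# < x → ∀ n → 0# < x ^ n
  ^-pos 0<x zero    = 0<1
  ^-pos 0<x (suc n) = *-pos 0<x (^-pos 0<x n)

  ∑ : ∀ {a} {A : Set a} → List A → (A → Carrier) → Carrier
  ∑ xs f = foldr (λ x s → f x + s) 0# xs

  ∏ : ∀ {a} {A : Set a} → List A → (A → Carrier) → Carrier
  ∏ xs f = foldr (λ x s → f x * s) 1# xs

  IsLittleO : (f g : ℕ → Carrier) → Set (c ⊔ˡ ℓ₂)
  IsLittleO f g = ∀ ε → 0# < ε → ∃[ N ] ∀ n → N ℕ.≤ n → ∣ f n ∣ ≤ ε * ∣ g n ∣

  IsBigO : (f g : ℕ → Carrier) → Set (c ⊔ˡ ℓ₂)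
  IsBigO f g = ∃[ C ] ∃[ N ] ∀ n → N ℕ.≤ n → ∣ f n ∣ ≤ C * ∣ g n ∣

  -- f(n) ≈ ∑_{k ≥ 0} a k · g k n
  AsymptoticExpansion : (f : ℕ → Carrier) (a : ℕ → Carrier) (g : ℕ → ℕ → Carrier) → Set (c ⊔ˡ ℓ₂)
  AsymptoticExpansion f a g =
    (∀ k → IsLittleO (g (suc k)) (g k)) ×
    (∀ r → IsBigO (λ n → f n - ∑ (upTo (suc r)) (λ k → a k * g k n)) (g (suc r)))

module WeightedTournaments {c ℓ₁ ℓ₂} (ℝ : Reals c ℓ₁ ℓ₂) (ρ : Reals.Carrier ℝ) where
  open Reals ℝ
  open RealNotation ℝ

  weight : ∀ {n} → Digraph n → Carrier
  weight t = (ρ - 1#) ^ numTies t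

  -- it j k is 𝔦𝔱⁽ʲ⁾ₖ(ρ)
  it : (j k : ℕ) → Carrier
  it zero    zero    = 1#
  it zero    (suc _) = 0#
  it (suc j) k       = ∑ (filter (hasComponents? (suc j)) (tournaments k)) weight

  Q : (k m : ℕ) → Carrier
  Q k m = fromℕ m * (it (m ℕ.∸ 1) k - fromℕ 2 * it m k + it (suc m) k)

  -- The coefficients of 1 - ∑ₖ (2 𝔦𝔱⁽¹⁾ₖ - 𝔦𝔱⁽²⁾ₖ) gₖ, where 1 = g₀.
  scCoefficient : ℕ → Carrier
  scCoefficient zero    = 1# - (fromℕ 2 * it 1 zero - it 2 zero)
  scCoefficient (suc k) = - (fromℕ 2 * it 1 (suc k) - it 2 (suc k))

module ErdősRényi {c ℓ₁ ℓ₂} (ℝ : Reals c ℓ₁ ℓ₂)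
                  (p : Reals.Carrier ℝ) (p<1 : Reals._<_ ℝ p (Reals.1# ℝ)) where
  open Reals ℝ
  open RealNotation ℝ

  q : Carrier
  q = 1# - p

  0<q : 0# < q
  0<q = x<y⇒0<y-x p<1

  ρ : Carrier
  ρ = p * recip q 0<q

  -- The arguments tell whether i → j and whether j → i are edges; in a
  -- tournament the last case does not occur.
  pairProbability : Bool → Bool → Carrier
  pairProbability true  true  = p - q
  pairProbability true  false = q
  pairProbability false true  = q
  pairProbability false false = 0#

  -- Distinct pairs are independent.
  probability : ∀ {n} → Digraph n → Carrier
  probability {n} t = ∏ (pairs n) λ (i , j) → pairProbability (adj t i j) (adj t j i)

  ℙ : ∀ n {A : Digraph n → Set} → U.Decidable A → Carrier
  ℙ n A? = ∑ (filter A? (tournaments n)) probability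

  g : (k n : ℕ) → Carrier
  g k n = fromℕ (n ℕ.C k) *
          (q ^ (n ℕ.* k) * recip (q ^ (k ℕ.* suc k ℕ./ 2)) (^-pos 0<q (k ℕ.* suc k ℕ./ 2)))

  open WeightedTournaments ℝ ρ public

module Submission where

-- Weigh a tournament with ties by (ρ-1)^(number of ties), so that ℙ is q^C(n,2) times the weight
-- and all tournaments on [n] together weigh T(n) = q^(-C(n,2)). The strong components of a
-- tournament are linearly ordered, so cutting off the first one gives, for exponential generating
-- functions, 𝔦𝔱⁽ᵐ⁺¹⁾ = 𝔦𝔱⁽¹⁾ 𝔦𝔱⁽ᵐ⁾ and T = 1 + 𝔦𝔱⁽¹⁾ T, that is U T = 1 for U = 1 - 𝔦𝔱⁽¹⁾.
-- Because T grows so fast, only the r first and the r last terms of a binomial convolution of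
-- sequences bounded by T matter up to O(C(n,r) T(n-r)). Hence expanding a sequence along
-- C(n,k) T(n-k) is a derivation: if f has coefficients c and h has coefficients d, then f h has
-- coefficients f d + c h. As the coefficients of U follow from U T = 1 to be -U², those of 𝔦𝔱⁽ᵐ⁾
-- are m 𝔦𝔱⁽ᵐ⁻¹⁾ U² = m (𝔦𝔱⁽ᵐ⁻¹⁾ - 2 𝔦𝔱⁽ᵐ⁾ + 𝔦𝔱⁽ᵐ⁺¹⁾).

open import Defs
open import Level using (0ℓ) renaming (_⊔_ to _⊔ˡ_)
open import Algebra.Bundles using (CommutativeRing; RawRing)
import Algebra.Properties.CommutativeSemigroup
import Algebra.Properties.Ring
import Algebra.Properties.Semiring.Exp
import Algebra.Properties.Semiring.Mult
import Algebra.Solver.Ring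
open import Algebra.Solver.Ring.AlmostCommutativeRing
  using (fromCommutativeRing; _-Raw-AlmostCommutative⟶_; Induced-equivalence)
open import Data.Bool.Base using (Bool; true; false; not; _∧_; _∨_; if_then_else_)
import Data.Bool.Properties as Bool
open import Data.Fin.Base using (Fin; zero; suc)
import Data.Fin.Properties as Fin
open import Data.List.Base as List
  using (List; []; _∷_; _++_; length; deduplicate; filter; allFin; upTo; cartesianProduct; cartesianProductWith)
import Data.List.Properties as List
open import Data.Maybe.Base using (just; nothing)
open import Data.Nat.Base as ℕ using (ℕ; zero; suc; NonZero)
open import Data.Nat.Combinatorics using (nCk+nC[k+1]≡[n+1]C[k+1]; nCk≡nC[n∸k]; nCn≡1)
open import Data.Nat.Combinatorics.Specification using (k>n⇒nCk≡0)
open import Data.Nat.Divisibility using (n∣m*n)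
import Data.Nat.DivMod as ℕ
import Data.Nat.Properties as ℕ
import Data.Nat.Solver
open import Data.Product.Base using (_×_; _,_; ∃-syntax; proj₁; proj₂; uncurry)
open import Data.Sum.Base using (_⊎_; inj₁; inj₂)
open import Data.Vec.Base as Vec using (Vec; []; _∷_; lookup; map; zipWith; tabulate)
import Data.Vec.Properties as Vec
open import Function.Base using (_∘_; _$_)
open import Function.Bundles using (_⇔_; mk⇔; Equivalence)
open import Relation.Binary.Definitions using (Decidable; DecidableEquality; WeaklyDecidable)
import Relation.Binary.PropositionalEquality as ≡
open ≡ using (_≡_; _≢_)
import Relation.Binary.Reasoning.Base.Triple
import Relation.Binary.Reasoning.Setoid
open import Relation.Binary.Structures using (IsStrictPartialOrder; IsPreorder)
open import Relation.Nullary using (¬_; Dec; does; yes; no; contradiction)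
open import Relation.Nullary.Decidable using (map′; does-⇔; dec-true; dec-false; ¬?; T?)
import Relation.Unary as U

-- The hypothesis p ≥ 1/2 enters as x = 1/q ≥ 2. The three ways to join a pair weigh 1 + 1 + (ρ-1) =
-- x together, whence `T n` = x^C(n,2); and ρ-1 = x-2 ≥ 0 makes all weights nonnegative, so that
-- each 𝔦𝔱⁽ᵐ⁾ is termwise at most `T`. No convergence is involved: generating functions are
-- sequences with a formal product, and size is measured against `T` only. The order of the reals is
-- not decidable. Hence every case distinction is made on natural numbers, and the terms of a
-- convolution are compared through exact ratios of consecutive terms, cleared of denominators. An
-- expansion sees only finitely many coefficients, but truncation does not commute with products.
-- The discrepancy is a finite combination of terms C(n,k) f(n-k) with k ≥ r, hence negligible
-- itself; this is what makes the derivation rule exact up to the order wanted. Adjacency matrices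
-- list every pair twice. They are traded for an inductive type listing each pair once, along which
-- weights multiply and restriction to a set of vertices is structural.

-- A ring solver with formal differences of naturals as coefficients.

-- The coefficient (m , n) of the solver stands for m - n.
module RingSolver {c ℓ} (R : CommutativeRing c ℓ) where
  open CommutativeRing R
  open Algebra.Properties.Ring ring
  open Algebra.Properties.Semiring.Mult semiring renaming (_×_ to _·_)
  open Algebra.Properties.CommutativeSemigroup +-commutativeSemigroup using (interchange)
  open Relation.Binary.Reasoning.Setoid setoid

  -- Pairs need no normalisation: several of them stand for the same integer, and `coefficient≟`
  -- compares them by cross addition.
  Difference : RawRing 0ℓ 0ℓ
  Difference = record
    { Carrier = ℕ × ℕ
    ; _≈_     = _≡_
    ; _+_     = λ (a , b) (c , d) → a ℕ.+ c , b ℕ.+ d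
    ; _*_     = λ (a , b) (c , d) → a ℕ.* c ℕ.+ b ℕ.* d , a ℕ.* d ℕ.+ b ℕ.* c
    ; -_      = λ (a , b) → b , a
    ; 0#      = 0 , 0
    ; 1#      = 1 , 0
    }

  -‿interchange : ∀ a b c d → (a + c) - (b + d) ≈ (a - b) + (c - d)
  -‿interchange a b c d = trans (+-congˡ (sym (-‿+-comm b d))) (interchange a c (- b) (- d))

  -‿*-expand : ∀ a b c d → (a - b) * (c - d) ≈ (a * c + b * d) - (a * d + b * c)
  -‿*-expand a b c d = begin
    (a - b) * (c - d)                       ≈⟨ distribʳ (c - d) a (- b) ⟩
    a * (c - d) + - b * (c - d)             ≈⟨ +-cong (x[y-z]≈xy-xz a c d) (sym (-‿distribˡ-* b (c - d))) ⟩
    (a * c - a * d) - b * (c - d)           ≈⟨ +-congˡ (-‿cong (x[y-z]≈xy-xz b c d)) ⟩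
    (a * c - a * d) - (b * c - b * d)       ≈⟨ +-congˡ (-‿+-comm (b * c) (- (b * d))) ⟨
    (a * c - a * d) + (- (b * c) - (- (b * d))) ≈⟨ +-congˡ (+-congˡ (-‿involutive (b * d))) ⟩
    (a * c - a * d) + (- (b * c) + b * d)   ≈⟨ +-congˡ (+-comm _ _) ⟩
    (a * c - a * d) + (b * d - b * c)       ≈⟨ -‿interchange (a * c) (a * d) (b * d) (b * c) ⟨
    (a * c + b * d) - (a * d + b * c)       ∎

  -- Values are computed in reduced form, so that equal coefficients, and the constants 0 and 1,
  -- denote definitionally equal elements.
  ⟦_⟧ᵈ : ℕ × ℕ → Carrier
  ⟦ 0           , 0     ⟧ᵈ = 0#
  ⟦ 0           , suc b ⟧ᵈ = - (suc b · 1#)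
  ⟦ 1           , 0     ⟧ᵈ = 1#
  ⟦ suc (suc a) , 0     ⟧ᵈ = suc (suc a) · 1#
  ⟦ suc a       , suc b ⟧ᵈ = ⟦ a , b ⟧ᵈ

  x-0≈x : ∀ x → x - 0# ≈ x
  x-0≈x x = trans (+-congˡ -0#≈0#) (+-identityʳ x)

  ⟦⟧ᵈ≈ : ∀ a b → ⟦ a , b ⟧ᵈ ≈ a · 1# - b · 1#
  ⟦⟧ᵈ-suc : ∀ a b → ⟦ a , b ⟧ᵈ ≈ suc a · 1# - suc b · 1#

  ⟦⟧ᵈ≈ 0             0       = sym (-‿inverseʳ 0#)
  ⟦⟧ᵈ≈ 0             (suc b) = sym (+-identityˡ _)
  ⟦⟧ᵈ≈ 1             0       = sym (trans (x-0≈x _) (+-identityʳ 1#))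
  ⟦⟧ᵈ≈ 1             (suc b) = ⟦⟧ᵈ-suc 0 b
  ⟦⟧ᵈ≈ (suc (suc a)) 0       = sym (x-0≈x _)
  ⟦⟧ᵈ≈ (suc (suc a)) (suc b) = ⟦⟧ᵈ-suc (suc a) b

  ⟦⟧ᵈ-suc a b = trans (⟦⟧ᵈ≈ a b) (sym (trans (-‿interchange 1# 1# (a · 1#) (b · 1#))
                 (trans (+-congʳ (-‿inverseʳ 1#)) (+-identityˡ _))))

  morphism : Difference -Raw-AlmostCommutative⟶ fromCommutativeRing R
  morphism = record
    { ⟦_⟧    = ⟦_⟧ᵈ
    ; +-homo = λ (a , b) (c , d) → begin
        ⟦ a ℕ.+ c , b ℕ.+ d ⟧ᵈ                      ≈⟨ ⟦⟧ᵈ≈ (a ℕ.+ c) (b ℕ.+ d) ⟩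
        (a ℕ.+ c) · 1# - (b ℕ.+ d) · 1#
          ≈⟨ +-cong (×-homo-+ 1# a c) (-‿cong (×-homo-+ 1# b d)) ⟩
        (a · 1# + c · 1#) - (b · 1# + d · 1#)       ≈⟨ -‿interchange _ _ _ _ ⟩
        (a · 1# - b · 1#) + (c · 1# - d · 1#)       ≈⟨ +-cong (⟦⟧ᵈ≈ a b) (⟦⟧ᵈ≈ c d) ⟨
        ⟦ a , b ⟧ᵈ + ⟦ c , d ⟧ᵈ                     ∎
    ; *-homo = λ (a , b) (c , d) → begin
        ⟦ a ℕ.* c ℕ.+ b ℕ.* d , a ℕ.* d ℕ.+ b ℕ.* c ⟧ᵈ
          ≈⟨ ⟦⟧ᵈ≈ (a ℕ.* c ℕ.+ b ℕ.* d) (a ℕ.* d ℕ.+ b ℕ.* c) ⟩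
        (a ℕ.* c ℕ.+ b ℕ.* d) · 1# - (a ℕ.* d ℕ.+ b ℕ.* c) · 1#
          ≈⟨ +-cong (×1-homo-*+* a c b d) (-‿cong (×1-homo-*+* a d b c)) ⟩
        (a · 1# * c · 1# + b · 1# * d · 1#) - (a · 1# * d · 1# + b · 1# * c · 1#)
          ≈⟨ -‿*-expand _ _ _ _ ⟨
        (a · 1# - b · 1#) * (c · 1# - d · 1#)       ≈⟨ *-cong (⟦⟧ᵈ≈ a b) (⟦⟧ᵈ≈ c d) ⟨
        ⟦ a , b ⟧ᵈ * ⟦ c , d ⟧ᵈ                     ∎
    ; -‿homo = λ (a , b) → begin
        ⟦ b , a ⟧ᵈ                  ≈⟨ ⟦⟧ᵈ≈ b a ⟩
        b · 1# - a · 1#             ≈⟨ ⁻¹-anti-homo‿- (a · 1#) (b · 1#) ⟨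
        - (a · 1# - b · 1#)         ≈⟨ -‿cong (⟦⟧ᵈ≈ a b) ⟨
        - ⟦ a , b ⟧ᵈ                ∎
    ; 0-homo = refl
    ; 1-homo = refl
    }
    where
    ×1-homo-*+* : ∀ a c b d → (a ℕ.* c ℕ.+ b ℕ.* d) · 1# ≈ (a · 1#) * (c · 1#) + (b · 1#) * (d · 1#)
    ×1-homo-*+* a c b d = trans (×-homo-+ 1# (a ℕ.* c) (b ℕ.* d)) (+-cong (×1-homo-* a c) (×1-homo-* b d))

  coefficient≟ : WeaklyDecidable (Induced-equivalence morphism)
  coefficient≟ (a , b) (c , d) with a ℕ.+ d ℕ.≟ c ℕ.+ b
  ... | no  _  = nothing
  ... | yes eq = just (begin
    ⟦ a , b ⟧ᵈ           ≈⟨ ⟦⟧ᵈ≈ a b ⟩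
    A - B                ≈⟨ +-identityʳ (A - B) ⟨
    (A - B) + 0#         ≈⟨ +-congˡ (-‿inverseʳ D) ⟨
    (A - B) + (D - D)    ≈⟨ -‿interchange A B D D ⟨
    (A + D) - (B + D)    ≈⟨ +-congʳ (×-homo-+ 1# a d) ⟨
    (a ℕ.+ d) · 1# - (B + D) ≡⟨ ≡.cong (λ n → n · 1# - (B + D)) eq ⟩
    (c ℕ.+ b) · 1# - (B + D) ≈⟨ +-congʳ (×-homo-+ 1# c b) ⟩
    (C + B) - (B + D)    ≈⟨ +-congˡ (-‿cong (+-comm B D)) ⟩
    (C + B) - (D + B)    ≈⟨ -‿interchange C D B B ⟩
    (C - D) + (B - B)    ≈⟨ +-congˡ (-‿inverseʳ B) ⟩
    (C - D) + 0#         ≈⟨ +-identityʳ (C - D) ⟩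
    C - D                ≈⟨ ⟦⟧ᵈ≈ c d ⟨
    ⟦ c , d ⟧ᵈ           ∎)
    where
    A = a · 1#
    B = b · 1#
    C = c · 1#
    D = d · 1#

  open Algebra.Solver.Ring Difference (fromCommutativeRing R) morphism coefficient≟ public
    using (solve; _:=_; _:+_; _:*_; _:-_; :-_; con)

  :0 :1 : ∀ {n} → Algebra.Solver.Ring.Polynomial Difference (fromCommutativeRing R) morphism coefficient≟ n
  :0 = con (0 , 0)
  :1 = con (1 , 0)

-- Polynomial identities that bookkeep the error terms.

module RingIdentities {c ℓ} (R : CommutativeRing c ℓ) where
  open CommutativeRing R
  open RingSolver R

  [a-b]k : ∀ a b k → (a - b) * k ≈ a * k - b * k
  [a-b]k = solve 3 (λ a b k → (a :- b) :* k := a :* k :- b :* k) refl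

  tails-product : ∀ f h f′ h′ → (f - f′) * (h - h′) ≈ (f * h - (f′ * h + f * h′)) + f′ * h′
  tails-product = solve 4 (λ f h f′ h′ →
    (f :- f′) :* (h :- h′) := (f :* h :- (f′ :* h :+ f :* h′)) :+ f′ :* h′) refl

  -- In use, `f′`, `h′`, `c`, `d` are truncations of the two factors and of their coefficient
  -- sequences, and `u`, `v` are truncated products. The left side is a sum of five negligible
  -- errors: the middle of the convolution, the two given expansions, and two exchanges of
  -- truncation with product.
  product-rule : ∀ f h f′ h′ c d T u v →
    (f * h - (f′ * h + f * h′))
      + ((f′ * (h - d * T) + h′ * (f - c * T)) + ((f′ * d * T - u * T) + (c * h′ * T - v * T)))
    ≈ f * h - (u + v) * T
  product-rule = solve 9 (λ f h f′ h′ c d T u v →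
    (f :* h :- (f′ :* h :+ f :* h′))
      :+ ((f′ :* (h :- d :* T) :+ h′ :* (f :- c :* T)) :+ ((f′ :* d :* T :- u :* T) :+ (c :* h′ :* T :- v :* T)))
    := f :* h :- (u :+ v) :* T) refl

  -- Here `u`, `t`, `v`, `w` are the truncations of U, T, U², UT. Once UT = 1 and `w` = 1 are
  -- inserted on the right, `u` cancels and `inverse-rule₂` leaves U + `v` T.
  inverse-rule₁ : ∀ U T u t v w →
    u - (u * (U * T - (u * T + U * t)) + ((u * t * U - w * U) + (u * u * T - v * T)))
    ≈ (u - u * (U * T)) + (w * U + v * T)
  inverse-rule₁ = solve 6 (λ U T u t v w →
    u :- (u :* (U :* T :- (u :* T :+ U :* t)) :+ ((u :* t :* U :- w :* U) :+ (u :* u :* T :- v :* T)))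
    := (u :- u :* (U :* T)) :+ (w :* U :+ v :* T)) refl

  inverse-rule₂ : ∀ U T u v → (u - u * 1#) + (1# * U + v * T) ≈ U - (- v) * T
  inverse-rule₂ = solve 4 (λ U T u v → (u :- u :* :1) :+ (:1 :* U :+ v :* T) := U :- (:- v) :* T) refl

  [1-a]t : ∀ a t → (1# - a) * t ≈ t - a * t
  [1-a]t = solve 2 (λ a t → (:1 :- a) :* t := t :- a :* t) refl

  1-[1-a--vt] : ∀ a v t → 1# - ((1# - a) - (- v) * t) ≈ a - v * t
  1-[1-a--vt] = solve 3 (λ a v t → :1 :- ((:1 :- a) :- (:- v) :* t) := a :- v :* t) refl

  [1-a][1-a]b : ∀ a b → (1# - a) * (1# - a) * b ≈ b - (a * b + a * b) + a * (a * b)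
  [1-a][1-a]b = solve 2 (λ a b →
    (:1 :- a) :* (:1 :- a) :* b := b :- (a :* b :+ a :* b) :+ a :* (a :* b)) refl

-- Sequences under binomial convolution, and their truncations.

module Hurwitz {c ℓ} (R : CommutativeRing c ℓ) where
  open CommutativeRing R
  open RingSolver R using (solve; _:=_; _:+_)
  open Relation.Binary.Reasoning.Setoid setoid

  Seq : Set c
  Seq = ℕ → Carrier

  infix 4 _≋_
  _≋_ : Seq → Seq → Set ℓ
  f ≋ h = ∀ n → f n ≈ h n

  infixl 9 _′
  _′ : Seq → Seq
  (f ′) n = f (suc n)

  infixl 6 _⊕_
  _⊕_ : Seq → Seq → Seq
  (f ⊕ h) n = f n + h n

  ⊝_ : Seq → Seq
  (⊝ f) n = - f n

  𝟘 : Seq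
  𝟘 n = 0#

  -- The product of exponential generating functions:
  -- (f ⋆ h) n is the sum of C(n,k) f(k) h(n-k), here computed by Leibniz' rule.
  infixl 7 _⋆_
  _⋆_ : Seq → Seq → Seq
  (f ⋆ h) zero    = f 0 * h 0
  (f ⋆ h) (suc n) = (f ′ ⋆ h) n + (f ⋆ h ′) n

  -- The sequence whose exponential generating function is z^k/k!; `δ 0` is the unit of `⋆`.
  δ : ℕ → Seq
  δ zero    zero    = 1#
  δ zero    (suc n) = 0#
  δ (suc k) zero    = 0#
  δ (suc k) (suc n) = δ k n

  ⋆-cong-≤ : ∀ {f f₁ h h₁} n → (∀ k → k ℕ.≤ n → f k ≈ f₁ k) → (∀ k → k ℕ.≤ n → h k ≈ h₁ k) →
             (f ⋆ h) n ≈ (f₁ ⋆ h₁) n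
  ⋆-cong-≤ zero    p q = *-cong (p 0 ℕ.z≤n) (q 0 ℕ.z≤n)
  ⋆-cong-≤ (suc n) p q =
    +-cong (⋆-cong-≤ n (λ k k≤n → p (suc k) (ℕ.s≤s k≤n)) (λ k k≤n → q k (ℕ.m≤n⇒m≤1+n k≤n)))
           (⋆-cong-≤ n (λ k k≤n → p k (ℕ.m≤n⇒m≤1+n k≤n)) (λ k k≤n → q (suc k) (ℕ.s≤s k≤n)))

  ⋆-cong : ∀ {f f₁ h h₁} → f ≋ f₁ → h ≋ h₁ → f ⋆ h ≋ f₁ ⋆ h₁
  ⋆-cong p q n = ⋆-cong-≤ n (λ k _ → p k) (λ k _ → q k)

  ⋆-comm : ∀ f h → f ⋆ h ≋ h ⋆ f
  ⋆-comm f h zero    = *-comm (f 0) (h 0)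
  ⋆-comm f h (suc n) = trans (+-comm _ _) (+-cong (⋆-comm f (h ′) n) (⋆-comm (f ′) h n))

  ⋆-zeroˡ : ∀ f → 𝟘 ⋆ f ≋ 𝟘
  ⋆-zeroˡ f zero    = zeroˡ (f 0)
  ⋆-zeroˡ f (suc n) = trans (+-cong (⋆-zeroˡ f n) (⋆-zeroˡ (f ′) n)) (+-identityˡ 0#)

  ⋆-distribʳ : ∀ f h k → (h ⊕ k) ⋆ f ≋ h ⋆ f ⊕ k ⋆ f
  ⋆-distribʳ f h k zero    = distribʳ (f 0) (h 0) (k 0)
  ⋆-distribʳ f h k (suc n) = trans (+-cong (⋆-distribʳ f (h ′) (k ′) n) (⋆-distribʳ (f ′) h k n))
    (solve 4 (λ a b c d → (a :+ b) :+ (c :+ d) := (a :+ c) :+ (b :+ d)) refl _ _ _ _)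

  ⋆-distribˡ : ∀ f h k → f ⋆ (h ⊕ k) ≋ f ⋆ h ⊕ f ⋆ k
  ⋆-distribˡ f h k n = begin
    (f ⋆ (h ⊕ k)) n         ≈⟨ ⋆-comm f (h ⊕ k) n ⟩
    ((h ⊕ k) ⋆ f) n         ≈⟨ ⋆-distribʳ f h k n ⟩
    (h ⋆ f) n + (k ⋆ f) n   ≈⟨ +-cong (⋆-comm h f n) (⋆-comm k f n) ⟩
    (f ⋆ h) n + (f ⋆ k) n   ∎

  ⋆-assoc : ∀ f h k → (f ⋆ h) ⋆ k ≋ f ⋆ (h ⋆ k)
  ⋆-assoc f h k zero    = *-assoc (f 0) (h 0) (k 0)
  ⋆-assoc f h k (suc n) = begin
    ((f ′ ⋆ h ⊕ f ⋆ h ′) ⋆ k) n + ((f ⋆ h) ⋆ k ′) n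
      ≈⟨ +-congʳ (⋆-distribʳ k (f ′ ⋆ h) (f ⋆ h ′) n) ⟩
    (f ′ ⋆ h ⋆ k) n + (f ⋆ h ′ ⋆ k) n + (f ⋆ h ⋆ k ′) n
      ≈⟨ +-cong (+-cong (⋆-assoc (f ′) h k n) (⋆-assoc f (h ′) k n)) (⋆-assoc f h (k ′) n) ⟩
    (f ′ ⋆ (h ⋆ k)) n + (f ⋆ (h ′ ⋆ k)) n + (f ⋆ (h ⋆ k ′)) n
      ≈⟨ +-assoc _ _ _ ⟩
    (f ′ ⋆ (h ⋆ k)) n + ((f ⋆ (h ′ ⋆ k)) n + (f ⋆ (h ⋆ k ′)) n)
      ≈⟨ +-congˡ (⋆-distribˡ f (h ′ ⋆ k) (h ⋆ k ′) n) ⟨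
    (f ′ ⋆ (h ⋆ k)) n + (f ⋆ (h ′ ⋆ k ⊕ h ⋆ k ′)) n ∎

  ⋆-identityˡ : ∀ f → δ 0 ⋆ f ≋ f
  ⋆-identityˡ f zero    = *-identityˡ (f 0)
  ⋆-identityˡ f (suc n) = trans (+-cong (⋆-zeroˡ f n) (⋆-identityˡ (f ′) n)) (+-identityˡ (f (suc n)))

  hurwitzRing : CommutativeRing c ℓ
  hurwitzRing = record
    { Carrier = Seq
    ; _≈_     = _≋_
    ; _+_     = _⊕_
    ; _*_     = _⋆_
    ; -_      = ⊝_
    ; 0#      = 𝟘
    ; 1#      = δ 0
    ; isCommutativeRing = record
      { isRing = record
        { +-isAbelianGroup = record
          { isGroup = record
            { isMonoid = record
              { isSemigroup = record
                { isMagma = record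
                  { isEquivalence = record
                    { refl = λ n → refl ; sym = λ p n → sym (p n) ; trans = λ p q n → trans (p n) (q n) }
                  ; ∙-cong = λ p q n → +-cong (p n) (q n)
                  }
                ; assoc = λ f h k n → +-assoc (f n) (h n) (k n)
                }
              ; identity = (λ f n → +-identityˡ (f n)) , (λ f n → +-identityʳ (f n))
              }
            ; inverse = (λ f n → -‿inverseˡ (f n)) , (λ f n → -‿inverseʳ (f n))
            ; ⁻¹-cong = λ p n → -‿cong (p n)
            }
          ; comm = λ f h n → +-comm (f n) (h n)
          }
        ; *-cong = ⋆-cong
        ; *-assoc = ⋆-assoc
        ; *-identity = ⋆-identityˡ , λ f n → trans (⋆-comm f (δ 0) n) (⋆-identityˡ f n)
        ; distrib = ⋆-distribˡ , ⋆-distribʳ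
        }
      ; *-comm = ⋆-comm
      }
    }

  infixr 8 _⊙_
  _⊙_ : Carrier → Seq → Seq
  (a ⊙ f) n = a * f n

  ⊙-⋆ : ∀ a f h → (a ⊙ f) ⋆ h ≋ a ⊙ (f ⋆ h)
  ⊙-⋆ a f h zero    = *-assoc a (f 0) (h 0)
  ⊙-⋆ a f h (suc n) = trans (+-cong (⊙-⋆ a (f ′) h n) (⊙-⋆ a f (h ′) n)) (sym (distribˡ a _ _))

  -- Leibniz' rule becomes Pascal's rule for the factor, which is C(j+k,j). It is left existential
  -- because it is later absorbed into a constant.
  δ⋆δ : ∀ j k → ∃[ a ] (δ j ⋆ δ k ≋ a ⊙ δ (j ℕ.+ k))
  δ⋆δ zero    k       = 1# , λ n → trans (⋆-identityˡ (δ k) n) (sym (*-identityˡ _))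
  δ⋆δ (suc j) zero    rewrite ℕ.+-identityʳ j =
    1# , λ n → trans (⋆-comm (δ (suc j)) (δ 0) n)
                     (trans (⋆-identityˡ (δ (suc j)) n) (sym (*-identityˡ _)))
  δ⋆δ (suc j) (suc k) with δ⋆δ j (suc k) | δ⋆δ (suc j) k
  ... | a , p | b , q = a + b , eq
    where
    eq : δ (suc j) ⋆ δ (suc k) ≋ (a + b) ⊙ δ (suc j ℕ.+ suc k)
    eq zero    = trans (zeroˡ 0#) (sym (zeroʳ (a + b)))
    eq (suc n) = begin
      (δ j ⋆ δ (suc k)) n + (δ (suc j) ⋆ δ k) n   ≈⟨ +-cong (p n) (q n) ⟩
      a * δ (j ℕ.+ suc k) n + b * δ (suc j ℕ.+ k) n
        ≡⟨ ≡.cong (λ i → a * δ (j ℕ.+ suc k) n + b * δ i n) (≡.sym (ℕ.+-suc j k)) ⟩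
      a * δ (j ℕ.+ suc k) n + b * δ (j ℕ.+ suc k) n ≈⟨ distribʳ _ a b ⟨
      (a + b) * δ (j ℕ.+ suc k) n ∎

  -- Truncation modulo z^r. Recursing through `′` matches the recursion of `⋆`.
  τ : ℕ → Seq → Seq
  τ zero    f n       = 0#
  τ (suc r) f zero    = f 0
  τ (suc r) f (suc n) = τ r (f ′) n

  τ-< : ∀ r f {n} → n ℕ.< r → τ r f n ≈ f n
  τ-< (suc r) f {zero}  _           = refl
  τ-< (suc r) f {suc n} (ℕ.s≤s n<r) = τ-< r (f ′) n<r

  τ-≥ : ∀ r f {n} → r ℕ.≤ n → τ r f n ≈ 0#
  τ-≥ zero    f         _           = refl
  τ-≥ (suc r) f {suc n} (ℕ.s≤s r≤n) = τ-≥ r (f ′) r≤n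

  τ-cong : ∀ r {f h} → f ≋ h → τ r f ≋ τ r h
  τ-cong zero    p n       = refl
  τ-cong (suc r) p zero    = p 0
  τ-cong (suc r) p (suc n) = τ-cong r (λ k → p (suc k)) n

  τ-⊕ : ∀ r f h → τ r (f ⊕ h) ≋ τ r f ⊕ τ r h
  τ-⊕ zero    f h n       = sym (+-identityˡ 0#)
  τ-⊕ (suc r) f h zero    = refl
  τ-⊕ (suc r) f h (suc n) = τ-⊕ r (f ′) (h ′) n

  τ-suc : ∀ r f → τ (suc r) f ≋ τ r f ⊕ f r ⊙ δ r
  τ-suc zero    f zero    = sym (trans (+-identityˡ _) (*-identityʳ (f 0)))
  τ-suc zero    f (suc n) = sym (trans (+-identityˡ _) (zeroʳ (f 0)))
  τ-suc (suc r) f zero    = sym (trans (+-congˡ (zeroʳ (f (suc r)))) (+-identityʳ (f 0)))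
  τ-suc (suc r) f (suc n) = τ-suc r (f ′) n

  -- The induction step for products with a truncation: it writes `τ r f ⋆ h` as the sum over k < r
  -- of `f k ⊙ (δ k ⋆ h)`.
  τ-suc-⋆ : ∀ r f h → τ (suc r) f ⋆ h ≋ τ r f ⋆ h ⊕ f r ⊙ (δ r ⋆ h)
  τ-suc-⋆ r f h n = begin
    (τ (suc r) f ⋆ h) n                         ≈⟨ ⋆-cong {h = h} (τ-suc r f) (λ _ → refl) n ⟩
    ((τ r f ⊕ f r ⊙ δ r) ⋆ h) n                 ≈⟨ ⋆-distribʳ h (τ r f) (f r ⊙ δ r) n ⟩
    (τ r f ⋆ h) n + ((f r ⊙ δ r) ⋆ h) n         ≈⟨ +-congˡ (⊙-⋆ (f r) (δ r) h n) ⟩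
    (τ r f ⋆ h) n + f r * (δ r ⋆ h) n           ∎

  -- A count of degrees: the factors have degrees at most r-1 and s-1, so the product vanishes from
  -- index r+s-1 on.
  τ⋆τ-≥ : ∀ r s f h n → r ℕ.+ s ℕ.≤ suc n → (τ r f ⋆ τ s h) n ≈ 0#
  τ⋆τ-≥ zero    s       f h n       _  = ⋆-zeroˡ (τ s h) n
  τ⋆τ-≥ (suc r) zero    f h n       _  = trans (⋆-comm (τ (suc r) f) 𝟘 n) (⋆-zeroˡ (τ (suc r) f) n)
  τ⋆τ-≥ (suc r) (suc s) f h zero    (ℕ.s≤s le) with () ← ≡.subst (ℕ._≤ 0) (ℕ.+-suc r s) le
  τ⋆τ-≥ (suc r) (suc s) f h (suc n) (ℕ.s≤s le) =
    trans (+-cong (τ⋆τ-≥ r (suc s) (f ′) h n le)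
                  (τ⋆τ-≥ (suc r) s f (h ′) n (≡.subst (ℕ._≤ suc n) (ℕ.+-suc r s) le)))
          (+-identityˡ 0#)

  τ⋆τ-< : ∀ r f h n → n ℕ.< r → (τ r f ⋆ τ r h) n ≈ (f ⋆ h) n
  τ⋆τ-< r f h n n<r = ⋆-cong-≤ n (λ k k≤n → τ-< r f (ℕ.≤-<-trans k≤n n<r))
                                 (λ k k≤n → τ-< r h (ℕ.≤-<-trans k≤n n<r))

  private module I = RingIdentities hurwitzRing

  -- From here on, the identities of `RingIdentities` are restated with the operations of
  -- `hurwitzRing` spelled out as `⋆`, `⊕` and `⊝`.
  ⋆-[a-b]k : ∀ a b k → (a ⊕ ⊝ b) ⋆ k ≋ a ⋆ k ⊕ ⊝ (b ⋆ k)
  ⋆-[a-b]k = I.[a-b]k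

  ⋆-tails-product : ∀ f h f₁ h₁ →
    (f ⊕ ⊝ f₁) ⋆ (h ⊕ ⊝ h₁) ≋ (f ⋆ h ⊕ ⊝ (f₁ ⋆ h ⊕ f ⋆ h₁)) ⊕ f₁ ⋆ h₁
  ⋆-tails-product = I.tails-product

  ⋆-product-rule : ∀ f h f₁ h₁ c d t u v →
    (f ⋆ h ⊕ ⊝ (f₁ ⋆ h ⊕ f ⋆ h₁))
      ⊕ ((f₁ ⋆ (h ⊕ ⊝ (d ⋆ t)) ⊕ h₁ ⋆ (f ⊕ ⊝ (c ⋆ t)))
        ⊕ ((f₁ ⋆ d ⋆ t ⊕ ⊝ (u ⋆ t)) ⊕ (c ⋆ h₁ ⋆ t ⊕ ⊝ (v ⋆ t))))
    ≋ f ⋆ h ⊕ ⊝ ((u ⊕ v) ⋆ t)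
  ⋆-product-rule = I.product-rule

  ⋆-inverse-rule₁ : ∀ a t u t₁ v w →
    u ⊕ ⊝ (u ⋆ (a ⋆ t ⊕ ⊝ (u ⋆ t ⊕ a ⋆ t₁))
             ⊕ ((u ⋆ t₁ ⋆ a ⊕ ⊝ (w ⋆ a)) ⊕ (u ⋆ u ⋆ t ⊕ ⊝ (v ⋆ t))))
    ≋ (u ⊕ ⊝ (u ⋆ (a ⋆ t))) ⊕ (w ⋆ a ⊕ v ⋆ t)
  ⋆-inverse-rule₁ = I.inverse-rule₁

  ⋆-inverse-rule₂ : ∀ a t u v →
    (u ⊕ ⊝ (u ⋆ δ 0)) ⊕ (δ 0 ⋆ a ⊕ v ⋆ t) ≋ a ⊕ ⊝ ((⊝ v) ⋆ t)
  ⋆-inverse-rule₂ = I.inverse-rule₂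

  ⋆-[1-a]t : ∀ a t → (δ 0 ⊕ ⊝ a) ⋆ t ≋ t ⊕ ⊝ (a ⋆ t)
  ⋆-[1-a]t = I.[1-a]t

  ⋆-1-[1-a--vt] : ∀ a v t → δ 0 ⊕ ⊝ ((δ 0 ⊕ ⊝ a) ⊕ ⊝ ((⊝ v) ⋆ t)) ≋ a ⊕ ⊝ (v ⋆ t)
  ⋆-1-[1-a--vt] = I.1-[1-a--vt]

  ⋆-[1-a][1-a]b : ∀ a b →
    (δ 0 ⊕ ⊝ a) ⋆ (δ 0 ⊕ ⊝ a) ⋆ b ≋ b ⊕ ⊝ (a ⋆ b ⊕ a ⋆ b) ⊕ a ⋆ (a ⋆ b)
  ⋆-[1-a][1-a]b = I.[1-a][1-a]b

  ⋆-identityʳ : ∀ f → f ⋆ δ 0 ≋ f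
  ⋆-identityʳ f n = trans (⋆-comm f (δ 0) n) (⋆-identityˡ f n)

-- Inequalities in a constructive ordered field.

module OrderedField {c ℓ₁ ℓ₂} (ℝ : Reals c ℓ₁ ℓ₂) where
  open Reals ℝ
  open RealNotation ℝ
  open CommutativeRing commutativeRing using (ring; setoid)
  open Algebra.Properties.Ring ring using (-‿involutive; -‿+-comm)
  private module < = IsStrictPartialOrder isStrictPartialOrder
  open RingSolver commutativeRing using (solve; _:=_; _:+_; _:*_; _:-_; :-_; :0)

  ≤-reflexive : ∀ {x y} → x ≈ y → x ≤ y
  ≤-reflexive x≈y = <.irrefl (sym x≈y)

  ≤-refl : ∀ {x} → x ≤ x
  ≤-refl = ≤-reflexive refl

  <⇒≤ : ∀ {x y} → x < y → x ≤ y
  <⇒≤ = <.asym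

  -- In place of trichotomy, cotransitivity of apartness separates `z` from `x` or from `y`; of the
  -- two resulting orders, one always contradicts `y ≤ z`.
  <-≤-trans : ∀ {x y z} → x < y → y ≤ z → x < z
  <-≤-trans {z = z} x<y y≤z with #-cotrans (<⇒# x<y) z
  ... | inj₁ x#z with #⇒<⊎> x#z
  ...   | inj₁ x<z = x<z
  ...   | inj₂ z<x = contradiction (<.trans z<x x<y) y≤z
  <-≤-trans x<y y≤z | inj₂ z#y with #⇒<⊎> z#y
  ...   | inj₁ z<y = contradiction z<y y≤z
  ...   | inj₂ y<z = <.trans x<y y<z

  ≤-<-trans : ∀ {x y z} → x ≤ y → y < z → x < z
  ≤-<-trans {x} x≤y y<z with #-cotrans (<⇒# y<z) x
  ... | inj₂ x#z with #⇒<⊎> x#z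
  ...   | inj₁ x<z = x<z
  ...   | inj₂ z<x = contradiction (<.trans y<z z<x) x≤y
  ≤-<-trans x≤y y<z | inj₁ y#x with #⇒<⊎> y#x
  ...   | inj₁ y<x = contradiction y<x x≤y
  ...   | inj₂ x<y = <.trans x<y y<z

  ≤-trans : ∀ {x y z} → x ≤ y → y ≤ z → x ≤ z
  ≤-trans x≤y y≤z z<x = y≤z (<-≤-trans z<x x≤y)

  ≤-antisym : ∀ {x y} → x ≤ y → y ≤ x → x ≈ y
  ≤-antisym {x} {y} x≤y y≤x = proj₁ (tight x y) λ x#y → case# (#⇒<⊎> x#y)
    where
    case# : ¬ (x < y ⊎ y < x)
    case# (inj₁ x<y) = y≤x x<y
    case# (inj₂ y<x) = x≤y y<x

  ≤-isPreorder : IsPreorder _≈_ _≤_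
  ≤-isPreorder = record
    { isEquivalence = <.isEquivalence ; reflexive = ≤-reflexive ; trans = ≤-trans }

  module ≤-Reasoning = Relation.Binary.Reasoning.Base.Triple
    ≤-isPreorder <.asym <.trans <.<-resp-≈ <⇒≤ <-≤-trans ≤-<-trans
    hiding (step-≈; step-≈˘)

  open ≤-Reasoning

  +-monoˡ-≤ : ∀ {x y} z → x ≤ y → x + z ≤ y + z
  +-monoˡ-≤ {x} {y} z x≤y y+z<x+z =
    x≤y (<.<-respˡ-≈ (lem y) (<.<-respʳ-≈ (lem x) (+-monoˡ-< (- z) y+z<x+z)))
    where
    lem : ∀ w → w + z - z ≈ w
    lem w = solve 2 (λ w z → w :+ z :- z := w) refl w z

  +-monoʳ-≤ : ∀ {x y} z → x ≤ y → z + x ≤ z + y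
  +-monoʳ-≤ {x} {y} z x≤y = begin
    z + x ≈⟨ +-comm z x ⟩
    x + z ≤⟨ +-monoˡ-≤ z x≤y ⟩
    y + z ≈⟨ +-comm y z ⟩
    z + y ∎

  +-mono-≤ : ∀ {x y u v} → x ≤ y → u ≤ v → x + u ≤ y + v
  +-mono-≤ {y = y} {u} x≤y u≤v = ≤-trans (+-monoˡ-≤ u x≤y) (+-monoʳ-≤ y u≤v)

  +-nonneg : ∀ {x y} → 0# ≤ x → 0# ≤ y → 0# ≤ x + y
  +-nonneg {x} {y} 0≤x 0≤y = begin
    0#      ≈⟨ +-identityˡ 0# ⟨
    0# + 0# ≤⟨ +-mono-≤ 0≤x 0≤y ⟩
    x + y   ∎

  x≤y⇒0≤y-x : ∀ {x y} → x ≤ y → 0# ≤ y - x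
  x≤y⇒0≤y-x {x} {y} x≤y = begin
    0#    ≈⟨ -‿inverseʳ x ⟨
    x - x ≤⟨ +-monoˡ-≤ (- x) x≤y ⟩
    y - x ∎

  0≤y-x⇒x≤y : ∀ {x y} → 0# ≤ y - x → x ≤ y
  0≤y-x⇒x≤y {x} {y} 0≤y-x = begin
    x         ≈⟨ +-identityˡ x ⟨
    0# + x    ≤⟨ +-monoˡ-≤ x 0≤y-x ⟩
    y - x + x ≈⟨ solve 2 (λ x y → y :- x :+ x := y) refl x y ⟩
    y         ∎

  -‿mono-≤ : ∀ {x y} → x ≤ y → - y ≤ - x
  -‿mono-≤ {x} {y} x≤y = 0≤y-x⇒x≤y $ begin
    0#        ≤⟨ x≤y⇒0≤y-x x≤y ⟩
    y - x     ≈⟨ solve 2 (λ x y → y :- x := :- x :- :- y) refl x y ⟩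
    - x - - y ∎

  *#0⇒#0 : ∀ {x y} → x * y # 0# → x # 0#
  *#0⇒#0 {x} {y} xy#0 with z , _ , xyz≈1 ← #⇒invertible xy#0 = invertible⇒# (y * z , yz*x , x*yz)
    where
    x*yz : (x - 0#) * (y * z) ≈ 1#
    x*yz = trans (solve 3 (λ x y z → (x :- :0) :* (y :* z) := (x :* y :- :0) :* z) refl x y z) xyz≈1
    yz*x : (y * z) * (x - 0#) ≈ 1#
    yz*x = trans (*-comm _ _) x*yz

  0≤x∧x#0⇒0<x : ∀ {x} → 0# ≤ x → x # 0# → 0# < x
  0≤x∧x#0⇒0<x 0≤x x#0 with #⇒<⊎> x#0
  ... | inj₁ x<0 = contradiction x<0 0≤x
  ... | inj₂ 0<x = 0<x

  -- If xy < 0 then xy is invertible, hence so are x and y. Being nonnegative they are then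
  -- positive, and so is xy.
  *-nonneg : ∀ {x y} → 0# ≤ x → 0# ≤ y → 0# ≤ x * y
  *-nonneg {x} {y} 0≤x 0≤y xy<0 = <.asym xy<0
    (*-pos (0≤x∧x#0⇒0<x 0≤x (*#0⇒#0 (<⇒# xy<0)))
           (0≤x∧x#0⇒0<x 0≤y (*#0⇒#0 (<⇒# (<.<-respˡ-≈ (*-comm x y) xy<0)))))

  *-monoˡ-≤ : ∀ {x y z} → 0# ≤ z → x ≤ y → z * x ≤ z * y
  *-monoˡ-≤ {x} {y} {z} 0≤z x≤y = 0≤y-x⇒x≤y $ begin
    0#            ≤⟨ *-nonneg 0≤z (x≤y⇒0≤y-x x≤y) ⟩
    z * (y - x)   ≈⟨ solve 3 (λ x y z → z :* (y :- x) := z :* y :- z :* x) refl x y z ⟩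
    z * y - z * x ∎

  *-monoʳ-≤ : ∀ {x y z} → 0# ≤ z → x ≤ y → x * z ≤ y * z
  *-monoʳ-≤ {x} {y} {z} 0≤z x≤y = begin
    x * z ≈⟨ *-comm x z ⟩
    z * x ≤⟨ *-monoˡ-≤ 0≤z x≤y ⟩
    z * y ≈⟨ *-comm z y ⟩
    y * z ∎

  *-mono-≤ : ∀ {x y u v} → 0# ≤ x → 0# ≤ v → x ≤ y → u ≤ v → x * u ≤ y * v
  *-mono-≤ 0≤x 0≤v x≤y u≤v = ≤-trans (*-monoˡ-≤ 0≤x u≤v) (*-monoʳ-≤ 0≤v x≤y)

  *-cancelˡ-≤ : ∀ {x y z} → 0# < z → z * x ≤ z * y → x ≤ y
  *-cancelˡ-≤ {x} {y} {z} 0<z zx≤zy y<x = zx≤zy $ begin-strict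
    z * y             ≈⟨ +-identityˡ (z * y) ⟨
    0# + z * y        <⟨ +-monoˡ-< (z * y) (*-pos 0<z (x<y⇒0<y-x y<x)) ⟩
    z * (x - y) + z * y ≈⟨ solve 3 (λ x y z → z :* (x :- y) :+ z :* y := z :* x) refl x y z ⟩
    z * x             ∎

  0≤x+x⇒0≤x : ∀ {x} → 0# ≤ x + x → 0# ≤ x
  0≤x+x⇒0≤x {x} 0≤x+x x<0 = 0≤x+x $ begin-strict
    x + x  <⟨ +-monoˡ-< x x<0 ⟩
    0# + x ≈⟨ +-identityˡ x ⟩
    x      <⟨ x<0 ⟩
    0#     ∎

  x≤∣x∣ : ∀ x → x ≤ ∣ x ∣
  x≤∣x∣ x = proj₁ (supremum x (- x))

  -x≤∣x∣ : ∀ x → - x ≤ ∣ x ∣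
  -x≤∣x∣ x = proj₁ (proj₂ (supremum x (- x)))

  ∣x∣≤ : ∀ {x y} → x ≤ y → - x ≤ y → ∣ x ∣ ≤ y
  ∣x∣≤ {x} {y} = λ p q → proj₂ (proj₂ (supremum x (- x))) y p q

  0≤∣x∣ : ∀ x → 0# ≤ ∣ x ∣
  0≤∣x∣ x = 0≤x+x⇒0≤x $ begin
    0#            ≈⟨ -‿inverseʳ x ⟨
    x - x         ≤⟨ +-mono-≤ (x≤∣x∣ x) (-x≤∣x∣ x) ⟩
    ∣ x ∣ + ∣ x ∣ ∎

  ∣∣-mono-≈ : ∀ {x y} → x ≈ y → ∣ x ∣ ≤ ∣ y ∣
  ∣∣-mono-≈ {x} {y} x≈y = ∣x∣≤ (≤-trans (≤-reflexive x≈y) (x≤∣x∣ y))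
                            (≤-trans (≤-reflexive (-‿cong x≈y)) (-x≤∣x∣ y))

  ∣∣-cong : ∀ {x y} → x ≈ y → ∣ x ∣ ≈ ∣ y ∣
  ∣∣-cong x≈y = ≤-antisym (∣∣-mono-≈ x≈y) (∣∣-mono-≈ (sym x≈y))

  0≤x⇒∣x∣≈x : ∀ {x} → 0# ≤ x → ∣ x ∣ ≈ x
  0≤x⇒∣x∣≈x {x} 0≤x = ≤-antisym (∣x∣≤ ≤-refl (begin
    - x    ≤⟨ -‿mono-≤ 0≤x ⟩
    - 0#   ≈⟨ solve 0 (:- :0 := :0) refl ⟩
    0#     ≤⟨ 0≤x ⟩
    x      ∎)) (x≤∣x∣ x)

  ∣-x∣≤∣x∣ : ∀ x → ∣ - x ∣ ≤ ∣ x ∣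
  ∣-x∣≤∣x∣ x = ∣x∣≤ (-x≤∣x∣ x) (≤-trans (≤-reflexive (-‿involutive x)) (x≤∣x∣ x))

  ∣x+y∣≤∣x∣+∣y∣ : ∀ x y → ∣ x + y ∣ ≤ ∣ x ∣ + ∣ y ∣
  ∣x+y∣≤∣x∣+∣y∣ x y = ∣x∣≤ (+-mono-≤ (x≤∣x∣ x) (x≤∣x∣ y)) (begin
    - (x + y)     ≈⟨ -‿+-comm x y ⟨
    - x + - y     ≤⟨ +-mono-≤ (-x≤∣x∣ x) (-x≤∣x∣ y) ⟩
    ∣ x ∣ + ∣ y ∣ ∎)

  -- Twice the difference is (∣x∣ - x)(∣y∣ + y) + (∣x∣ + x)(∣y∣ - y).
  x*y≤∣x∣*∣y∣ : ∀ x y → x * y ≤ ∣ x ∣ * ∣ y ∣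
  x*y≤∣x∣*∣y∣ x y = 0≤y-x⇒x≤y $ 0≤x+x⇒0≤x $ begin
    0#
      ≤⟨ +-nonneg (*-nonneg (x≤y⇒0≤y-x (x≤∣x∣ x)) (0≤+ y))
                  (*-nonneg (0≤+ x) (x≤y⇒0≤y-x (x≤∣x∣ y))) ⟩
    (∣ x ∣ - x) * (∣ y ∣ + y) + (∣ x ∣ + x) * (∣ y ∣ - y)
      ≈⟨ solve 4 (λ x y a b → (a :- x) :* (b :+ y) :+ (a :+ x) :* (b :- y)
                            := (a :* b :- x :* y) :+ (a :* b :- x :* y)) refl x y ∣ x ∣ ∣ y ∣ ⟩
    (∣ x ∣ * ∣ y ∣ - x * y) + (∣ x ∣ * ∣ y ∣ - x * y) ∎
    where
    0≤+ : ∀ z → 0# ≤ ∣ z ∣ + z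
    0≤+ z = ≤-trans (x≤y⇒0≤y-x (-x≤∣x∣ z)) (≤-reflexive (+-congˡ (-‿involutive z)))

  ∣x*y∣≤∣x∣*∣y∣ : ∀ x y → ∣ x * y ∣ ≤ ∣ x ∣ * ∣ y ∣
  ∣x*y∣≤∣x∣*∣y∣ x y = ∣x∣≤ (x*y≤∣x∣*∣y∣ x y) (begin
    - (x * y)       ≈⟨ solve 2 (λ x y → :- (x :* y) := (:- x) :* y) refl x y ⟩
    - x * y         ≤⟨ x*y≤∣x∣*∣y∣ (- x) y ⟩
    ∣ - x ∣ * ∣ y ∣ ≤⟨ *-monoʳ-≤ (0≤∣x∣ y) (∣-x∣≤∣x∣ x) ⟩
    ∣ x ∣ * ∣ y ∣   ∎)

  0≤1 : 0# ≤ 1#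
  0≤1 = <⇒≤ 0<1

  fromℕ-1 : fromℕ 1 ≈ 1#
  fromℕ-1 = +-identityʳ 1#

  module Mult = Algebra.Properties.Semiring.Mult semiring

  fromℕ-+ : ∀ m n → fromℕ (m ℕ.+ n) ≈ fromℕ m + fromℕ n
  fromℕ-+ = Mult.×-homo-+ 1#

  fromℕ-* : ∀ m n → fromℕ (m ℕ.* n) ≈ fromℕ m * fromℕ n
  fromℕ-* = Mult.×1-homo-*

  0≤fromℕ : ∀ n → 0# ≤ fromℕ n
  0≤fromℕ zero    = ≤-refl
  0≤fromℕ (suc n) = +-nonneg 0≤1 (0≤fromℕ n)

  fromℕ-mono : ∀ {m n} → m ℕ.≤ n → fromℕ m ≤ fromℕ n
  fromℕ-mono {n = n} ℕ.z≤n       = 0≤fromℕ n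
  fromℕ-mono {suc m} {suc n} (ℕ.s≤s m≤n) = +-monoʳ-≤ 1# (fromℕ-mono {m} {n} m≤n)

  0<fromℕ-suc : ∀ n → 0# < fromℕ (suc n)
  0<fromℕ-suc n = <-≤-trans 0<1 (≤-trans (≤-reflexive (sym fromℕ-1)) (fromℕ-mono {1} {suc n} (ℕ.s≤s ℕ.z≤n)))

  recip-inverse : ∀ x (0<x : 0# < x) → recip x 0<x * x ≈ 1#
  recip-inverse x 0<x =
    trans (*-congˡ (solve 1 (λ x → x := x :- :0) refl x)) (proj₁ (proj₂ (#⇒invertible (#-sym (<⇒# 0<x)))))

  0≤recip : ∀ x (0<x : 0# < x) → 0# ≤ recip x 0<x
  0≤recip x 0<x r<0 = <.asym 0<1 $ begin-strict
    1#     ≈⟨ recip-inverse x 0<x ⟨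
    r * x  ≈⟨ solve 2 (λ r x → r :* x := :- ((:0 :- r) :* x)) refl r x ⟩
    - y    ≈⟨ +-identityˡ (- y) ⟨
    0# - y <⟨ +-monoˡ-< (- y) (*-pos (x<y⇒0<y-x r<0) 0<x) ⟩
    y - y  ≈⟨ -‿inverseʳ y ⟩
    0#     ∎
    where
    r = recip x 0<x
    y = (0# - r) * x

  *-cancelˡ-≈ : ∀ {x y z} → 0# < z → z * x ≈ z * y → x ≈ y
  *-cancelˡ-≈ 0<z zx≈zy = ≤-antisym (*-cancelˡ-≤ 0<z (≤-reflexive zx≈zy))
                                    (*-cancelˡ-≤ 0<z (≤-reflexive (sym zx≈zy)))

  module Exp = Algebra.Properties.Semiring.Exp semiring

  ^-nonneg : ∀ {x} → 0# ≤ x → ∀ n → 0# ≤ x ^ n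
  ^-nonneg 0≤x zero    = 0≤1
  ^-nonneg 0≤x (suc n) = *-nonneg 0≤x (^-nonneg 0≤x n)

  ^-mono-≤ : ∀ {x y} → 0# ≤ x → x ≤ y → ∀ n → x ^ n ≤ y ^ n
  ^-mono-≤ 0≤x x≤y zero    = ≤-refl
  ^-mono-≤ 0≤x x≤y (suc n) =
    *-mono-≤ 0≤x (^-nonneg (≤-trans 0≤x x≤y) n) x≤y (^-mono-≤ 0≤x x≤y n)

  fromℕ-^ : ∀ m n → fromℕ (m ℕ.^ n) ≈ fromℕ m ^ n
  fromℕ-^ m zero    = fromℕ-1
  fromℕ-^ m (suc n) = trans (fromℕ-* m (m ℕ.^ n)) (*-congˡ (fromℕ-^ m n))

-- Binomial coefficients and powers of two.

module Naturals where
  open import Data.Nat.Combinatorics using (_C_)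
  open import Data.Nat.Base using (_+_; _*_; _^_; _∸_; _≤_; _<_; z≤n; s≤s)
  open ≡ using (refl; cong; cong₂; sym; trans)
  open Data.Nat.Solver.+-*-Solver

  nC0≡1 : ∀ n → n C 0 ≡ 1
  nC0≡1 n = trans (nCk≡nC[n∸k] {n = n} z≤n) (nCn≡1 n)

  C-sym : ∀ a b → (a + b) C a ≡ (b + a) C b
  C-sym a b = trans (nCk≡nC[n∸k] (ℕ.m≤m+n a b)) (cong₂ _C_ (ℕ.+-comm a b) (ℕ.m+n∸m≡n a b))

  C-absorption : ∀ n k → suc k * (suc n C suc k) ≡ suc n * (n C k)
  C-absorption zero    zero    = refl
  C-absorption zero    (suc k) = trans
    (cong (suc (suc k) *_) (k>n⇒nCk≡0 {1} {suc (suc k)} (s≤s (s≤s z≤n))))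
    (trans (ℕ.*-zeroʳ (suc (suc k))) (sym (cong (1 *_) (k>n⇒nCk≡0 {0} {suc k} (s≤s z≤n)))))
  C-absorption (suc n) zero    = begin
    1 * (suc (suc n) C 1)               ≡⟨ cong (1 *_) (nCk+nC[k+1]≡[n+1]C[k+1] (suc n) 0) ⟨
    1 * (suc n C 0 + suc n C 1)         ≡⟨ cong₂ (λ x y → 1 * (x + y)) (nC0≡1 (suc n)) (sym (ℕ.*-identityˡ _)) ⟩
    1 * (1 + 1 * (suc n C 1))           ≡⟨ cong (λ x → 1 * (1 + x)) (C-absorption n zero) ⟩
    1 * (1 + suc n * (n C 0))           ≡⟨ cong (λ x → 1 * (1 + suc n * x)) (nC0≡1 n) ⟩
    1 * (1 + suc n * 1)                 ≡⟨ ℕ.*-identityˡ _ ⟩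
    1 + suc n * 1                       ≡⟨⟩
    suc (suc n) * 1                     ≡⟨ cong (suc (suc n) *_) (nC0≡1 (suc n)) ⟨
    suc (suc n) * (suc n C 0)           ∎
    where open ≡.≡-Reasoning
  C-absorption (suc n) (suc k) = begin
    suc (suc k) * (suc (suc n) C suc (suc k))
      ≡⟨ cong (suc (suc k) *_) (nCk+nC[k+1]≡[n+1]C[k+1] (suc n) (suc k)) ⟨
    suc (suc k) * (A + suc n C suc (suc k))
      ≡⟨ ℕ.*-distribˡ-+ (suc (suc k)) A _ ⟩
    suc (suc k) * A + suc (suc k) * (suc n C suc (suc k))
      ≡⟨ cong (suc (suc k) * A +_) (C-absorption n (suc k)) ⟩
    (A + suc k * A) + suc n * (n C suc k)
      ≡⟨ cong (λ x → (A + x) + suc n * (n C suc k)) (C-absorption n k) ⟩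
    (A + suc n * (n C k)) + suc n * (n C suc k)
      ≡⟨ solve 4 (λ A m x y → (A :+ m :* x) :+ m :* y := A :+ m :* (x :+ y)) refl A (suc n) (n C k) (n C suc k) ⟩
    A + suc n * (n C k + n C suc k)
      ≡⟨ cong (λ x → A + suc n * x) (nCk+nC[k+1]≡[n+1]C[k+1] n k) ⟩
    suc (suc n) * A ∎
    where
    open ≡.≡-Reasoning
    A = suc n C suc k

  -- With n = r+1+d, Pascal's rule and absorption give (r+1)(C(n,r) + C(n,r+1)) = (n+1) C(n,r).
  -- Cancelling (r+1) C(n,r) leaves the factor n-r = d+1.
  C-ratio : ∀ r d → suc r * ((suc r + d) C suc r) ≡ suc d * ((suc r + d) C r)
  C-ratio r d = ℕ.+-cancelʳ-≡ (suc r * c) _ _ (begin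
    suc r * ((suc r + d) C suc r) + suc r * c ≡⟨ ℕ.+-comm (suc r * ((suc r + d) C suc r)) (suc r * c) ⟩
    suc r * c + suc r * ((suc r + d) C suc r) ≡⟨ ℕ.*-distribˡ-+ (suc r) c _ ⟨
    suc r * (c + (suc r + d) C suc r)         ≡⟨ cong (suc r *_) (nCk+nC[k+1]≡[n+1]C[k+1] (suc r + d) r) ⟩
    suc r * (suc (suc r + d) C suc r)         ≡⟨ C-absorption (suc r + d) r ⟩
    suc (suc r + d) * c
      ≡⟨ solve 3 (λ r d c → (con 2 :+ (r :+ d)) :* c := (con 1 :+ d) :* c :+ (con 1 :+ r) :* c) refl r d c ⟩
    suc d * c + suc r * c ∎)
    where
    open ≡.≡-Reasoning
    c = (suc r + d) C r

  n<2^n : ∀ n → n < 2 ^ n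
  n<2^n zero    = s≤s z≤n
  n<2^n (suc n) = begin-strict
    suc n             ≤⟨ n<2^n n ⟩
    2 ^ n             <⟨ ℕ.m<m+n (2 ^ n) (ℕ.m^n>0 2 n) ⟩
    2 ^ n + 2 ^ n     ≡⟨ cong (2 ^ n +_) (ℕ.+-identityʳ (2 ^ n)) ⟨
    2 ^ suc n         ∎
    where open ℕ.≤-Reasoning

  -- Lets one power of two absorb two linear factors: a ratio of binomial coefficients, together
  -- with either 1/ε or the number of terms of a sum.
  n*n≤2^[1+n] : ∀ n → n * n ≤ 2 ^ suc n
  n*n≤2^[1+n] zero    = z≤n
  n*n≤2^[1+n] (suc n) = begin
    suc n * suc n           ≡⟨ solve 1 (λ n → (con 1 :+ n) :* (con 1 :+ n) := n :* n :+ (con 1 :+ con 2 :* n)) refl n ⟩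
    n * n + suc (2 * n)     ≤⟨ ℕ.+-mono-≤ (n*n≤2^[1+n] n) (ℕ.n≤1+n (suc (2 * n))) ⟩
    2 ^ suc n + suc (suc (2 * n))
      ≡⟨ cong (2 ^ suc n +_) (solve 1 (λ n → con 2 :+ con 2 :* n := con 2 :* (con 1 :+ n)) refl n) ⟩
    2 ^ suc n + 2 * suc n   ≤⟨ ℕ.+-monoʳ-≤ (2 ^ suc n) (ℕ.*-monoʳ-≤ 2 (n<2^n n)) ⟩
    2 ^ suc n + 2 ^ suc n   ≡⟨ cong (2 ^ suc n +_) (ℕ.+-identityʳ (2 ^ suc n)) ⟨
    2 ^ suc (suc n)         ∎
    where open ℕ.≤-Reasoning

-- Asymptotic calculus for sequences bounded by x^C(n,2).

module Gargantuan {c ℓ₁ ℓ₂} (ℝ : Reals c ℓ₁ ℓ₂)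
                  (x : Reals.Carrier ℝ) (2≤x : Reals._≤_ ℝ (Reals.fromℕ ℝ 2) x) where
  open import Data.Nat.Combinatorics using (_C_)
  open Reals ℝ
  open OrderedField ℝ
  open Hurwitz commutativeRing
  open RingSolver commutativeRing using (solve; _:=_; _:+_; _:*_; _:-_; :0; :1)
  open ≤-Reasoning
  open Naturals
  private module N = Data.Nat.Solver.+-*-Solver

  ⋆-nonneg : ∀ {f h} → (∀ n → 0# ≤ f n) → (∀ n → 0# ≤ h n) → ∀ n → 0# ≤ (f ⋆ h) n
  ⋆-nonneg p q zero    = *-nonneg (p 0) (q 0)
  ⋆-nonneg p q (suc n) = +-nonneg (⋆-nonneg (λ k → p (suc k)) q n) (⋆-nonneg p (λ k → q (suc k)) n)

  ∣⋆∣-mono : ∀ {f h F H} → (∀ n → ∣ f n ∣ ≤ F n) → (∀ n → ∣ h n ∣ ≤ H n) →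
             ∀ n → ∣ (f ⋆ h) n ∣ ≤ (F ⋆ H) n
  ∣⋆∣-mono {f} {h} p q zero    = ≤-trans (∣x*y∣≤∣x∣*∣y∣ (f 0) (h 0))
    (*-mono-≤ (0≤∣x∣ (f 0)) (≤-trans (0≤∣x∣ (h 0)) (q 0)) (p 0) (q 0))
  ∣⋆∣-mono {f} {h} p q (suc n) = ≤-trans (∣x+y∣≤∣x∣+∣y∣ _ _)
    (+-mono-≤ (∣⋆∣-mono (λ k → p (suc k)) q n) (∣⋆∣-mono p (λ k → q (suc k)) n))

  ⋆-mono : ∀ {f h F H} → (∀ n → 0# ≤ f n) → (∀ n → 0# ≤ H n) →
           (∀ n → f n ≤ F n) → (∀ n → h n ≤ H n) → ∀ n → (f ⋆ h) n ≤ (F ⋆ H) n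
  ⋆-mono a b p q zero    = *-mono-≤ (a 0) (b 0) (p 0) (q 0)
  ⋆-mono a b p q (suc n) =
    +-mono-≤ (⋆-mono (λ k → a (suc k)) b (λ k → p (suc k)) q n)
             (⋆-mono a (λ k → b (suc k)) p (λ k → q (suc k)) n)

  C>⇒0 : ∀ {n k} a → n ℕ.< k → fromℕ (n C k) * a ≈ 0#
  C>⇒0 {n} {k} a n<k = begin-equality
    fromℕ (n C k) * a ≡⟨ ≡.cong (λ i → fromℕ i * a) (k>n⇒nCk≡0 n<k) ⟩
    0# * a            ≈⟨ zeroˡ a ⟩
    0#                ∎

  δ-⋆ : ∀ k f n → (δ k ⋆ f) n ≈ fromℕ (n C k) * f (n ℕ.∸ k)
  δ-⋆ zero    f n       = begin-equality
    (δ 0 ⋆ f) n             ≈⟨ ⋆-identityˡ f n ⟩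
    f n                     ≈⟨ *-identityˡ (f n) ⟨
    1# * f n                ≈⟨ *-congʳ fromℕ-1 ⟨
    fromℕ 1 * f n           ≡⟨ ≡.cong (λ i → fromℕ i * f n) (nC0≡1 n) ⟨
    fromℕ (n C 0) * f n     ∎
  δ-⋆ (suc k) f zero    = trans (zeroˡ (f 0)) (sym (C>⇒0 {0} {suc k} _ (ℕ.s≤s ℕ.z≤n)))
  δ-⋆ (suc k) f (suc n) = begin-equality
    (δ k ⋆ f) n + (δ (suc k) ⋆ f ′) n
      ≈⟨ +-cong (δ-⋆ k f n) (δ-⋆ (suc k) (f ′) n) ⟩
    fromℕ (n C k) * f (n ℕ.∸ k) + fromℕ (n C suc k) * f (suc (n ℕ.∸ suc k))
      ≈⟨ +-congˡ shift ⟩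
    fromℕ (n C k) * f (n ℕ.∸ k) + fromℕ (n C suc k) * f (n ℕ.∸ k)
      ≈⟨ distribʳ _ _ _ ⟨
    (fromℕ (n C k) + fromℕ (n C suc k)) * f (n ℕ.∸ k)
      ≈⟨ *-congʳ (fromℕ-+ (n C k) (n C suc k)) ⟨
    fromℕ (n C k ℕ.+ n C suc k) * f (n ℕ.∸ k)
      ≡⟨ ≡.cong (λ i → fromℕ i * f (n ℕ.∸ k)) (nCk+nC[k+1]≡[n+1]C[k+1] n k) ⟩
    fromℕ (suc n C suc k) * f (n ℕ.∸ k) ∎
    where
    -- For k ≥ n, truncated subtraction makes the two arguments of `f` differ, but then C(n,k+1) =
    -- 0.
    shift : fromℕ (n C suc k) * f (suc (n ℕ.∸ suc k)) ≈ fromℕ (n C suc k) * f (n ℕ.∸ k)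
    shift with k ℕ.<? n
    ... | yes k<n = reflexive (≡.cong (λ i → fromℕ (n C suc k) * f i) (≡.sym (ℕ.+-∸-assoc 1 k<n)))
    ... | no  k≮n = trans (C>⇒0 _ n<k+1) (sym (C>⇒0 _ n<k+1))
      where n<k+1 = ℕ.s≤s (ℕ.≮⇒≥ k≮n)

  -- T n = x ^ C(n,2).
  T : Seq
  T zero    = 1#
  T (suc n) = x ^ n * T n

  -- The scale of the expansions: `G r n` = C(n,r) T(n-r), which q^C(n,2) turns into `g r n`.
  G : ℕ → Seq
  G r = δ r ⋆ T

  0≤x : 0# ≤ x
  0≤x = ≤-trans (0≤fromℕ 2) 2≤x

  0<x : 0# < x
  0<x = <-≤-trans (0<fromℕ-suc 1) 2≤x

  0<x^ : ∀ n → 0# < x ^ n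
  0<x^ = RealNotation.^-pos ℝ 0<x

  2^n≤x^n : ∀ n → fromℕ (2 ℕ.^ n) ≤ x ^ n
  2^n≤x^n n = ≤-trans (≤-reflexive (fromℕ-^ 2 n)) (^-mono-≤ (0≤fromℕ 2) 2≤x n)

  0<T : ∀ n → 0# < T n
  0<T zero    = RealNotation.0<1 ℝ
  0<T (suc n) = *-pos (0<x^ n) (0<T n)

  0≤T : ∀ n → 0# ≤ T n
  0≤T n = <⇒≤ (0<T n)

  0≤δ : ∀ k n → 0# ≤ δ k n
  0≤δ zero    zero    = 0≤1
  0≤δ zero    (suc n) = ≤-refl
  0≤δ (suc k) zero    = ≤-refl
  0≤δ (suc k) (suc n) = 0≤δ k n

  0≤G : ∀ r n → 0# ≤ G r n
  0≤G r = ⋆-nonneg (0≤δ r) 0≤T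

  G-explicit : ∀ r d → G r (r ℕ.+ d) ≈ fromℕ ((r ℕ.+ d) C r) * T d
  G-explicit r d = trans (δ-⋆ r T (r ℕ.+ d))
    (reflexive (≡.cong (λ i → fromℕ ((r ℕ.+ d) C r) * T i) (ℕ.m+n∸m≡n r d)))

  G-explicit-suc : ∀ r d → G r (suc r ℕ.+ d) ≈ fromℕ ((suc r ℕ.+ d) C r) * T (suc d)
  G-explicit-suc r d = ≡.subst (λ n → G r n ≈ fromℕ (n C r) * T (suc d)) (ℕ.+-suc r d) (G-explicit r (suc d))

  -- By `C-ratio` and T(d+1) = x^d T(d). Read as a quotient, `G (suc r)` over `G r` is (d+1)/((r+1)
  -- x^d) at n = r+1+d; every estimate of growth below rests on it.
  G-ratio : ∀ r d → fromℕ (suc r) * (x ^ d * G (suc r) (suc r ℕ.+ d)) ≈ fromℕ (suc d) * G r (suc r ℕ.+ d)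
  G-ratio r d = begin-equality
    fromℕ (suc r) * (x ^ d * G (suc r) (suc r ℕ.+ d))
      ≈⟨ *-congˡ (*-congˡ (G-explicit (suc r) d)) ⟩
    fromℕ (suc r) * (x ^ d * (fromℕ (n C suc r) * T d))
      ≈⟨ solve 4 (λ a b c d → a :* (b :* (c :* d)) := (a :* c) :* (b :* d)) refl
                 (fromℕ (suc r)) (x ^ d) (fromℕ (n C suc r)) (T d) ⟩
    (fromℕ (suc r) * fromℕ (n C suc r)) * T (suc d)
      ≈⟨ *-congʳ (fromℕ-* (suc r) (n C suc r)) ⟨
    fromℕ (suc r ℕ.* (n C suc r)) * T (suc d)
      ≡⟨ ≡.cong (λ i → fromℕ i * T (suc d)) (C-ratio r d) ⟩
    fromℕ (suc d ℕ.* (n C r)) * T (suc d)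
      ≈⟨ *-congʳ (fromℕ-* (suc d) (n C r)) ⟩
    (fromℕ (suc d) * fromℕ (n C r)) * T (suc d)
      ≈⟨ *-assoc _ _ _ ⟩
    fromℕ (suc d) * (fromℕ (n C r) * T (suc d))
      ≈⟨ *-congˡ (G-explicit-suc r d) ⟨
    fromℕ (suc d) * G r n ∎
    where n = suc r ℕ.+ d

  G-below : ∀ r n → n ℕ.< r → G r n ≈ 0#
  G-below r n n<r = trans (δ-⋆ r T n) (C>⇒0 _ n<r)

  -- The quotient in `G-ratio` is at most 1, since d+1 ≤ 2^d ≤ x^d.
  G-anti : ∀ r n → G (suc r) n ≤ G r n
  G-anti r n with n ℕ.<? suc r
  ... | yes n<r+1 = ≤-trans (≤-reflexive (G-below (suc r) n n<r+1)) (0≤G r n)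
  ... | no  n≮r+1 with d , ≡.refl ← ℕ.m≤n⇒∃[o]m+o≡n (ℕ.≮⇒≥ n≮r+1) =
    *-cancelˡ-≤ (*-pos (0<fromℕ-suc r) (0<x^ d)) $ begin
      (R * x ^ d) * G (suc r) m ≈⟨ *-assoc _ _ _ ⟩
      R * (x ^ d * G (suc r) m) ≈⟨ G-ratio r d ⟩
      fromℕ (suc d) * G r m     ≤⟨ *-monoʳ-≤ (0≤G r m) (fromℕ-mono {suc d} (n<2^n d)) ⟩
      fromℕ (2 ℕ.^ d) * G r m   ≤⟨ *-monoʳ-≤ (0≤G r m) (2^n≤x^n d) ⟩
      x ^ d * G r m             ≈⟨ *-congʳ (*-identityˡ _) ⟨
      (1# * x ^ d) * G r m
        ≤⟨ *-monoʳ-≤ (0≤G r m) (*-monoʳ-≤ (<⇒≤ (0<x^ d))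
             (≤-trans (≤-reflexive (sym fromℕ-1)) (fromℕ-mono {1} {suc r} (ℕ.s≤s ℕ.z≤n)))) ⟩
      (R * x ^ d) * G r m ∎
    where
    m = suc r ℕ.+ d
    R = fromℕ (suc r)

  -- G (r+1) n / G r n ≤ (d+1) / xᵈ with d = n-r-1, which is ≤ ε once ε (d+1) ≥ 4, as (d+1)² ≤ 4·2ᵈ.
  G-little-o : ∀ r ε → 0# < ε → ∃[ N ] ∀ n → N ℕ.≤ n → G (suc r) n ≤ ε * G r n
  G-little-o r ε 0<ε with archimedean (fromℕ 4 * RealNotation.recip ℝ ε 0<ε)
  ... | M , 4/ε<M = suc r ℕ.+ M , bound
    where
    bound : ∀ n → suc r ℕ.+ M ℕ.≤ n → G (suc r) n ≤ ε * G r n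
    bound n N≤n with d , ≡.refl ← ℕ.m≤n⇒∃[o]m+o≡n (ℕ.≤-trans (ℕ.m≤m+n (suc r) M) N≤n) =
      *-cancelˡ-≤ (*-pos (0<fromℕ-suc d) (*-pos (0<fromℕ-suc r) (0<x^ d))) $ begin
        D * (R * x ^ d) * G (suc r) m
          ≈⟨ solve 4 (λ a b c d → a :* (b :* c) :* d := a :* (b :* (c :* d))) refl D R (x ^ d) (G (suc r) m) ⟩
        D * (R * (x ^ d * G (suc r) m))       ≈⟨ *-congˡ (G-ratio r d) ⟩
        D * (D * G r m)                       ≈⟨ *-assoc D D (G r m) ⟨
        (D * D) * G r m                       ≤⟨ *-monoʳ-≤ (0≤G r m) D*D≤ ⟩
        (D * (ε * (R * x ^ d))) * G r m
          ≈⟨ solve 5 (λ D ε R y g → (D :* (ε :* (R :* y))) :* g := D :* (R :* y) :* (ε :* g))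
               refl D ε R (x ^ d) (G r m) ⟩
        D * (R * x ^ d) * (ε * G r m) ∎
      where
      m = suc r ℕ.+ d
      R = fromℕ (suc r)
      D = fromℕ (suc d)
      M≤d : M ℕ.≤ d
      M≤d = ℕ.+-cancelˡ-≤ (suc r) M d N≤n
      4≤εD : fromℕ 4 ≤ ε * D
      4≤εD = begin
        fromℕ 4                ≈⟨ *-identityʳ (fromℕ 4) ⟨
        fromℕ 4 * 1#           ≈⟨ *-congˡ (recip-inverse ε 0<ε) ⟨
        fromℕ 4 * (RealNotation.recip ℝ ε 0<ε * ε)
          ≈⟨ solve 3 (λ a b c → a :* (b :* c) := c :* (a :* b)) refl (fromℕ 4) (RealNotation.recip ℝ ε 0<ε) ε ⟩
        ε * (fromℕ 4 * RealNotation.recip ℝ ε 0<ε) ≤⟨ *-monoˡ-≤ (<⇒≤ 0<ε) (<⇒≤ 4/ε<M) ⟩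
        ε * fromℕ M            ≤⟨ *-monoˡ-≤ (<⇒≤ 0<ε) (fromℕ-mono {M} {suc d} (ℕ.m≤n⇒m≤1+n M≤d)) ⟩
        ε * D ∎
      D*D≤ : D * D ≤ D * (ε * (R * x ^ d))
      D*D≤ = begin
        D * D                       ≈⟨ fromℕ-* (suc d) (suc d) ⟨
        fromℕ (suc d ℕ.* suc d)     ≤⟨ fromℕ-mono {suc d ℕ.* suc d} (n*n≤2^[1+n] (suc d)) ⟩
        fromℕ (2 ℕ.^ (2 ℕ.+ d))     ≡⟨ ≡.cong fromℕ (ℕ.^-distribˡ-+-* 2 2 d) ⟩
        fromℕ (4 ℕ.* 2 ℕ.^ d)       ≈⟨ fromℕ-* 4 (2 ℕ.^ d) ⟩
        fromℕ 4 * fromℕ (2 ℕ.^ d)   ≤⟨ *-mono-≤ (0≤fromℕ 4) (<⇒≤ (0<x^ d)) 4≤εD (2^n≤x^n d) ⟩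
        (ε * D) * x ^ d             ≈⟨ *-identityˡ _ ⟨
        1# * ((ε * D) * x ^ d)
          ≤⟨ *-monoʳ-≤ (*-nonneg (*-nonneg (<⇒≤ 0<ε) (0≤fromℕ (suc d))) (<⇒≤ (0<x^ d)))
               (≤-trans (≤-reflexive (sym fromℕ-1)) (fromℕ-mono {1} {suc r} (ℕ.s≤s ℕ.z≤n))) ⟩
        R * ((ε * D) * x ^ d)
          ≈⟨ solve 4 (λ R ε D y → R :* ((ε :* D) :* y) := D :* (ε :* (R :* y))) refl R ε D (x ^ d) ⟩
        D * (ε * (R * x ^ d)) ∎

  -- The relation f = O(`G r`). A threshold is required because `G r n` vanishes for n < r;
  -- nonnegativity of the factor lets bounds be multiplied.
  record Negligible (r : ℕ) (f : Seq) : Set (c ⊔ˡ ℓ₂) where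
    constructor negligible
    field
      factor        : Carrier
      factor-nonneg : 0# ≤ factor
      threshold     : ℕ
      bound         : ∀ n → threshold ℕ.≤ n → ∣ f n ∣ ≤ factor * G r n

  -- Without a threshold, unlike `Negligible`: a convolution at n involves the values at all smaller
  -- indices.
  record Bounded (f : Seq) : Set (c ⊔ˡ ℓ₂) where
    constructor bounded
    field
      factor        : Carrier
      factor-nonneg : 0# ≤ factor
      bound         : ∀ n → ∣ f n ∣ ≤ factor * T n

  bounded⇒negligible : ∀ {f} → Bounded f → Negligible 0 f
  bounded⇒negligible (bounded K 0≤K p) =
    negligible K 0≤K 0 λ n _ → ≤-trans (p n) (≤-reflexive (*-congˡ (sym (⋆-identityˡ T n))))

  bounded-⊕ : ∀ {f h} → Bounded f → Bounded h → Bounded (f ⊕ h)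
  bounded-⊕ (bounded K 0≤K p) (bounded L 0≤L q) = bounded (K + L) (+-nonneg 0≤K 0≤L) λ n →
    ≤-trans (∣x+y∣≤∣x∣+∣y∣ _ _) (≤-trans (+-mono-≤ (p n) (q n)) (≤-reflexive (sym (distribʳ (T n) K L))))

  bounded-⊝ : ∀ {f} → Bounded f → Bounded (⊝ f)
  bounded-⊝ {f} (bounded K 0≤K p) = bounded K 0≤K λ n → ≤-trans (∣-x∣≤∣x∣ (f n)) (p n)

  negligible-cong-≥ : ∀ {r f h} N → (∀ n → N ℕ.≤ n → f n ≈ h n) → Negligible r f → Negligible r h
  negligible-cong-≥ N p (negligible K 0≤K M q) = negligible K 0≤K (N ℕ.+ M) λ n N+M≤n →
    ≤-trans (∣∣-mono-≈ (sym (p n (ℕ.≤-trans (ℕ.m≤m+n N M) N+M≤n)))) (q n (ℕ.≤-trans (ℕ.m≤n+m M N) N+M≤n))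

  negligible-cong : ∀ {r f h} → f ≋ h → Negligible r f → Negligible r h
  negligible-cong p = negligible-cong-≥ 0 (λ n _ → p n)

  negligible-𝟘 : ∀ {r} → Negligible r 𝟘
  negligible-𝟘 {r} = negligible 0# ≤-refl 0 λ n _ → ≤-reflexive $
    trans (0≤x⇒∣x∣≈x ≤-refl) (sym (zeroˡ (G r n)))

  negligible-⊕ : ∀ {r f h} → Negligible r f → Negligible r h → Negligible r (f ⊕ h)
  negligible-⊕ {r} (negligible K 0≤K M p) (negligible L 0≤L N q) = negligible (K + L) (+-nonneg 0≤K 0≤L) (M ℕ.+ N) λ n M+N≤n →
    ≤-trans (∣x+y∣≤∣x∣+∣y∣ _ _)
      (≤-trans (+-mono-≤ (p n (ℕ.≤-trans (ℕ.m≤m+n M N) M+N≤n)) (q n (ℕ.≤-trans (ℕ.m≤n+m N M) M+N≤n)))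
               (≤-reflexive (sym (distribʳ (G r n) K L))))

  negligible-⊝ : ∀ {r f} → Negligible r f → Negligible r (⊝ f)
  negligible-⊝ {f = f} (negligible K 0≤K N p) = negligible K 0≤K N λ n N≤n → ≤-trans (∣-x∣≤∣x∣ (f n)) (p n N≤n)

  negligible-⊙ : ∀ {r f} a → Negligible r f → Negligible r (a ⊙ f)
  negligible-⊙ {f = f} a (negligible K 0≤K N p) = negligible (∣ a ∣ * K) (*-nonneg (0≤∣x∣ a) 0≤K) N λ n N≤n →
    ≤-trans (∣x*y∣≤∣x∣*∣y∣ a (f n))
      (≤-trans (*-monoˡ-≤ (0≤∣x∣ a) (p n N≤n)) (≤-reflexive (sym (*-assoc ∣ a ∣ K _))))

  negligible-pred : ∀ {r f} → Negligible (suc r) f → Negligible r f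
  negligible-pred {r} (negligible K 0≤K N p) = negligible K 0≤K N λ n N≤n →
    ≤-trans (p n N≤n) (*-monoˡ-≤ 0≤K (G-anti r n))

  negligible-+ : ∀ j {r f} → Negligible (j ℕ.+ r) f → Negligible r f
  negligible-+ zero    p = p
  negligible-+ (suc j) p = negligible-+ j (negligible-pred p)

  negligible-≤ : ∀ {r s f} → r ℕ.≤ s → Negligible s f → Negligible r f
  negligible-≤ {r} {f = f} r≤s p with j , ≡.refl ← ℕ.m≤n⇒∃[o]m+o≡n r≤s =
    negligible-+ j (≡.subst (λ s → Negligible s f) (ℕ.+-comm r j) p)

  -- By `δ⋆δ`, `δ k ⋆ G r` is a multiple of `G (k + r)`, so multiplication by `δ k` gains k orders.
  -- The threshold grows by k because the value at n uses `f` at n-k.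
  negligible-δ⋆ : ∀ k {r f} → Negligible r f → Negligible (k ℕ.+ r) (δ k ⋆ f)
  negligible-δ⋆ k {r} {f} (negligible K 0≤K N p) with a , δkδr ← δ⋆δ k r =
    negligible (K * ∣ a ∣) (*-nonneg 0≤K (0≤∣x∣ a)) (N ℕ.+ k) λ n N+k≤n → begin
      ∣ (δ k ⋆ f) n ∣                                ≤⟨ ∣∣-mono-≈ (δ-⋆ k f n) ⟩
      ∣ fromℕ (n C k) * f (n ℕ.∸ k) ∣                ≤⟨ ∣x*y∣≤∣x∣*∣y∣ _ _ ⟩
      ∣ fromℕ (n C k) ∣ * ∣ f (n ℕ.∸ k) ∣            ≈⟨ *-congʳ (0≤x⇒∣x∣≈x (0≤fromℕ (n C k))) ⟩
      fromℕ (n C k) * ∣ f (n ℕ.∸ k) ∣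
        ≤⟨ *-monoˡ-≤ (0≤fromℕ (n C k)) (p (n ℕ.∸ k) (N≤n∸k n N+k≤n)) ⟩
      fromℕ (n C k) * (K * G r (n ℕ.∸ k))
        ≈⟨ solve 3 (λ a b c → a :* (b :* c) := b :* (a :* c)) refl _ K _ ⟩
      K * (fromℕ (n C k) * G r (n ℕ.∸ k))            ≈⟨ *-congˡ (δ-⋆ k (G r) n) ⟨
      K * (δ k ⋆ (δ r ⋆ T)) n                        ≈⟨ *-congˡ (⋆-assoc (δ k) (δ r) T n) ⟨
      K * (δ k ⋆ δ r ⋆ T) n                          ≈⟨ *-congˡ (⋆-cong {h = T} δkδr (λ _ → refl) n) ⟩
      K * ((a ⊙ δ (k ℕ.+ r)) ⋆ T) n                  ≈⟨ *-congˡ (⊙-⋆ a (δ (k ℕ.+ r)) T n) ⟩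
      K * (a * G (k ℕ.+ r) n)                        ≈⟨ *-assoc K a _ ⟨
      K * a * G (k ℕ.+ r) n
        ≤⟨ *-monoʳ-≤ (0≤G (k ℕ.+ r) n) (*-monoˡ-≤ 0≤K (x≤∣x∣ a)) ⟩
      K * ∣ a ∣ * G (k ℕ.+ r) n                      ∎
    where
    N≤n∸k : ∀ n → N ℕ.+ k ℕ.≤ n → N ℕ.≤ n ℕ.∸ k
    N≤n∸k n le = ≡.subst (ℕ._≤ n ℕ.∸ k) (ℕ.m+n∸n≡m N k) (ℕ.∸-monoˡ-≤ k le)

  -- A truncation is a finite combination of the `δ k`, and none of these lowers the order.
  negligible-τ⋆ : ∀ R c {r f} → Negligible r f → Negligible r (τ R c ⋆ f)
  negligible-τ⋆ zero    c {f = f} p = negligible-cong (λ n → sym (⋆-zeroˡ f n)) negligible-𝟘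
  negligible-τ⋆ (suc R) c {f = f} p = negligible-cong (λ n → sym (τ-suc-⋆ R c f n))
    (negligible-⊕ (negligible-τ⋆ R c p) (negligible-⊙ (c R) (negligible-+ R (negligible-δ⋆ R p))))

  -- Terms of index k < r have coefficient 0, and a term of index k ≥ r has order k by
  -- `negligible-δ⋆`.
  negligible-high : ∀ R e {r f} → (∀ n → n ℕ.< r → e n ≈ 0#) → Bounded f → Negligible r (τ R e ⋆ f)
  negligible-high zero    e {f = f} e≈0 b = negligible-cong (λ n → sym (⋆-zeroˡ f n)) negligible-𝟘
  negligible-high (suc R) e {r} {f} e≈0 b = negligible-cong (λ n → sym (τ-suc-⋆ R e f n))
    (negligible-⊕ (negligible-high R e e≈0 b) (term (R ℕ.<? r)))
    where
    term : _ → Negligible r (e R ⊙ (δ R ⋆ f))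
    term (yes R<r) = negligible-cong (λ n → sym (trans (*-congʳ (e≈0 R R<r)) (zeroˡ _))) negligible-𝟘
    term (no  R≮r) = negligible-⊙ (e R) (negligible-≤ (ℕ.≮⇒≥ R≮r)
      (≡.subst (λ s → Negligible s (δ R ⋆ f)) (ℕ.+-identityʳ R) (negligible-δ⋆ R (bounded⇒negligible b))))

  -- The product of the truncations and the truncated product agree below r and both vanish from 2r
  -- on. Their difference is thus a finite combination of `δ k` with r ≤ k < 2r.
  τ-⋆-negligible : ∀ r f h {k} → Bounded k → Negligible r (τ r f ⋆ τ r h ⋆ k ⊕ ⊝ (τ r (f ⋆ h) ⋆ k))
  τ-⋆-negligible r f h {k} b = negligible-cong eq (negligible-high (r ℕ.+ r) e e-low b)
    where
    e : Seq
    e = τ r f ⋆ τ r h ⊕ ⊝ τ r (f ⋆ h)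
    e-low : ∀ n → n ℕ.< r → e n ≈ 0#
    e-low n n<r = trans (+-cong (τ⋆τ-< r f h n n<r) (-‿cong (τ-< r (f ⋆ h) n<r))) (-‿inverseʳ _)
    e-high : τ (r ℕ.+ r) e ≋ e
    e-high n with n ℕ.<? r ℕ.+ r
    ... | yes n<2r = τ-< (r ℕ.+ r) e n<2r
    ... | no  n≮2r = trans (τ-≥ (r ℕ.+ r) e 2r≤n) (sym (trans
        (+-cong (τ⋆τ-≥ r r f h n (ℕ.m≤n⇒m≤1+n 2r≤n))
                (-‿cong (τ-≥ r (f ⋆ h) (ℕ.≤-trans (ℕ.m≤m+n r r) 2r≤n))))
        (-‿inverseʳ 0#)))
      where 2r≤n = ℕ.≮⇒≥ n≮2r
    eq : τ (r ℕ.+ r) e ⋆ k ≋ τ r f ⋆ τ r h ⋆ k ⊕ ⊝ (τ r (f ⋆ h) ⋆ k)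
    eq n = trans (⋆-cong {h = k} e-high (λ _ → refl) n)
      (⋆-[a-b]k (τ r f ⋆ τ r h) (τ r (f ⋆ h)) k n)

  -- The tail complementary to `τ`.
  σ : ℕ → Seq → Seq
  σ r f = f ⊕ ⊝ τ r f

  σ-< : ∀ r f {n} → n ℕ.< r → σ r f n ≈ 0#
  σ-< r f n<r = trans (+-congˡ (-‿cong (τ-< r f n<r))) (-‿inverseʳ _)

  σ-≥ : ∀ r f {n} → r ℕ.≤ n → σ r f n ≈ f n
  σ-≥ r f r≤n = trans (+-congˡ (-‿cong (τ-≥ r f r≤n))) (solve 1 (λ x → x :- :0 := x) refl _)

  σ-bound : ∀ {f} r (b : Bounded f) → ∀ n → ∣ σ r f n ∣ ≤ (Bounded.factor b ⊙ σ r T) n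
  σ-bound {f} r (bounded K 0≤K p) n with n ℕ.<? r
  ... | yes n<r = begin
    ∣ σ r f n ∣  ≈⟨ ∣∣-cong (σ-< r f n<r) ⟩
    ∣ 0# ∣       ≈⟨ 0≤x⇒∣x∣≈x ≤-refl ⟩
    0#           ≈⟨ zeroʳ K ⟨
    K * 0#       ≈⟨ *-congˡ (σ-< r T n<r) ⟨
    K * σ r T n  ∎
  ... | no  n≮r = begin
    ∣ σ r f n ∣  ≈⟨ ∣∣-cong (σ-≥ r f (ℕ.≮⇒≥ n≮r)) ⟩
    ∣ f n ∣      ≤⟨ p n ⟩
    K * T n      ≈⟨ *-congˡ (σ-≥ r T (ℕ.≮⇒≥ n≮r)) ⟨
    K * σ r T n  ∎

  0≤σT : ∀ r n → 0# ≤ σ r T n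
  0≤σT r n with n ℕ.<? r
  ... | yes n<r = ≤-reflexive (sym (σ-< r T n<r))
  ... | no  n≮r = ≤-trans (0≤T n) (≤-reflexive (sym (σ-≥ r T (ℕ.≮⇒≥ n≮r))))

  σT≤T : ∀ r n → σ r T n ≤ T n
  σT≤T r n with n ℕ.<? r
  ... | yes n<r = ≤-trans (≤-reflexive (σ-< r T n<r)) (0≤T n)
  ... | no  n≮r = ≤-reflexive (σ-≥ r T (ℕ.≮⇒≥ n≮r))

  τ⋆-≤ : ∀ R f h n M → (∀ k → k ℕ.< R → f k * (δ k ⋆ h) n ≤ M) → (τ R f ⋆ h) n ≤ fromℕ R * M
  τ⋆-≤ zero    f h n M p = ≤-reflexive (trans (⋆-zeroˡ h n) (sym (zeroˡ M)))
  τ⋆-≤ (suc R) f h n M p = begin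
    (τ (suc R) f ⋆ h) n                   ≈⟨ τ-suc-⋆ R f h n ⟩
    (τ R f ⋆ h) n + f R * (δ R ⋆ h) n
      ≤⟨ +-mono-≤ (τ⋆-≤ R f h n M (λ k k<R → p k (ℕ.m≤n⇒m≤1+n k<R))) (p R ℕ.≤-refl) ⟩
    fromℕ R * M + M                       ≈⟨ solve 2 (λ R M → R :* M :+ M := (:1 :+ R) :* M) refl (fromℕ R) M ⟩
    fromℕ (suc R) * M                     ∎

  ⋆-≤ : ∀ f h n M → (∀ k → k ℕ.≤ n → f k * (δ k ⋆ h) n ≤ M) → (f ⋆ h) n ≤ fromℕ (suc n) * M
  ⋆-≤ f h n M p = begin
    (f ⋆ h) n               ≈⟨ ⋆-cong-≤ n (λ k k≤n → τ-< (suc n) f (ℕ.s≤s k≤n)) (λ _ _ → refl) ⟨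
    (τ (suc n) f ⋆ h) n     ≤⟨ τ⋆-≤ (suc n) f h n M (λ k k<1+n → p k (ℕ.s≤s⁻¹ k<1+n)) ⟩
    fromℕ (suc n) * M       ∎

  -- summand k n = C(n,k) T(k) T(n-k) is the term of index k of T ⋆ T, which
  -- decreases in k up to the middle.
  summand : ℕ → ℕ → Carrier
  summand k n = T k * G k n

  0≤summand : ∀ k n → 0# ≤ summand k n
  0≤summand k n = *-nonneg (0≤T k) (0≤G k n)

  summand-sym : ∀ k l → summand k (k ℕ.+ l) ≈ summand l (l ℕ.+ k)
  summand-sym k l = begin-equality
    T k * G k (k ℕ.+ l)                       ≈⟨ *-congˡ (G-explicit k l) ⟩
    T k * (fromℕ ((k ℕ.+ l) C k) * T l)
      ≈⟨ solve 3 (λ a b c → a :* (b :* c) := c :* (b :* a)) refl (T k) _ (T l) ⟩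
    T l * (fromℕ ((k ℕ.+ l) C k) * T k)       ≡⟨ ≡.cong (λ i → T l * (fromℕ i * T k)) (C-sym k l) ⟩
    T l * (fromℕ ((l ℕ.+ k) C l) * T k)       ≈⟨ *-congˡ (G-explicit l k) ⟨
    T l * G l (l ℕ.+ k)                       ∎

  summand-ratio : ∀ a b → fromℕ (suc a) * x ^ b * summand (suc a) (suc a ℕ.+ b)
                  ≈ fromℕ (suc b) * x ^ a * summand a (suc a ℕ.+ b)
  summand-ratio a b = begin-equality
    A * y * (z * t * g)   ≈⟨ solve 5 (λ A y z t g → A :* y :* (z :* t :* g) := z :* t :* (A :* (y :* g))) refl A y z t g ⟩
    z * t * (A * (y * g)) ≈⟨ *-congˡ (G-ratio a b) ⟩
    z * t * (B * g′)      ≈⟨ solve 4 (λ z t B g → z :* t :* (B :* g) := B :* z :* (t :* g)) refl z t B g′ ⟩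
    B * z * (t * g′)      ∎
    where
    A = fromℕ (suc a)
    B = fromℕ (suc b)
    y = x ^ b
    z = x ^ a
    t = T a
    g = G (suc a) (suc a ℕ.+ b)
    g′ = G a (suc a ℕ.+ b)

  -- By `summand-ratio` this amounts to b+1 ≤ (a+1) x^(b-a). With b = a+1+e, it follows from b+1 ≤
  -- (a+1)(e+2) and e+2 ≤ 2^(e+1).
  summand-step : ∀ a b → suc a ℕ.≤ b → summand (suc a) (suc a ℕ.+ b) ≤ summand a (suc a ℕ.+ b)
  summand-step a b a<b with e , ≡.refl ← ℕ.m≤n⇒∃[o]m+o≡n a<b =
    *-cancelˡ-≤ (*-pos (0<fromℕ-suc a) (0<x^ b)) $ begin
      A * x ^ b * summand (suc a) n             ≈⟨ summand-ratio a b ⟩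
      fromℕ (suc b) * x ^ a * summand a n       ≤⟨ *-monoʳ-≤ (0≤summand a n) compare ⟩
      A * x ^ b * summand a n                   ∎
    where
    n = suc a ℕ.+ b
    A = fromℕ (suc a)
    nat : suc b ℕ.≤ suc a ℕ.* 2 ℕ.^ suc e
    nat = ℕ.≤-trans
      (≡.subst (suc b ℕ.≤_)
        (N.solve 2 (λ a e → (N.con 2 N.:+ (a N.:+ e)) N.:+ (a N.:+ a N.:* e)
                          N.:= (N.con 1 N.:+ a) N.:* (N.con 2 N.:+ e)) ≡.refl a e)
        (ℕ.m≤m+n (suc b) (a ℕ.+ a ℕ.* e)))
      (ℕ.*-monoʳ-≤ (suc a) (n<2^n (suc e)))
    compare : fromℕ (suc b) * x ^ a ≤ A * x ^ b
    compare = begin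
      fromℕ (suc b) * x ^ a                     ≤⟨ *-monoʳ-≤ (<⇒≤ (0<x^ a)) (fromℕ-mono {suc b} nat) ⟩
      fromℕ (suc a ℕ.* 2 ℕ.^ suc e) * x ^ a     ≈⟨ *-congʳ (fromℕ-* (suc a) (2 ℕ.^ suc e)) ⟩
      A * fromℕ (2 ℕ.^ suc e) * x ^ a
        ≤⟨ *-monoʳ-≤ (<⇒≤ (0<x^ a)) (*-monoˡ-≤ (0≤fromℕ (suc a)) (2^n≤x^n (suc e))) ⟩
      A * x ^ suc e * x ^ a
        ≈⟨ *-assoc A _ _ ⟩
      A * (x ^ suc e * x ^ a)                   ≈⟨ *-congˡ (Exp.^-homo-* x (suc e) a) ⟨
      A * x ^ (suc e ℕ.+ a)                     ≡⟨ ≡.cong (λ i → A * x ^ suc i) (ℕ.+-comm e a) ⟩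
      A * x ^ b                                 ∎

  summand-anti : ∀ s j n → (s ℕ.+ j) ℕ.+ (s ℕ.+ j) ℕ.≤ n → summand (s ℕ.+ j) n ≤ summand s n
  summand-anti s zero    n le rewrite ℕ.+-identityʳ s = ≤-refl
  summand-anti s (suc j) n le rewrite ℕ.+-suc s j
    with b , ≡.refl ← ℕ.m≤n⇒∃[o]m+o≡n (ℕ.≤-trans (ℕ.m≤m+n (suc (s ℕ.+ j)) (suc (s ℕ.+ j))) le) =
    ≤-trans (summand-step (s ℕ.+ j) b (ℕ.+-cancelˡ-≤ (suc (s ℕ.+ j)) _ _ le))
            (summand-anti s j (suc (s ℕ.+ j) ℕ.+ b) (ℕ.≤-trans (ℕ.+-mono-≤ (ℕ.n≤1+n (s ℕ.+ j)) (ℕ.n≤1+n (s ℕ.+ j))) le))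

  -- The symmetry between `k` and `l` moves the index into the first half, where `summand-anti`
  -- descends to `s`.
  summand-≤ : ∀ s k l → s ℕ.≤ k → s ℕ.≤ l → summand k (k ℕ.+ l) ≤ summand s (k ℕ.+ l)
  summand-≤ s k l s≤k s≤l with ℕ.≤-total k l
  ... | inj₁ k≤l with j , ≡.refl ← ℕ.m≤n⇒∃[o]m+o≡n s≤k = summand-anti s j (k ℕ.+ l) (ℕ.+-monoʳ-≤ k k≤l)
  ... | inj₂ l≤k with j , ≡.refl ← ℕ.m≤n⇒∃[o]m+o≡n s≤l = begin
    summand k (k ℕ.+ l)  ≈⟨ summand-sym k l ⟩
    summand l (l ℕ.+ k)  ≤⟨ summand-anti s j (l ℕ.+ k) (ℕ.+-monoʳ-≤ l l≤k) ⟩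
    summand s (l ℕ.+ k)  ≡⟨ ≡.cong (summand s) (ℕ.+-comm l k) ⟩
    summand s (k ℕ.+ l)  ∎

  -- The terms with k < s or n-k < s vanish, and the others are at most `summand s n`. The crude
  -- count of n+1 terms is paid for in `[1+n]summand-≤`.
  σT⋆σT-≤ : ∀ s n → (σ s T ⋆ σ s T) n ≤ fromℕ (suc n) * summand s n
  σT⋆σT-≤ s n = ⋆-≤ S S n (summand s n) term
    where
    S = σ s T
    term : ∀ k → k ℕ.≤ n → S k * (δ k ⋆ S) n ≤ summand s n
    term k k≤n with l , ≡.refl ← ℕ.m≤n⇒∃[o]m+o≡n k≤n with k ℕ.<? s | l ℕ.<? s
    ... | yes k<s | _       = ≤-trans (≤-reflexive (trans (*-congʳ (σ-< s T k<s)) (zeroˡ _))) (0≤summand s n)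
    ... | no  _   | yes l<s = ≤-trans (≤-reflexive (begin-equality
      S k * (δ k ⋆ S) (k ℕ.+ l)                               ≈⟨ *-congˡ (δ-⋆ k S (k ℕ.+ l)) ⟩
      S k * (fromℕ ((k ℕ.+ l) C k) * S (k ℕ.+ l ℕ.∸ k))
        ≡⟨ ≡.cong (λ i → S k * (fromℕ ((k ℕ.+ l) C k) * S i)) (ℕ.m+n∸m≡n k l) ⟩
      S k * (fromℕ ((k ℕ.+ l) C k) * S l)                     ≈⟨ *-congˡ (*-congˡ (σ-< s T l<s)) ⟩
      S k * (fromℕ ((k ℕ.+ l) C k) * 0#)                      ≈⟨ solve 2 (λ a b → a :* (b :* :0) := :0) refl (S k) _ ⟩
      0#                                                      ∎)) (0≤summand s (k ℕ.+ l))
    ... | no k≮s  | no l≮s  = begin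
      S k * (δ k ⋆ S) (k ℕ.+ l)
        ≤⟨ *-mono-≤ (0≤σT s k) (0≤G k (k ℕ.+ l)) (σT≤T s k)
             (⋆-mono (0≤δ k) 0≤T (λ _ → ≤-refl) (σT≤T s) (k ℕ.+ l)) ⟩
      summand k (k ℕ.+ l) ≤⟨ summand-≤ s k l (ℕ.≮⇒≥ k≮s) (ℕ.≮⇒≥ l≮s) ⟩
      summand s (k ℕ.+ l) ∎

  -- Passing from index r to r+1 gains the factor (b+1) x^r / ((r+1) x^b). The linear factors are
  -- absorbed by (n+1)(b+1) ≤ (n+1)² ≤ 2^(n+2) = 2^(r+3) 2^b, where 2^b ≤ x^b; this is the origin of
  -- the constant.
  [1+n]summand-≤ : ∀ r b → let n = suc r ℕ.+ b in
             fromℕ (suc n) * summand (suc r) n ≤ fromℕ (2 ℕ.^ (3 ℕ.+ r)) * x ^ r * summand r n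
  [1+n]summand-≤ r b = *-cancelˡ-≤ (*-pos (0<fromℕ-suc r) (0<x^ b)) $ begin
    R * x ^ b * (N′ * summand (suc r) n)
      ≈⟨ solve 4 (λ R y N p → R :* y :* (N :* p) := N :* (R :* y :* p)) refl R (x ^ b) N′ (summand (suc r) n) ⟩
    N′ * (R * x ^ b * summand (suc r) n)            ≈⟨ *-congˡ (summand-ratio r b) ⟩
    N′ * (fromℕ (suc b) * x ^ r * summand r n)
      ≈⟨ solve 4 (λ N B z p → N :* (B :* z :* p) := N :* B :* (z :* p)) refl N′ (fromℕ (suc b)) (x ^ r) (summand r n) ⟩
    N′ * fromℕ (suc b) * (x ^ r * summand r n)      ≤⟨ *-monoʳ-≤ 0≤zp compare ⟩
    K * x ^ b * (x ^ r * summand r n)               ≈⟨ *-identityˡ _ ⟨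
    1# * (K * x ^ b * (x ^ r * summand r n))
      ≤⟨ *-monoʳ-≤ (*-nonneg (*-nonneg (0≤fromℕ (2 ℕ.^ (3 ℕ.+ r))) (<⇒≤ (0<x^ b))) 0≤zp)
           (≤-trans (≤-reflexive (sym fromℕ-1)) (fromℕ-mono {1} {suc r} (ℕ.s≤s ℕ.z≤n))) ⟩
    R * (K * x ^ b * (x ^ r * summand r n))
      ≈⟨ solve 5 (λ R K y z p → R :* (K :* y :* (z :* p)) := R :* y :* (K :* z :* p)) refl R K (x ^ b) (x ^ r) (summand r n) ⟩
    R * x ^ b * (K * x ^ r * summand r n)           ∎
    where
    n = suc r ℕ.+ b
    N′ = fromℕ (suc n)
    R = fromℕ (suc r)
    K = fromℕ (2 ℕ.^ (3 ℕ.+ r))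
    0≤zp = *-nonneg (<⇒≤ (0<x^ r)) (0≤summand r n)
    nat : suc n ℕ.* suc b ℕ.≤ 2 ℕ.^ (3 ℕ.+ r) ℕ.* 2 ℕ.^ b
    nat = ℕ.≤-trans (ℕ.*-monoʳ-≤ (suc n) (ℕ.s≤s (ℕ.≤-trans (ℕ.m≤n+m b r) (ℕ.n≤1+n (r ℕ.+ b)))))
      (≡.subst (suc n ℕ.* suc n ℕ.≤_) (ℕ.^-distribˡ-+-* 2 (3 ℕ.+ r) b) (n*n≤2^[1+n] (suc n)))
    compare : N′ * fromℕ (suc b) ≤ K * x ^ b
    compare = begin
      N′ * fromℕ (suc b)                          ≈⟨ fromℕ-* (suc n) (suc b) ⟨
      fromℕ (suc n ℕ.* suc b)                     ≤⟨ fromℕ-mono {suc n ℕ.* suc b} nat ⟩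
      fromℕ (2 ℕ.^ (3 ℕ.+ r) ℕ.* 2 ℕ.^ b)         ≈⟨ fromℕ-* (2 ℕ.^ (3 ℕ.+ r)) (2 ℕ.^ b) ⟩
      K * fromℕ (2 ℕ.^ b)                         ≤⟨ *-monoˡ-≤ (0≤fromℕ (2 ℕ.^ (3 ℕ.+ r))) (2^n≤x^n b) ⟩
      K * x ^ b                                   ∎

  -- The extreme terms, of index r and n-r, are split off from σ r T ⋆ σ r T; every other
  -- term is at most summand (r+1) n, which beats the number n of terms by an exponential factor.
  negligible-σT⋆σT : ∀ r → Negligible r (σ r T ⋆ σ r T)
  negligible-σT⋆σT r = negligible L 0≤L (suc r) bound
    where
    K = fromℕ (2 ℕ.^ (3 ℕ.+ r)) * x ^ r
    L = T r + T r + K * T r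
    0≤K = *-nonneg (0≤fromℕ (2 ℕ.^ (3 ℕ.+ r))) (<⇒≤ (0<x^ r))
    0≤L = +-nonneg (+-nonneg (0≤T r) (0≤T r)) (*-nonneg 0≤K (0≤T r))
    S = σ r T
    S⁺ = σ (suc r) T
    E = T r ⊙ δ r
    S≋ : S ≋ E ⊕ S⁺
    S≋ n = sym (trans (+-congˡ (+-congˡ (-‿cong (τ-suc r T n))))
      (solve 3 (λ e t u → e :+ (t :- (u :+ e)) := t :- u) refl (E n) (T n) (τ r T n)))
    δ⋆σ≤G : ∀ s n → (δ r ⋆ σ s T) n ≤ G r n
    δ⋆σ≤G s = ⋆-mono (0≤δ r) 0≤T (λ _ → ≤-refl) (σT≤T s)
    E⋆≤ : ∀ s n → (E ⋆ σ s T) n ≤ summand r n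
    E⋆≤ s n = ≤-trans (≤-reflexive (⊙-⋆ (T r) (δ r) (σ s T) n)) (*-monoˡ-≤ (0≤T r) (δ⋆σ≤G s n))
    bound : ∀ n → suc r ℕ.≤ n → ∣ (S ⋆ S) n ∣ ≤ L * G r n
    bound n r<n with b , ≡.refl ← ℕ.m≤n⇒∃[o]m+o≡n r<n = begin
      ∣ (S ⋆ S) n ∣                      ≈⟨ 0≤x⇒∣x∣≈x (⋆-nonneg (0≤σT r) (0≤σT r) n) ⟩
      (S ⋆ S) n                          ≈⟨ ⋆-cong {h = S} S≋ (λ _ → refl) n ⟩
      ((E ⊕ S⁺) ⋆ S) n                   ≈⟨ ⋆-distribʳ S E S⁺ n ⟩
      (E ⋆ S) n + (S⁺ ⋆ S) n             ≈⟨ +-congˡ (⋆-cong {f = S⁺} (λ _ → refl) S≋ n) ⟩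
      (E ⋆ S) n + (S⁺ ⋆ (E ⊕ S⁺)) n      ≈⟨ +-congˡ (⋆-distribˡ S⁺ E S⁺ n) ⟩
      (E ⋆ S) n + ((S⁺ ⋆ E) n + (S⁺ ⋆ S⁺) n)
        ≤⟨ +-mono-≤ (E⋆≤ r n) (+-mono-≤
             (≤-trans (≤-reflexive (⋆-comm S⁺ E n)) (E⋆≤ (suc r) n))
             (≤-trans (σT⋆σT-≤ (suc r) n) ([1+n]summand-≤ r b))) ⟩
      summand r n + (summand r n + K * summand r n)
        ≈⟨ solve 3 (λ t g K → t :* g :+ (t :* g :+ K :* (t :* g)) := (t :+ t :+ K :* t) :* g) refl (T r) (G r n) K ⟩
      L * G r n                          ∎

  -- The expression is the product of the tails of `f` and `h` minus `τ r f ⋆ τ r h`, which vanishes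
  -- from 2r on. The tails are dominated by multiples of the tail of `T`, so the square of that tail
  -- decides.
  negligible-middle : ∀ r {f h} → Bounded f → Bounded h →
                      Negligible r (f ⋆ h ⊕ ⊝ (τ r f ⋆ h ⊕ f ⋆ τ r h))
  negligible-middle r {f} {h} bf bh =
    negligible-cong-≥ (r ℕ.+ r) eq (negligible-σ⋆σ (negligible-σT⋆σT r))
    where
    open Bounded bf using () renaming (factor to K; factor-nonneg to 0≤K)
    open Bounded bh using () renaming (factor to L; factor-nonneg to 0≤L)
    negligible-σ⋆σ : Negligible r (σ r T ⋆ σ r T) → Negligible r (σ r f ⋆ σ r h)
    negligible-σ⋆σ (negligible M 0≤M N q) =
     negligible (K * L * M) (*-nonneg (*-nonneg 0≤K 0≤L) 0≤M) N λ n N≤n → begin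
      ∣ (σ r f ⋆ σ r h) n ∣                 ≤⟨ ∣⋆∣-mono (σ-bound r bf) (σ-bound r bh) n ⟩
      ((K ⊙ σ r T) ⋆ (L ⊙ σ r T)) n         ≈⟨ ⊙-⋆ K (σ r T) (L ⊙ σ r T) n ⟩
      K * (σ r T ⋆ (L ⊙ σ r T)) n           ≈⟨ *-congˡ (⋆-comm (σ r T) (L ⊙ σ r T) n) ⟩
      K * ((L ⊙ σ r T) ⋆ σ r T) n           ≈⟨ *-congˡ (⊙-⋆ L (σ r T) (σ r T) n) ⟩
      K * (L * (σ r T ⋆ σ r T) n)           ≤⟨ *-monoˡ-≤ 0≤K (*-monoˡ-≤ 0≤L (≤-trans (x≤∣x∣ _) (q n N≤n))) ⟩
      K * (L * (M * G r n))
        ≈⟨ solve 4 (λ a b c d → a :* (b :* (c :* d)) := a :* b :* c :* d) refl K L M (G r n) ⟩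
      K * L * M * G r n                     ∎
    eq : ∀ n → r ℕ.+ r ℕ.≤ n → (σ r f ⋆ σ r h) n ≈ (f ⋆ h ⊕ ⊝ (τ r f ⋆ h ⊕ f ⋆ τ r h)) n
    eq n 2r≤n = begin-equality
      (σ r f ⋆ σ r h) n
        ≈⟨ ⋆-tails-product f h (τ r f) (τ r h) n ⟩
      (f ⋆ h ⊕ ⊝ (τ r f ⋆ h ⊕ f ⋆ τ r h)) n + (τ r f ⋆ τ r h) n
        ≈⟨ +-congˡ (τ⋆τ-≥ r r f h n (ℕ.m≤n⇒m≤1+n 2r≤n)) ⟩
      (f ⋆ h ⊕ ⊝ (τ r f ⋆ h ⊕ f ⋆ τ r h)) n + 0#
        ≈⟨ +-identityʳ _ ⟩
      (f ⋆ h ⊕ ⊝ (τ r f ⋆ h ⊕ f ⋆ τ r h)) n ∎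

  -- f(n) agrees with ∑_{k<r} c(k) C(n,k) T(n-k) up to order r.
  Expands : ℕ → Seq → Seq → Set _
  Expands r f c = Negligible r (f ⊕ ⊝ (τ r c ⋆ T))

  -- Modulo its middle, f ⋆ h is τf ⋆ h + f ⋆ τh. Replacing h in the first product and f in the
  -- second by their expansions gives τf ⋆ τd ⋆ T + τc ⋆ τh ⋆ T, and products of truncations may be
  -- exchanged for truncated products.
  expands-⋆ : ∀ r {f h c d} → Bounded f → Bounded h → Bounded T → Expands r f c → Expands r h d →
              Expands r (f ⋆ h) (f ⋆ d ⊕ c ⋆ h)
  expands-⋆ r {f} {h} {c} {d} bf bh bT ef eh = negligible-cong eq
    (negligible-⊕ (negligible-middle r bf bh)
      (negligible-⊕ (negligible-⊕ (negligible-τ⋆ r f eh) (negligible-τ⋆ r h ef))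
        (negligible-⊕ (τ-⋆-negligible r f d bT) (τ-⋆-negligible r c h bT))))
    where
    eq : (f ⋆ h ⊕ ⊝ (τ r f ⋆ h ⊕ f ⋆ τ r h))
           ⊕ ((τ r f ⋆ (h ⊕ ⊝ (τ r d ⋆ T)) ⊕ τ r h ⋆ (f ⊕ ⊝ (τ r c ⋆ T)))
           ⊕ ((τ r f ⋆ τ r d ⋆ T ⊕ ⊝ (τ r (f ⋆ d) ⋆ T)) ⊕ (τ r c ⋆ τ r h ⋆ T ⊕ ⊝ (τ r (c ⋆ h) ⋆ T))))
         ≋ f ⋆ h ⊕ ⊝ (τ r (f ⋆ d ⊕ c ⋆ h) ⋆ T)
    eq n = trans
      (⋆-product-rule f h (τ r f) (τ r h) (τ r c) (τ r d) T (τ r (f ⋆ d)) (τ r (c ⋆ h)) n)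
      (+-congˡ (-‿cong (⋆-cong {h = T} (λ k → sym (τ-⊕ r (f ⋆ d) (c ⋆ h) k)) (λ _ → refl) n)))

-- Expansion of an inverse of T and of the powers of a sequence.

module Powers {c ℓ₁ ℓ₂} (ℝ : Reals c ℓ₁ ℓ₂)
              (x : Reals.Carrier ℝ) (2≤x : Reals._≤_ ℝ (Reals.fromℕ ℝ 2) x) where
  open Reals ℝ
  open OrderedField ℝ
  open Hurwitz commutativeRing
  open Gargantuan ℝ x 2≤x
  open RingSolver commutativeRing using (solve; _:=_; _:+_; _:*_; _:-_; :-_; :0; :1)
  open ≤-Reasoning

  τ-⊝ : ∀ r f → τ r (⊝ f) ≋ ⊝ τ r f
  τ-⊝ zero    f n       = solve 0 (:0 := :- :0) refl
  τ-⊝ (suc r) f zero    = refl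
  τ-⊝ (suc r) f (suc n) = τ-⊝ r (f ′) n

  -- Truncation at order 0 would erase the unit, which is why the expansions below have order
  -- `suc r`.
  τ-δ0 : ∀ r → τ (suc r) (δ 0) ≋ δ 0
  τ-δ0 r       zero    = refl
  τ-δ0 zero    (suc n) = refl
  τ-δ0 (suc r) (suc n) = τ-𝟘 (suc r) n
    where
    τ-𝟘 : ∀ r → τ r 𝟘 ≋ 𝟘
    τ-𝟘 zero    n       = refl
    τ-𝟘 (suc r) zero    = refl
    τ-𝟘 (suc r) (suc n) = τ-𝟘 r n

  negligible-finite : ∀ {r} s f → (∀ n → s ℕ.≤ n → f n ≈ 0#) → Negligible r f
  negligible-finite s f p = negligible-cong-≥ s (λ n s≤n → sym (p n s≤n)) negligible-𝟘

  negligible-δ0 : ∀ {r} → Negligible r (δ 0)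
  negligible-δ0 = negligible-finite 1 (δ 0) λ { (suc n) _ → refl }

  bounded-T : Bounded T
  bounded-T = bounded 1# 0≤1 λ n →
    ≤-reflexive (trans (0≤x⇒∣x∣≈x (0≤T n)) (sym (*-identityˡ (T n))))

  bounded-δ0 : Bounded (δ 0)
  bounded-δ0 = bounded 1# 0≤1 λ n →
    ≤-trans (≤-reflexive (0≤x⇒∣x∣≈x (0≤δ 0 n))) (≤-trans (δ≤T n) (≤-reflexive (sym (*-identityˡ (T n)))))
    where
    δ≤T : ∀ n → δ 0 n ≤ T n
    δ≤T zero    = ≤-refl
    δ≤T (suc n) = 0≤T (suc n)

  expands-cong : ∀ r {f h c d} → f ≋ h → c ≋ d → Expands r f c → Expands r h d
  expands-cong r p q = negligible-cong λ n →
    +-cong (p n) (-‿cong (⋆-cong {h = T} (τ-cong r q) (λ _ → refl) n))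

  -- 0 ≡ 1 = U⋆T ≡ τU⋆T + U⋆τT; multiplying by τU, where τU⋆τT ≡ 1, gives 0 ≡ τ(U⋆U)⋆T + U.
  expands-inverse : ∀ r {U} → Bounded U → U ⋆ T ≋ δ 0 → Expands (suc r) U (⊝ (U ⋆ U))
  expands-inverse r {U} bU U⋆T≋1 = negligible-cong eq
    (negligible-⊕ (negligible-finite s u (λ n → τ-≥ s U))
      (negligible-⊝ (negligible-⊕ (negligible-τ⋆ s U (negligible-middle s bU bounded-T))
        (negligible-⊕ (τ-⋆-negligible s U T bU) (τ-⋆-negligible s U U bounded-T)))))
    where
    s = suc r
    u = τ s U
    t = τ s T
    v = τ s (U ⋆ U)
    w = τ s (U ⋆ T)
    eq : u ⊕ ⊝ (u ⋆ (U ⋆ T ⊕ ⊝ (u ⋆ T ⊕ U ⋆ t)) ⊕ ((u ⋆ t ⋆ U ⊕ ⊝ (w ⋆ U)) ⊕ (u ⋆ u ⋆ T ⊕ ⊝ (v ⋆ T))))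
         ≋ U ⊕ ⊝ (τ s (⊝ (U ⋆ U)) ⋆ T)
    eq n = begin-equality
      _
        ≈⟨ ⋆-inverse-rule₁ U T u t v w n ⟩
      ((u ⊕ ⊝ (u ⋆ (U ⋆ T))) ⊕ (w ⋆ U ⊕ v ⋆ T)) n
        ≈⟨ +-cong (+-congˡ (-‿cong (⋆-cong {f = u} (λ _ → refl) U⋆T≋1 n)))
                  (+-congʳ (⋆-cong {h = U} (λ k → trans (τ-cong s U⋆T≋1 k) (τ-δ0 r k)) (λ _ → refl) n)) ⟩
      ((u ⊕ ⊝ (u ⋆ δ 0)) ⊕ (δ 0 ⋆ U ⊕ v ⋆ T)) n
        ≈⟨ ⋆-inverse-rule₂ U T u v n ⟩
      (U ⊕ ⊝ ((⊝ v) ⋆ T)) n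
        ≈⟨ +-congˡ (-‿cong (⋆-cong {h = T} (λ k → sym (τ-⊝ s (U ⋆ U) k)) (λ _ → refl) n)) ⟩
      (U ⊕ ⊝ (τ s (⊝ (U ⋆ U)) ⋆ T)) n ∎

  -- `A m` is the m-th power of `A 1`, presented by its recursion, and the last hypothesis says that
  -- T is the inverse of 1 - `A 1`.
  module _ (A : ℕ → Seq) (bA : ∀ m → Bounded (A m))
           (A-zero : A 0 ≋ δ 0) (A-suc : ∀ m → A (suc m) ≋ A 1 ⋆ A m)
           (T≋1+A⋆T : T ≋ δ 0 ⊕ A 1 ⋆ T) where

    U : Seq
    U = δ 0 ⊕ ⊝ A 1

    bU : Bounded U
    bU = bounded-⊕ bounded-δ0 (bounded-⊝ (bA 1))

    U⋆T≋1 : U ⋆ T ≋ δ 0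
    U⋆T≋1 n = begin-equality
      (U ⋆ T) n
        ≈⟨ ⋆-[1-a]t (A 1) T n ⟩
      T n - (A 1 ⋆ T) n                     ≈⟨ +-congʳ (T≋1+A⋆T n) ⟩
      δ 0 n + (A 1 ⋆ T) n - (A 1 ⋆ T) n     ≈⟨ solve 2 (λ a b → a :+ b :- b := a) refl _ _ ⟩
      δ 0 n                                 ∎

    -- `A 1` is 1 - U, and the constant 1 contributes nothing: `δ 0` has finite support and is
    -- negligible to every order.
    expands-A₁ : ∀ r → Expands (suc r) (A 1) (U ⋆ U)
    expands-A₁ r = negligible-cong eq
      (negligible-⊕ negligible-δ0 (negligible-⊝ (expands-inverse r bU U⋆T≋1)))
      where
      eq : δ 0 ⊕ ⊝ (U ⊕ ⊝ (τ (suc r) (⊝ (U ⋆ U)) ⋆ T)) ≋ A 1 ⊕ ⊝ (τ (suc r) (U ⋆ U) ⋆ T)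
      eq n = trans
        (+-congˡ (-‿cong (+-congˡ (-‿cong (⋆-cong {h = T} (τ-⊝ (suc r) (U ⋆ U)) (λ _ → refl) n)))))
        (⋆-1-[1-a--vt] (A 1) (τ (suc r) (U ⋆ U)) T n)

    -- The power rule for the derivation sending `A 1` to U²: the product rule yields (m+1) copies
    -- of U² ⋆ `A (suc m)` from the factor `A (suc m)` and one more from the factor `A 1`.
    expands-A : ∀ r m → Expands (suc r) (A (suc m)) (fromℕ (suc m) ⊙ (U ⋆ U ⋆ A m))
    expands-A r zero    = expands-cong (suc r) (λ _ → refl) (λ n → sym (begin-equality
      fromℕ 1 * (U ⋆ U ⋆ A 0) n     ≈⟨ *-congʳ fromℕ-1 ⟩
      1# * (U ⋆ U ⋆ A 0) n          ≈⟨ *-identityˡ _ ⟩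
      (U ⋆ U ⋆ A 0) n               ≈⟨ ⋆-cong {f = U ⋆ U} (λ _ → refl) A-zero n ⟩
      (U ⋆ U ⋆ δ 0) n               ≈⟨ ⋆-identityʳ (U ⋆ U) n ⟩
      (U ⋆ U) n                     ∎)) (expands-A₁ r)
    expands-A r (suc m) = expands-cong (suc r) (λ n → sym (A-suc (suc m) n)) eq
      (expands-⋆ (suc r) (bA 1) (bA (suc m)) bounded-T (expands-A₁ r) (expands-A r m))
      where
      M = fromℕ (suc m)
      eq : A 1 ⋆ (M ⊙ (U ⋆ U ⋆ A m)) ⊕ U ⋆ U ⋆ A (suc m) ≋ fromℕ (suc (suc m)) ⊙ (U ⋆ U ⋆ A (suc m))
      eq n = begin-equality
        (A 1 ⋆ (M ⊙ (U ⋆ U ⋆ A m))) n + V n        ≈⟨ +-congʳ (⋆-comm (A 1) (M ⊙ (U ⋆ U ⋆ A m)) n) ⟩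
        ((M ⊙ (U ⋆ U ⋆ A m)) ⋆ A 1) n + V n        ≈⟨ +-congʳ (⊙-⋆ M (U ⋆ U ⋆ A m) (A 1) n) ⟩
        M * (U ⋆ U ⋆ A m ⋆ A 1) n + V n            ≈⟨ +-congʳ (*-congˡ (⋆-assoc (U ⋆ U) (A m) (A 1) n)) ⟩
        M * (U ⋆ U ⋆ (A m ⋆ A 1)) n + V n
          ≈⟨ +-congʳ (*-congˡ (⋆-cong {f = U ⋆ U} (λ _ → refl)
               (λ k → trans (⋆-comm (A m) (A 1) k) (sym (A-suc m k))) n)) ⟩
        M * V n + V n                              ≈⟨ solve 2 (λ m v → m :* v :+ v := (:1 :+ m) :* v) refl M (V n) ⟩
        fromℕ (suc (suc m)) * V n                  ∎
        where V = U ⋆ U ⋆ A (suc m)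

    -- Multiplying by (1 - `A 1`)² takes the second difference of the powers; the bracket in `Q`
    -- originates here.
    U⋆U⋆A : ∀ m → U ⋆ U ⋆ A m ≋ A m ⊕ ⊝ (fromℕ 2 ⊙ A (suc m)) ⊕ A (suc (suc m))
    U⋆U⋆A m n = begin-equality
      (U ⋆ U ⋆ A m) n
        ≈⟨ ⋆-[1-a][1-a]b (A 1) (A m) n ⟩
      A m n - (AA n + AA n) + (A 1 ⋆ AA) n
        ≈⟨ +-cong (+-congˡ (-‿cong (+-cong (sym (A-suc m n)) (sym (A-suc m n)))))
                  (trans (⋆-cong {f = A 1} (λ _ → refl) (λ k → sym (A-suc m k)) n) (sym (A-suc (suc m) n))) ⟩
      A m n - (A (suc m) n + A (suc m) n) + A (suc (suc m)) n
        ≈⟨ +-congʳ (+-congˡ (-‿cong (solve 1 (λ a → a :+ a := (:1 :+ (:1 :+ :0)) :* a) refl _))) ⟩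
      A m n - fromℕ 2 * A (suc m) n + A (suc (suc m)) n ∎
      where AA = A 1 ⋆ A m

-- Strong components, closed sets and the source component.

module Graph where
  open import Data.Bool.Base using (T)
  open import Data.Fin.Properties using (any?; all?)
  open import Data.List.Membership.Propositional using (_∈_)
  open import Data.List.Membership.Propositional.Properties
    using (∈-deduplicate⁺; ∈-deduplicate⁻; ∈-tabulate⁺; ∈-tabulate⁻)
  open import Data.List.Relation.Unary.All as All using (All)
  open import Data.List.Relation.Unary.Any using (here; there)
  open import Data.List.Relation.Unary.Unique.Propositional using (Unique; _∷_)
  import Data.List.Relation.Unary.Unique.DecPropositional.Properties as Unique
  open import Data.Nat.Base using (_+_)
  open import Relation.Binary.Construct.Closure.ReflexiveTransitive using (ε; _◅_; _◅◅_; gmap)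
  open import Relation.Binary.Core using (Rel)
  open ≡ using (refl; cong; cong₂; sym; trans; subst)

  dec-true⁻ : ∀ {A : Set} (a? : Dec A) → does a? ≡ true → A
  dec-true⁻ (yes a) _ = a

  -- An equivalence class is counted at its last element.
  classes : ∀ {n} {E : Rel (Fin n) 0ℓ} → Decidable E → ℕ
  classes {zero}  E? = 0
  classes {suc n} E? = (if does (any? λ j → E? zero (suc j)) then 0 else 1) + classes λ i j → E? (suc i) (suc j)

  classes-cong : ∀ {n} {E F : Rel (Fin n) 0ℓ} (E? : Decidable E) (F? : Decidable F) →
                 (∀ i j → E i j ⇔ F i j) → classes E? ≡ classes F?
  classes-cong {zero}  E? F? E⇔F = refl
  classes-cong {suc n} E? F? E⇔F = cong₂ (λ b k → (if b then 0 else 1) + k)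
    (does-⇔ (mk⇔ (λ (j , e) → j , Equivalence.to (E⇔F zero (suc j)) e)
                 (λ (j , f) → j , Equivalence.from (E⇔F zero (suc j)) f)) (any? _) (any? _))
    (classes-cong (λ i j → E? (suc i) (suc j)) (λ i j → F? (suc i) (suc j)) λ i j → E⇔F (suc i) (suc j))

  module _ {A : Set} (_≟_ : DecidableEquality A) where

    filter-≢ : ∀ x ys → All (x ≢_) ys → filter (λ y → ¬? (x ≟ y)) ys ≡ ys
    filter-≢ x ys = List.filter-all (λ y → ¬? (x ≟ y))

    length-filter-≢ : ∀ x ys → Unique ys → x ∈ ys → suc (length (filter (λ y → ¬? (x ≟ y)) ys)) ≡ length ys
    length-filter-≢ x (y ∷ ys) (y∉ys ∷ uys) (here refl) = cong (suc ∘ length)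
      (trans (List.filter-reject (λ y → ¬? (x ≟ y)) (λ x≢x → x≢x refl)) (filter-≢ x ys y∉ys))
    length-filter-≢ x (y ∷ ys) (y∉ys ∷ uys) (there x∈ys) = trans
      (cong (suc ∘ length) (List.filter-accept (λ y → ¬? (x ≟ y)) {x = y} {xs = ys} (λ x≡y → All.lookup y∉ys x∈ys (sym x≡y))))
      (cong suc (length-filter-≢ x ys uys x∈ys))

    length-deduplicate-∷ : ∀ x xs (x∈xs? : Dec (x ∈ xs)) →
      length (deduplicate _≟_ (x ∷ xs)) ≡ (if does x∈xs? then 0 else 1) + length (deduplicate _≟_ xs)
    length-deduplicate-∷ x xs (yes x∈xs) =
      length-filter-≢ x (deduplicate _≟_ xs) (Unique.deduplicate-! _≟_ xs) (∈-deduplicate⁺ _≟_ x∈xs)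
    length-deduplicate-∷ x xs (no  x∉xs) = cong (suc ∘ length) (filter-≢ x (deduplicate _≟_ xs)
      (All.tabulate λ y∈ x≡y → x∉xs (subst (_∈ xs) (sym x≡y) (∈-deduplicate⁻ _≟_ xs y∈))))

    length-deduplicate-tabulate : ∀ {n} (f : Fin n → A) →
      length (deduplicate _≟_ (List.tabulate f)) ≡ classes (λ i j → f i ≟ f j)
    length-deduplicate-tabulate {zero}  f = refl
    length-deduplicate-tabulate {suc n} f = trans
      (length-deduplicate-∷ (f zero) (List.tabulate (f ∘ suc)) f0∈?)
      (cong ((if does f0∈? then 0 else 1) +_) (length-deduplicate-tabulate (f ∘ suc)))
      where
      f0∈? : Dec (f zero ∈ List.tabulate (f ∘ suc))
      f0∈? = map′ (λ (j , eq) → subst (_∈ List.tabulate (f ∘ suc)) (sym eq) (∈-tabulate⁺ j)) ∈-tabulate⁻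
                  (any? λ j → f zero ≟ f (suc j))

  module _ {n} (t : Digraph n) where

    component-≡ : ∀ i j → component t i ≡ component t j ⇔ MutuallyReachable t i j
    component-≡ i j = mk⇔ to from
      where
      to : component t i ≡ component t j → MutuallyReachable t i j
      to eq = dec-true⁻ (mutuallyReachable? t i j)
        (trans (sym (Vec.lookup∘tabulate (λ k → does (mutuallyReachable? t i k)) j))
          (trans (cong (λ S → lookup S j) eq)
            (trans (Vec.lookup∘tabulate (λ k → does (mutuallyReachable? t j k)) j)
                   (dec-true (mutuallyReachable? t j j) (ε , ε)))))
      from : MutuallyReachable t i j → component t i ≡ component t j
      from (i⇝j , j⇝i) = Vec.tabulate-cong λ k → does-⇔
        (mk⇔ (λ (i⇝k , k⇝i) → j⇝i ◅◅ i⇝k , k⇝i ◅◅ i⇝j)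
             (λ (j⇝k , k⇝j) → i⇝j ◅◅ j⇝k , k⇝j ◅◅ j⇝i))
        (mutuallyReachable? t i k) (mutuallyReachable? t j k)

    -- The list of components consists of subsets of [n] and cannot be compared across vertex sets;
    -- a count of classes depends on the relation alone.
    numComponents≡classes : numComponents t ≡ classes (mutuallyReachable? t)
    numComponents≡classes = trans
      (cong (length ∘ deduplicate _≟ˢ_) (List.map-tabulate (λ i → i) (component t)))
      (trans (length-deduplicate-tabulate _≟ˢ_ (component t))
             (classes-cong (λ i j → component t i ≟ˢ component t j) (mutuallyReachable? t) component-≡))
      where _≟ˢ_ = Vec.≡-dec Bool._≟_

  -- A set of vertices is a vector of Booleans; ι S enumerates its elements.
  # : ∀ {n} → Vec Bool n → ℕ
  # []          = 0
  # (true  ∷ S) = suc (# S)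
  # (false ∷ S) = # S

  ∁ : ∀ {n} → Vec Bool n → Vec Bool n
  ∁ = map not

  ι : ∀ {n} (S : Vec Bool n) → Fin (# S) → Fin n
  ι (true  ∷ S) zero    = zero
  ι (true  ∷ S) (suc i) = suc (ι S i)
  ι (false ∷ S) i       = suc (ι S i)

  ι-∈ : ∀ {n} (S : Vec Bool n) i → lookup S (ι S i) ≡ true
  ι-∈ (true  ∷ S) zero    = refl
  ι-∈ (true  ∷ S) (suc i) = ι-∈ S i
  ι-∈ (false ∷ S) i       = ι-∈ S i

  ι-surjective : ∀ {n} (S : Vec Bool n) j → lookup S j ≡ true → ∃[ i ] ι S i ≡ j
  ι-surjective (true  ∷ S) zero    _   = zero , refl
  ι-surjective (true  ∷ S) (suc j) j∈S with i , eq ← ι-surjective S j j∈S = suc i , cong suc eq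
  ι-surjective (false ∷ S) (suc j) j∈S with i , eq ← ι-surjective S j j∈S = i , cong suc eq

  ι-injective : ∀ {n} (S : Vec Bool n) {i j} → ι S i ≡ ι S j → i ≡ j
  ι-injective (true  ∷ S) {zero}  {zero}  eq = refl
  ι-injective (true  ∷ S) {suc i} {suc j} eq = cong suc (ι-injective S (Fin.suc-injective eq))
  ι-injective (false ∷ S) eq = ι-injective S (Fin.suc-injective eq)

  lookup-∁ : ∀ {n} (S : Vec Bool n) i → lookup (∁ S) i ≡ not (lookup S i)
  lookup-∁ S i = Vec.lookup-map i not S

  -- Related vertices lie on the same side of `S`, so a vertex has a later related vertex exactly
  -- when it has one on its own side.
  classes-split : ∀ {n} {E : Rel (Fin n) 0ℓ} (E? : Decidable E) (S : Vec Bool n) →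
    (∀ i j → E i j → lookup S i ≡ lookup S j) →
    classes E? ≡ classes (λ i j → E? (ι S i) (ι S j)) + classes (λ i j → E? (ι (∁ S) i) (ι (∁ S) j))
  classes-split E? [] E⇒S = refl
  classes-split {E = E} E? (true ∷ S) E⇒S = trans
    (cong₂ (λ b k → (if b then 0 else 1) + k)
      (does-⇔ (mk⇔ shrink (λ (i , e) → ι S i , e)) (any? _) (any? _))
      (classes-split (λ i j → E? (suc i) (suc j)) S λ i j → E⇒S (suc i) (suc j)))
    (sym (ℕ.+-assoc (if does (any? λ i → E? zero (suc (ι S i))) then 0 else 1) _ _))
    where
    shrink : ∃[ j ] E zero (suc j) → ∃[ i ] E zero (suc (ι S i))
    shrink (j , e) with i , refl ← ι-surjective S j (sym (E⇒S zero (suc j) e)) = i , e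
  classes-split {E = E} E? (false ∷ S) E⇒S = trans
    (cong₂ (λ b k → (if b then 0 else 1) + k)
      (does-⇔ (mk⇔ shrink (λ (i , e) → ι (∁ S) i , e)) (any? _) (any? _))
      (classes-split (λ i j → E? (suc i) (suc j)) S λ i j → E⇒S (suc i) (suc j)))
    (x+yz (if does (any? λ i → E? zero (suc (ι (∁ S) i))) then 0 else 1)
          (classes λ i j → E? (suc (ι S i)) (suc (ι S j)))
          (classes λ i j → E? (suc (ι (∁ S) i)) (suc (ι (∁ S) j))))
    where
    open import Algebra.Properties.CommutativeSemigroup ℕ.+-commutativeSemigroup renaming (x∙yz≈y∙xz to x+yz)
    shrink : ∃[ j ] E zero (suc j) → ∃[ i ] E zero (suc (ι (∁ S) i))
    shrink (j , e) with i , refl ← ι-surjective (∁ S) j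
      (trans (lookup-∁ S j) (cong not (sym (E⇒S zero (suc j) e)))) = i , e

  -- The last vertex has no later one, so it is always counted.
  classes-suc-positive : ∀ {n} {E : Rel (Fin (suc n)) 0ℓ} (E? : Decidable E) → classes E? ≢ 0
  classes-suc-positive {n} E? with any? (λ j → E? zero (suc j))
  classes-suc-positive {zero}  E? | no  _       = λ ()
  classes-suc-positive {suc n} E? | no  _       = λ ()
  classes-suc-positive {suc n} E? | yes _       = classes-suc-positive (λ i j → E? (suc i) (suc j))

  total⇒classes≡1 : ∀ {n} {E : Rel (Fin (suc n)) 0ℓ} (E? : Decidable E) → (∀ i j → E i j) → classes E? ≡ 1
  total⇒classes≡1 {zero}  E? total = refl
  total⇒classes≡1 {suc n} E? total = cong₂ (λ b k → (if b then 0 else 1) + k)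
    (dec-true (any? λ j → E? zero (suc j)) (zero , total zero (suc zero)))
    (total⇒classes≡1 (λ i j → E? (suc i) (suc j)) λ i j → total (suc i) (suc j))

  classes≡1⇒total : ∀ {n} {E : Rel (Fin n) 0ℓ} (E? : Decidable E) →
    (∀ i → E i i) → (∀ {i j} → E i j → E j i) → (∀ {i j k} → E i j → E j k → E i k) →
    classes E? ≡ 1 → ∀ i j → E i j
  classes≡1⇒total {suc n} {E} E? rf sy tr eq with any? (λ j → E? zero (suc j))
  ... | yes (k , e) = total
    where
    IH = classes≡1⇒total (λ i j → E? (suc i) (suc j)) (λ i → rf (suc i)) sy tr eq
    total : ∀ i j → E i j
    total zero    zero    = rf zero
    total zero    (suc j) = tr e (IH k j)
    total (suc i) zero    = tr (IH i k) (sy e)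
    total (suc i) (suc j) = IH i j
  classes≡1⇒total {suc zero}    {E} E? rf sy tr eq | no _ = λ { zero zero → rf zero }
  -- Vertex 0 already accounts for the only class, while the remaining vertices would contribute at
  -- least one more.
  classes≡1⇒total {suc (suc n)} {E} E? rf sy tr eq | no _ =
    contradiction (ℕ.suc-injective eq) (classes-suc-positive (λ i j → E? (suc i) (suc j)))

  module _ {n} (t : Digraph n) where
    numComponents≡1⇒stronglyConnected : numComponents t ≡ 1 → StronglyConnected t
    numComponents≡1⇒stronglyConnected eq i j = proj₁ (classes≡1⇒total (mutuallyReachable? t)
      (λ _ → ε , ε) (λ (p , q) → q , p) (λ (p , q) (p′ , q′) → p ◅◅ p′ , q′ ◅◅ q)
      (trans (sym (numComponents≡classes t)) eq) i j)

  -- The index `suc n` matters: the empty digraph is vacuously strongly connected but has no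
  -- component.
  stronglyConnected⇒numComponents≡1 : ∀ {n} (t : Digraph (suc n)) → StronglyConnected t → numComponents t ≡ 1
  stronglyConnected⇒numComponents≡1 t sc = trans (numComponents≡classes t)
    (total⇒classes≡1 (mutuallyReachable? t) λ i j → sc i j , sc j i)

  data Arc : Set where
    fwd bwd both : Arc

  out inn : Arc → Bool
  out fwd  = true
  out bwd  = false
  out both = true
  inn fwd  = false
  inn bwd  = true
  inn both = true

  -- as ∷ t adds to t a vertex 0, joined to vertex j of t by the arc as[j], read as going out of 0.
  data Tour : ℕ → Set where
    []  : Tour 0
    _∷_ : ∀ {n} → Vec Arc n → Tour n → Tour (suc n)

  -- `d` is the loop bit of the new vertex 0, `r` holds its outgoing and `c` its incoming edges.
  -- Every matrix has this form, whether or not it is a tournament.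
  cone : ∀ {n} → Bool → Vec Bool n → Vec Bool n → Digraph n → Digraph (suc n)
  cone d r c t = (d ∷ r) ∷ zipWith _∷_ c t

  toDigraph : ∀ {n} → Tour n → Digraph n
  toDigraph []       = []
  toDigraph (as ∷ t) = cone false (map out as) (map inn as) (toDigraph t)

  adj-cone-s0 : ∀ {n} d r c (t : Digraph n) i → adj (cone d r c t) (suc i) zero ≡ lookup c i
  adj-cone-s0 d r c t i = cong (λ row → lookup row zero) (Vec.lookup-zipWith _∷_ i c t)

  adj-cone-ss : ∀ {n} d r c (t : Digraph n) i j → adj (cone d r c t) (suc i) (suc j) ≡ adj t i j
  adj-cone-ss d r c t i j = cong (λ row → lookup row (suc j)) (Vec.lookup-zipWith _∷_ i c t)

  module _ {n} (as : Vec Arc n) (t : Tour n) where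
    private D = toDigraph (as ∷ t)

    adj-0s : ∀ j → adj D zero (suc j) ≡ out (lookup as j)
    adj-0s j = Vec.lookup-map j out as

    adj-s0 : ∀ i → adj D (suc i) zero ≡ inn (lookup as i)
    adj-s0 i = trans (adj-cone-s0 false (map out as) (map inn as) (toDigraph t) i) (Vec.lookup-map i inn as)

    adj-ss : ∀ i j → adj D (suc i) (suc j) ≡ adj (toDigraph t) i j
    adj-ss = adj-cone-ss false (map out as) (map inn as) (toDigraph t)

  pick : ∀ {n} (S : Vec Bool n) → Vec Arc n → Vec Arc (# S)
  pick []          []       = []
  pick (true  ∷ S) (a ∷ as) = a ∷ pick S as
  pick (false ∷ S) (a ∷ as) = pick S as

  lookup-pick : ∀ {n} (S : Vec Bool n) as i → lookup (pick S as) i ≡ lookup as (ι S i)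
  lookup-pick (true  ∷ S) (a ∷ as) zero    = refl
  lookup-pick (true  ∷ S) (a ∷ as) (suc i) = lookup-pick S as i
  lookup-pick (false ∷ S) (a ∷ as) i       = lookup-pick S as i

  restrict : ∀ {n} (S : Vec Bool n) → Tour n → Tour (# S)
  restrict []          []       = []
  restrict (true  ∷ S) (as ∷ t) = pick S as ∷ restrict S t
  restrict (false ∷ S) (as ∷ t) = restrict S t

  adj-restrict : ∀ {n} (S : Vec Bool n) (t : Tour n) i j →
                 adj (toDigraph (restrict S t)) i j ≡ adj (toDigraph t) (ι S i) (ι S j)
  adj-restrict (true  ∷ S) (as ∷ t) zero    zero    = refl
  adj-restrict (true  ∷ S) (as ∷ t) zero    (suc j) =
    trans (adj-0s (pick S as) (restrict S t) j) (trans (cong out (lookup-pick S as j)) (sym (adj-0s as t (ι S j))))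
  adj-restrict (true  ∷ S) (as ∷ t) (suc i) zero    =
    trans (adj-s0 (pick S as) (restrict S t) i) (trans (cong inn (lookup-pick S as i)) (sym (adj-s0 as t (ι S i))))
  adj-restrict (true  ∷ S) (as ∷ t) (suc i) (suc j) =
    trans (adj-ss (pick S as) (restrict S t) i j) (trans (adj-restrict S t i j) (sym (adj-ss as t (ι S i) (ι S j))))
  adj-restrict (false ∷ S) (as ∷ t) i       j       =
    trans (adj-restrict S t i j) (sym (adj-ss as t (ι S i) (ι S j)))

  _==_ : Arc → Arc → Bool
  fwd  == fwd  = true
  bwd  == bwd  = true
  both == both = true
  _    == _    = false

  -- Boolean-valued because it becomes a factor 0 or 1 in sums; the arcs to `S` itself stay free.
  fits : ∀ {n} → Arc → Vec Bool n → Vec Arc n → Bool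
  fits e []          []       = true
  fits e (true  ∷ S) (a ∷ as) = fits e S as
  fits e (false ∷ S) (a ∷ as) = (e == a) ∧ fits e S as

  -- No edge enters S from outside.
  closed : ∀ {n} → Vec Bool n → Tour n → Bool
  closed []          []       = true
  closed (true  ∷ S) (as ∷ t) = fits fwd S as ∧ closed S t
  closed (false ∷ S) (as ∷ t) = fits bwd (∁ S) as ∧ closed S t

  ==⇒≡ : ∀ e a → T (e == a) → e ≡ a
  ==⇒≡ fwd  fwd  _ = refl
  ==⇒≡ bwd  bwd  _ = refl
  ==⇒≡ both both _ = refl

  ==-refl : ∀ e → T (e == e)
  ==-refl fwd  = _
  ==-refl bwd  = _
  ==-refl both = _

  T-∧⁻ : ∀ {a b} → T (a ∧ b) → T a × T b
  T-∧⁻ = Equivalence.to Bool.T-∧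

  T-∧⁺ : ∀ {a b} → T a → T b → T (a ∧ b)
  T-∧⁺ p q = Equivalence.from Bool.T-∧ (p , q)

  fits⇒ : ∀ {n} e (S : Vec Bool n) as → T (fits e S as) → ∀ j → lookup S j ≡ false → e ≡ lookup as j
  fits⇒ e (true  ∷ S) (a ∷ as) f (suc j) j∉S = fits⇒ e S as f j j∉S
  fits⇒ e (false ∷ S) (a ∷ as) f zero    _   = ==⇒≡ e a (proj₁ (T-∧⁻ {e == a} f))
  fits⇒ e (false ∷ S) (a ∷ as) f (suc j) j∉S = fits⇒ e S as (proj₂ (T-∧⁻ {e == a} f)) j j∉S

  ⇒fits : ∀ {n} e (S : Vec Bool n) as → (∀ j → lookup S j ≡ false → e ≡ lookup as j) → T (fits e S as)
  ⇒fits e []          []       p = _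
  ⇒fits e (true  ∷ S) (a ∷ as) p = ⇒fits e S as (λ j → p (suc j))
  ⇒fits e (false ∷ S) (a ∷ as) p =
    T-∧⁺ {e == a} (subst (λ a → T (e == a)) (p zero refl) (==-refl e)) (⇒fits e S as (λ j → p (suc j)))

  -- The form of `closed` suited to arguments about walks.
  Closed : ∀ {n} → Vec Bool n → Digraph n → Set
  Closed S t = ∀ i j → Edge t i j → lookup S j ≡ true → lookup S i ≡ true

  ∉∁ : ∀ {n} (S : Vec Bool n) j → lookup S j ≡ true → lookup (∁ S) j ≡ false
  ∉∁ S j j∈S = trans (lookup-∁ S j) (cong not j∈S)

  ∉∁⁻ : ∀ {n} (S : Vec Bool n) j → lookup (∁ S) j ≡ false → lookup S j ≡ true
  ∉∁⁻ S j j∉∁S = Bool.not-injective (trans (sym (lookup-∁ S j)) j∉∁S)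

  closed⇒Closed : ∀ {n} (S : Vec Bool n) t → T (closed S t) → Closed S (toDigraph t)
  closed⇒Closed (true ∷ S) (as ∷ t) c zero    j       e j∈S = refl
  closed⇒Closed (true ∷ S) (as ∷ t) c (suc i) zero    e j∈S with lookup S i in eq
  ... | true  = refl
  ... | false = contradiction (subst T (trans (adj-s0 as t i)
                  (cong inn (sym (fits⇒ fwd S as (proj₁ (T-∧⁻ c)) i eq)))) e) λ ()
  closed⇒Closed (true ∷ S) (as ∷ t) c (suc i) (suc j) e j∈S =
    closed⇒Closed S t (proj₂ (T-∧⁻ {fits fwd S as} c)) i j (subst T (adj-ss as t i j) e) j∈S
  closed⇒Closed (false ∷ S) (as ∷ t) c zero   (suc j) e j∈S =
    contradiction (subst T (trans (adj-0s as t j)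
      (cong out (sym (fits⇒ bwd (∁ S) as (proj₁ (T-∧⁻ c)) j (∉∁ S j j∈S))))) e) λ ()
  closed⇒Closed (false ∷ S) (as ∷ t) c (suc i) (suc j) e j∈S =
    closed⇒Closed S t (proj₂ (T-∧⁻ {fits bwd (∁ S) as} c)) i j (subst T (adj-ss as t i j) e) j∈S

  inn≡false⇒fwd : ∀ a → ¬ T (inn a) → fwd ≡ a
  inn≡false⇒fwd fwd  _ = refl
  inn≡false⇒fwd bwd  p = contradiction _ p
  inn≡false⇒fwd both p = contradiction _ p

  out≡false⇒bwd : ∀ a → ¬ T (out a) → bwd ≡ a
  out≡false⇒bwd fwd  p = contradiction _ p
  out≡false⇒bwd bwd  _ = refl
  out≡false⇒bwd both p = contradiction _ p

  Closed⇒closed : ∀ {n} (S : Vec Bool n) t → Closed S (toDigraph t) → T (closed S t)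
  Closed⇒closed []         []       c = _
  Closed⇒closed (true ∷ S) (as ∷ t) c = T-∧⁺
    (⇒fits fwd S as λ j j∉S → inn≡false⇒fwd (lookup as j) λ e →
      contradiction (trans (sym (c (suc j) zero (subst T (sym (adj-s0 as t j)) e) refl)) j∉S) λ ())
    (Closed⇒closed S t λ i j e → c (suc i) (suc j) (subst T (sym (adj-ss as t i j)) e))
  Closed⇒closed (false ∷ S) (as ∷ t) c = T-∧⁺
    (⇒fits bwd (∁ S) as λ j j∉∁S → out≡false⇒bwd (lookup as j) λ e →
      contradiction (c zero (suc j) (subst T (sym (adj-0s as t j)) e) (∉∁⁻ S j j∉∁S)) λ ())
    (Closed⇒closed S t λ i j e → c (suc i) (suc j) (subst T (sym (adj-ss as t i j)) e))

  module _ {n} (S : Vec Bool n) (t : Tour n) (cl : Closed S (toDigraph t)) where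
    private
      D = toDigraph t
      D₁ = toDigraph (restrict S t)
      D₂ = toDigraph (restrict (∁ S) t)

    reach-∈ : ∀ {u v} → Reachable D u v → lookup S v ≡ true → lookup S u ≡ true
    reach-∈ ε       v∈S = v∈S
    reach-∈ (_◅_ {i = u} {j = w} e p) v∈S = cl u w e (reach-∈ p v∈S)

    restrict-reach : ∀ S′ {i j} → Reachable (toDigraph (restrict S′ t)) i j → Reachable D (ι S′ i) (ι S′ j)
    restrict-reach S′ = gmap (ι S′) λ {i} {j} e → subst T (adj-restrict S′ t i j) e

    -- A walk that ends in a closed set stays in it throughout. The start `u` is an arbitrary
    -- vertex, as it is recognised as a member of `S` only after the rest of the walk has been
    -- treated.
    reach-restrict : ∀ {u} j → Reachable D u (ι S j) → ∃[ i ] (ι S i ≡ u × Reachable D₁ i j)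
    reach-restrict j ε = j , refl , ε
    reach-restrict j (_◅_ {i = u} e p) with reach-restrict j p
    ... | k , refl , q with i , refl ← ι-surjective S u (cl u (ι S k) e (ι-∈ S k)) =
      i , refl , subst T (sym (adj-restrict S t i k)) e ◅ q

    -- Dually, a walk that starts outside `S` never enters it.
    reach-restrict-∁ : ∀ i {v} → Reachable D (ι (∁ S) i) v → ∃[ j ] (ι (∁ S) j ≡ v × Reachable D₂ i j)
    reach-restrict-∁ i ε = i , refl , ε
    reach-restrict-∁ i (_◅_ {j = w} e p) with ι-surjective (∁ S) w w∈∁S
      where
      w∈∁S : lookup (∁ S) w ≡ true
      w∈∁S with lookup S w in eq
      ... | false = trans (lookup-∁ S w) (cong not eq)
      ... | true  = contradiction
        (trans (sym (ι-∈ (∁ S) i)) (∉∁ S (ι (∁ S) i) (cl (ι (∁ S) i) w e eq))) λ ()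
    ... | k , refl with j , eq , q ← reach-restrict-∁ k p =
      j , eq , subst T (sym (adj-restrict (∁ S) t i k)) e ◅ q

    reachable-ι⁻ : ∀ i j → Reachable D (ι S i) (ι S j) → Reachable D₁ i j
    reachable-ι⁻ i j p with k , eq , q ← reach-restrict j p =
      subst (λ k → Reachable D₁ k j) (ι-injective S eq) q

    reachable-ι∁⁻ : ∀ i j → Reachable D (ι (∁ S) i) (ι (∁ S) j) → Reachable D₂ i j
    reachable-ι∁⁻ i j p with k , eq , q ← reach-restrict-∁ i p =
      subst (Reachable D₂ i) (ι-injective (∁ S) eq) q

    -- Mutually reachable vertices lie on the same side of a closed set, and walks between vertices
    -- of one side do not leave that side.
    numComponents-split : numComponents D ≡ numComponents D₁ + numComponents D₂
    numComponents-split = trans (numComponents≡classes D) (trans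
      (classes-split (mutuallyReachable? D) S λ i j (p , q) → same i j p q)
      (sym (cong₂ _+_
        (trans (numComponents≡classes D₁) (classes-cong (mutuallyReachable? D₁) _ λ i j →
          mk⇔ (λ (p , q) → restrict-reach S p , restrict-reach S q)
              (λ (p , q) → reachable-ι⁻ i j p , reachable-ι⁻ j i q)))
        (trans (numComponents≡classes D₂) (classes-cong (mutuallyReachable? D₂) _ λ i j →
          mk⇔ (λ (p , q) → restrict-reach (∁ S) p , restrict-reach (∁ S) q)
              (λ (p , q) → reachable-ι∁⁻ i j p , reachable-ι∁⁻ j i q))))))
      where
      same : ∀ i j → Reachable D i j → Reachable D j i → lookup S i ≡ lookup S j
      same i j p q with lookup S i in eqi | lookup S j in eqj
      ... | true  | true  = refl
      ... | false | false = refl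
      ... | true  | false = contradiction (trans (sym (reach-∈ q eqi)) eqj) λ ()
      ... | false | true  = contradiction (trans (sym (reach-∈ p eqj)) eqi) λ ()

  -- The arc between vertex 0 and a source of the remaining tour decides: whichever endpoint has an
  -- edge to the other reaches everything.
  source : ∀ {n} (t : Tour (suc n)) → ∃[ s ] ∀ j → Reachable (toDigraph t) s j
  source {zero}  (as ∷ t) = zero , λ { zero → ε }
  source {suc n} (as ∷ t) with s , s⇝ ← source t with lookup as s in eq
  ... | fwd  = zero , λ { zero → ε ; (suc j) → zero⇝ ◅ lift s⇝ j }
    where
    zero⇝ = subst T (sym (trans (adj-0s as t s) (cong out eq))) _
    lift : (∀ j → Reachable (toDigraph t) s j) → ∀ j → Reachable (toDigraph (as ∷ t)) (suc s) (suc j)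
    lift r j = gmap suc (λ {i} {j} e → subst T (sym (adj-ss as t i j)) e) (r j)
  ... | bwd  = suc s , λ { zero → subst T (sym (trans (adj-s0 as t s) (cong inn eq))) _ ◅ ε
                         ; (suc j) → gmap suc (λ {i} {j} e → subst T (sym (adj-ss as t i j)) e) (s⇝ j) }
  ... | both = suc s , λ { zero → subst T (sym (trans (adj-s0 as t s) (cong inn eq))) _ ◅ ε
                         ; (suc j) → gmap suc (λ {i} {j} e → subst T (sym (adj-ss as t i j)) e) (s⇝ j) }

  -- The first component in the linear order of strong components.
  sourceComponent : ∀ {n} → Digraph n → Vec Bool n
  sourceComponent t = tabulate λ i → does (all? λ j → reachable? t i j)

  module _ {n} (t : Digraph n) where
    ∈-source⁺ : ∀ i → (∀ j → Reachable t i j) → lookup (sourceComponent t) i ≡ true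
    ∈-source⁺ i p = trans (Vec.lookup∘tabulate _ i) (dec-true (all? λ j → reachable? t i j) p)

    ∈-source⁻ : ∀ i → lookup (sourceComponent t) i ≡ true → ∀ j → Reachable t i j
    ∈-source⁻ i i∈ = dec-true⁻ (all? λ j → reachable? t i j) (trans (sym (Vec.lookup∘tabulate _ i)) i∈)

    source-closed : Closed (sourceComponent t) t
    source-closed i j e j∈ = ∈-source⁺ i λ k → e ◅ ∈-source⁻ j j∈ k

  source-connected : ∀ {n} (t : Tour (suc n)) → let S = sourceComponent (toDigraph t) in
                     numComponents (toDigraph (restrict S t)) ≡ 1
  source-connected t = go (restrict S t) (ι-surjective S s (∈-source⁺ D s s⇝)) sc
    where
    D = toDigraph t
    S = sourceComponent D
    s = proj₁ (source t)
    s⇝ = proj₂ (source t)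
    sc : StronglyConnected (toDigraph (restrict S t))
    sc i j = reachable-ι⁻ S t (source-closed D) i j (∈-source⁻ D (ι S i) (ι-∈ S i) (ι S j))
    -- Abstracting the size `# S` permits matching on the tour; the vertex `s` in `S` excludes the
    -- empty one.
    go : ∀ {k v} {f : Fin k → Fin _} (t : Tour k) → ∃[ i ] f i ≡ v → StronglyConnected (toDigraph t) →
         numComponents (toDigraph t) ≡ 1
    go (as ∷ t) _ = stronglyConnected⇒numComponents≡1 (toDigraph (as ∷ t))

  nonempty : ∀ {n} (t : Digraph n) → numComponents t ≡ 1 → Fin n
  nonempty {suc n} t _ = zero

  -- One component forces `S` to contain a vertex. The source reaches it, hence lies in the closed
  -- set `S`; each vertex of `S` then reaches the source by connectedness, and so everything.
  -- Conversely, a vertex that reaches everything reaches into `S`, so it belongs to `S`.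
  closed-connected⇒source : ∀ {n} (S : Vec Bool (suc n)) t → Closed S (toDigraph t) →
    numComponents (toDigraph (restrict S t)) ≡ 1 → S ≡ sourceComponent (toDigraph t)
  closed-connected⇒source S t cl nc≡1 = trans (sym (Vec.tabulate∘lookup S))
    (trans (Vec.tabulate-cong pointwise) (Vec.tabulate∘lookup (sourceComponent D)))
    where
    D = toDigraph t
    s = proj₁ (source t)
    s⇝ = proj₂ (source t)
    k = nonempty (toDigraph (restrict S t)) nc≡1
    to : ∀ i → lookup S i ≡ true → lookup (sourceComponent D) i ≡ true
    to i i∈S with a , refl ← ι-surjective S i i∈S
             with b , eq ← ι-surjective S s (reach-∈ S t cl (s⇝ i) i∈S) =
      ∈-source⁺ D (ι S a) λ j →
        subst (Reachable D (ι S a)) eq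
          (restrict-reach S t cl S (numComponents≡1⇒stronglyConnected _ nc≡1 a b)) ◅◅ s⇝ j
    from : ∀ i → lookup (sourceComponent D) i ≡ true → lookup S i ≡ true
    from i i∈ = reach-∈ S t cl (∈-source⁻ D i i∈ (ι S k)) (ι-∈ S k)
    pointwise : ∀ i → lookup S i ≡ lookup (sourceComponent D) i
    pointwise i with lookup S i in eq | lookup (sourceComponent D) i in eq′
    ... | true  | true  = refl
    ... | false | false = refl
    ... | true  | false = contradiction (trans (sym (to i eq)) eq′) λ ()
    ... | false | true  = contradiction (trans (sym (from i eq′)) eq) λ ()

-- Sums over tournaments with ties and multiplicative weights.

module Summation {c ℓ₁ ℓ₂} (ℝ : Reals c ℓ₁ ℓ₂) where
  open Graph
  open import Data.Bool.Base using (T)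
  open Reals ℝ
  open RealNotation ℝ
  open RingSolver commutativeRing using (solve; _:=_; _:+_; _:*_; :0; :1)
  open Relation.Binary.Reasoning.Setoid (CommutativeRing.setoid commutativeRing)

  χ : Bool → Carrier
  χ true  = 1#
  χ false = 0#

  χ-∧ : ∀ a b → χ (a ∧ b) ≈ χ a * χ b
  χ-∧ true  b = sym (*-identityˡ (χ b))
  χ-∧ false b = sym (zeroˡ (χ b))

  χ-∧-* : ∀ a b z → χ (a ∧ b) * z ≈ χ a * (χ b * z)
  χ-∧-* a b z = trans (*-congʳ (χ-∧ a b)) (*-assoc _ _ z)

  module _ {a} {A : Set a} where

    ∑-cong : ∀ (xs : List A) {f h} → (∀ x → f x ≈ h x) → ∑ xs f ≈ ∑ xs h
    ∑-cong []       p = refl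
    ∑-cong (x ∷ xs) p = +-cong (p x) (∑-cong xs p)

    ∑-0 : ∀ (xs : List A) → ∑ xs (λ _ → 0#) ≈ 0#
    ∑-0 []       = refl
    ∑-0 (x ∷ xs) = trans (+-identityˡ _) (∑-0 xs)

    ∑-+ : ∀ (xs : List A) f h → ∑ xs (λ x → f x + h x) ≈ ∑ xs f + ∑ xs h
    ∑-+ []       f h = sym (+-identityˡ 0#)
    ∑-+ (x ∷ xs) f h = trans (+-congˡ (∑-+ xs f h))
      (solve 4 (λ a b c d → (a :+ b) :+ (c :+ d) := (a :+ c) :+ (b :+ d)) refl _ _ _ _)

    ∑-*ˡ : ∀ (xs : List A) z f → ∑ xs (λ x → z * f x) ≈ z * ∑ xs f
    ∑-*ˡ []       z f = sym (zeroʳ z)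
    ∑-*ˡ (x ∷ xs) z f = trans (+-congˡ (∑-*ˡ xs z f)) (sym (distribˡ z _ _))

    ∑-*ʳ : ∀ (xs : List A) z f → ∑ xs (λ x → f x * z) ≈ ∑ xs f * z
    ∑-*ʳ xs z f = trans (∑-cong xs (λ x → *-comm (f x) z)) (trans (∑-*ˡ xs z f) (*-comm z _))

    ∑-++ : ∀ (xs ys : List A) f → ∑ (xs ++ ys) f ≈ ∑ xs f + ∑ ys f
    ∑-++ []       ys f = sym (+-identityˡ _)
    ∑-++ (x ∷ xs) ys f = trans (+-congˡ (∑-++ xs ys f)) (sym (+-assoc _ _ _))

    ∑-filter : ∀ {p} {P : A → Set p} (P? : U.Decidable P) xs f →
               ∑ (filter P? xs) f ≈ ∑ xs (λ x → χ (does (P? x)) * f x)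
    ∑-filter P? []       f = refl
    ∑-filter P? (x ∷ xs) f with does (P? x)
    ... | true  = +-cong (sym (*-identityˡ (f x))) (∑-filter P? xs f)
    ... | false = trans (∑-filter P? xs f) (sym (trans (+-congʳ (zeroˡ (f x))) (+-identityˡ _)))

    ∏-cong : ∀ (xs : List A) {f h} → (∀ x → f x ≈ h x) → ∏ xs f ≈ ∏ xs h
    ∏-cong []       p = refl
    ∏-cong (x ∷ xs) p = *-cong (p x) (∏-cong xs p)

    ∏-++ : ∀ (xs ys : List A) f → ∏ (xs ++ ys) f ≈ ∏ xs f * ∏ ys f
    ∏-++ []       ys f = sym (*-identityˡ _)
    ∏-++ (x ∷ xs) ys f = trans (*-congˡ (∏-++ xs ys f)) (sym (*-assoc _ _ _))

    ∏-filter : ∀ {p} {P : A → Set p} (P? : U.Decidable P) xs f →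
               ∏ (filter P? xs) f ≈ ∏ xs (λ x → if does (P? x) then f x else 1#)
    ∏-filter P? []       f = refl
    ∏-filter P? (x ∷ xs) f with does (P? x)
    ... | true  = *-congˡ (∏-filter P? xs f)
    ... | false = trans (∏-filter P? xs f) (sym (*-identityˡ _))

    ^-length-filter : ∀ {p} {P : A → Set p} (P? : U.Decidable P) xs z →
                      z ^ length (filter P? xs) ≈ ∏ xs (λ x → if does (P? x) then z else 1#)
    ^-length-filter P? []       z = refl
    ^-length-filter P? (x ∷ xs) z with does (P? x)
    ... | true  = *-congˡ (^-length-filter P? xs z)
    ... | false = trans (^-length-filter P? xs z) (sym (*-identityˡ _))

  module _ {a b} {A : Set a} {B : Set b} where

    ∑-map : ∀ (g : A → B) xs f → ∑ (List.map g xs) f ≈ ∑ xs (f ∘ g)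
    ∑-map g []       f = refl
    ∑-map g (x ∷ xs) f = +-congˡ (∑-map g xs f)

    ∏-map : ∀ (g : A → B) xs f → ∏ (List.map g xs) f ≈ ∏ xs (f ∘ g)
    ∏-map g []       f = refl
    ∏-map g (x ∷ xs) f = *-congˡ (∏-map g xs f)

    ∑-swap : ∀ (xs : List A) (ys : List B) (f : A → B → Carrier) →
             ∑ xs (λ x → ∑ ys (f x)) ≈ ∑ ys (λ y → ∑ xs (λ x → f x y))
    ∑-swap []       ys f = sym (∑-0 ys)
    ∑-swap (x ∷ xs) ys f = trans (+-congˡ (∑-swap xs ys f)) (sym (∑-+ ys (f x) _))

  module _ {a b d} {A : Set a} {B : Set b} {D : Set d} where

    ∑-cartesianProductWith : ∀ (g : A → B → D) xs ys f →
      ∑ (cartesianProductWith g xs ys) f ≈ ∑ xs (λ x → ∑ ys (λ y → f (g x y)))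
    ∑-cartesianProductWith g []       ys f = refl
    ∑-cartesianProductWith g (x ∷ xs) ys f = trans (∑-++ (List.map (g x) ys) _ f)
      (+-cong (∑-map (g x) ys f) (∑-cartesianProductWith g xs ys f))

    ∏-cartesianProductWith : ∀ (g : A → B → D) xs ys f →
      ∏ (cartesianProductWith g xs ys) f ≈ ∏ xs (λ x → ∏ ys (λ y → f (g x y)))
    ∏-cartesianProductWith g []       ys f = refl
    ∏-cartesianProductWith g (x ∷ xs) ys f = trans (∏-++ (List.map (g x) ys) _ f)
      (*-cong (∏-map (g x) ys f) (∏-cartesianProductWith g xs ys f))

  ∏-allFin-suc : ∀ n f → ∏ (allFin (suc n)) f ≈ f zero * ∏ (allFin n) (f ∘ suc)
  ∏-allFin-suc n f = *-congˡ (trans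
    (reflexive (≡.cong (λ xs → ∏ xs f) (≡.sym (List.map-tabulate (λ i → i) suc))))
    (∏-map suc (allFin n) f))

  ∏-pairs : ∀ n f → ∏ (pairs n) f ≈
    ∏ (allFin n) (λ i → ∏ (allFin n) (λ j → if does (i Fin.<? j) then f (i , j) else 1#))
  ∏-pairs n f = trans (∏-filter (uncurry Fin._<?_) (cartesianProduct (allFin n) (allFin n)) f)
                      (∏-cartesianProductWith _,_ (allFin n) (allFin n) _)

  ∏-pairs-suc : ∀ n f → ∏ (pairs (suc n)) f ≈
    ∏ (allFin n) (λ j → f (zero , suc j)) * ∏ (pairs n) (λ (i , j) → f (suc i , suc j))
  ∏-pairs-suc n f = begin
    ∏ (pairs (suc n)) f
      ≈⟨ ∏-pairs (suc n) f ⟩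
    ∏ (allFin (suc n)) (λ i → ∏ (allFin (suc n)) (λ j → if does (i Fin.<? j) then f (i , j) else 1#))
      ≈⟨ ∏-allFin-suc n _ ⟩
    ∏ (allFin (suc n)) (λ j → if does (zero {n} Fin.<? j) then f (zero , j) else 1#) *
    ∏ (allFin n) (λ i → ∏ (allFin (suc n)) (λ j → if does (suc i Fin.<? j) then f (suc i , j) else 1#))
      ≈⟨ *-cong (trans (∏-allFin-suc n _) (*-identityˡ _))
                (∏-cong (allFin n) (λ i → trans (∏-allFin-suc n _) (*-identityˡ _))) ⟩
    ∏ (allFin n) (λ j → f (zero , suc j)) *
    ∏ (allFin n) (λ i → ∏ (allFin n) (λ j → if does (i Fin.<? j) then f (suc i , suc j) else 1#))
      ≈⟨ *-congˡ (∏-pairs n _) ⟨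
    ∏ (allFin n) (λ j → f (zero , suc j)) * ∏ (pairs n) (λ (i , j) → f (suc i , suc j)) ∎

  arcs : List Arc
  arcs = fwd ∷ bwd ∷ both ∷ []

  tours : ∀ n → List (Tour n)
  tours zero    = [] ∷ []
  tours (suc n) = cartesianProductWith _∷_ (vectors arcs n) (tours n)

  bits : List Bool
  bits = true ∷ false ∷ []

  anyEdge : ∀ {n} → Vec Bool n → Vec Bool n → Bool
  anyEdge []      []      = true
  anyEdge (x ∷ r) (y ∷ c) = (x ∨ y) ∧ anyEdge r c

  anyEdge⇒ : ∀ {n} (r c : Vec Bool n) → T (anyEdge r c) → ∀ j → T (lookup r j) ⊎ T (lookup c j)
  anyEdge⇒ (x ∷ r) (y ∷ c) p zero    = Equivalence.to Bool.T-∨ (proj₁ (T-∧⁻ {x ∨ y} p))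
  anyEdge⇒ (x ∷ r) (y ∷ c) p (suc j) = anyEdge⇒ r c (proj₂ (T-∧⁻ {x ∨ y} p)) j

  ⇒anyEdge : ∀ {n} (r c : Vec Bool n) → (∀ j → T (lookup r j) ⊎ T (lookup c j)) → T (anyEdge r c)
  ⇒anyEdge []      []      p = _
  ⇒anyEdge (x ∷ r) (y ∷ c) p = T-∧⁺ {x ∨ y} (Equivalence.from (Bool.T-∨ {x} {y}) (p zero)) (⇒anyEdge r c (λ j → p (suc j)))

  ⇒T-not : ∀ d → ¬ T d → T (not d)
  ⇒T-not false _  = _
  ⇒T-not true  ¬d = ¬d _

  T-not⇒ : ∀ d → T (not d) → ¬ T d
  T-not⇒ false _ ()

  cone-tournament : ∀ {n} d r c (t : Digraph n) → does (isTournamentWithTies? (cone d r c t))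
    ≡ not d ∧ (anyEdge r c ∧ does (isTournamentWithTies? t))
  cone-tournament d r c t = does-⇔ (mk⇔ to from) (isTournamentWithTies? (cone d r c t)) (T? _)
    where
    D = cone d r c t
    to : IsTournamentWithTies D → T (not d ∧ (anyEdge r c ∧ does (isTournamentWithTies? t)))
    to (irr , tot) = T-∧⁺ {not d} (⇒T-not d (irr zero)) (T-∧⁺ {anyEdge r c}
      (⇒anyEdge r c λ j → subst⊎ ≡.refl (adj-cone-s0 d r c t j) (tot zero (suc j) λ ()))
      (Equivalence.from Bool.T-≡ (dec-true (isTournamentWithTies? t)
        ( (λ i e → irr (suc i) (≡.subst T (≡.sym (adj-cone-ss d r c t i i)) e))
        , λ i j i≢j → subst⊎ (adj-cone-ss d r c t i j) (adj-cone-ss d r c t j i)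
                        (tot (suc i) (suc j) λ eq → i≢j (Fin.suc-injective eq))))))
      where
      subst⊎ : ∀ {a b a′ b′} → a ≡ a′ → b ≡ b′ → T a ⊎ T b → T a′ ⊎ T b′
      subst⊎ ≡.refl ≡.refl p = p
    from : T (not d ∧ (anyEdge r c ∧ does (isTournamentWithTies? t))) → IsTournamentWithTies D
    from p with T-∧⁻ {not d} p
    ... | ¬d , q with T-∧⁻ {anyEdge r c} q
    ... | or , q′ with dec-true⁻ (isTournamentWithTies? t) (Equivalence.to Bool.T-≡ q′)
    ... | irr , tot = irr′ , tot′
      where
      irr′ : ∀ i → ¬ Edge D i i
      irr′ zero    e = T-not⇒ d ¬d e
      irr′ (suc i) e = irr i (≡.subst T (adj-cone-ss d r c t i i) e)
      tot′ : ∀ i j → i ≢ j → Edge D i j ⊎ Edge D j i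
      tot′ zero    zero    i≢j = contradiction ≡.refl i≢j
      tot′ zero    (suc j) i≢j with anyEdge⇒ r c or j
      ... | inj₁ e = inj₁ e
      ... | inj₂ e = inj₂ (≡.subst T (≡.sym (adj-cone-s0 d r c t j)) e)
      tot′ (suc i) zero    i≢j with anyEdge⇒ r c or i
      ... | inj₁ e = inj₂ e
      ... | inj₂ e = inj₁ (≡.subst T (≡.sym (adj-cone-s0 d r c t i)) e)
      tot′ (suc i) (suc j) i≢j with tot i j (λ eq → i≢j (≡.cong suc eq))
      ... | inj₁ e = inj₁ (≡.subst T (≡.sym (adj-cone-ss d r c t i j)) e)
      ... | inj₂ e = inj₂ (≡.subst T (≡.sym (adj-cone-ss d r c t j i)) e)

  ∑-vectors-suc : ∀ {a} {A : Set a} (xs : List A) n f →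
    ∑ (vectors xs (suc n)) f ≈ ∑ xs (λ x → ∑ (vectors xs n) (λ v → f (x ∷ v)))
  ∑-vectors-suc xs n f = ∑-cartesianProductWith _∷_ xs (vectors xs n) f

  -- Matrices are enumerated by rows, whereas deleting vertex 0 removes a row and a column; this
  -- splits off the first column.
  ∑-columns : ∀ {a} {A : Set a} (xs : List A) n m f →
    ∑ (vectors (vectors xs (suc n)) m) f ≈
    ∑ (vectors xs m) (λ c → ∑ (vectors (vectors xs n) m) (λ t → f (zipWith _∷_ c t)))
  ∑-columns xs n zero    f = sym (+-identityʳ _)
  ∑-columns xs n (suc m) f = begin
    ∑ (vectors (vectors xs (suc n)) (suc m)) f
      ≈⟨ ∑-vectors-suc (vectors xs (suc n)) m f ⟩
    ∑ (vectors xs (suc n)) (λ row → ∑ (vectors (vectors xs (suc n)) m) (λ rows → f (row ∷ rows)))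
      ≈⟨ ∑-cong (vectors xs (suc n)) (λ row → ∑-columns xs n m (λ rows → f (row ∷ rows))) ⟩
    ∑ (vectors xs (suc n)) (λ row → ∑ (vectors xs m) (λ c → ∑ (vectors (vectors xs n) m) (λ t →
      f (row ∷ zipWith _∷_ c t))))
      ≈⟨ ∑-vectors-suc xs n _ ⟩
    ∑ xs (λ x → ∑ (vectors xs n) (λ r → ∑ (vectors xs m) (λ c → ∑ (vectors (vectors xs n) m) (λ t →
      f ((x ∷ r) ∷ zipWith _∷_ c t)))))
      ≈⟨ ∑-cong xs (λ x → ∑-swap (vectors xs n) (vectors xs m) _) ⟩
    ∑ xs (λ x → ∑ (vectors xs m) (λ c → ∑ (vectors xs n) (λ r → ∑ (vectors (vectors xs n) m) (λ t →
      f ((x ∷ r) ∷ zipWith _∷_ c t)))))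
      ≈⟨ ∑-cong xs (λ x → ∑-cong (vectors xs m) (λ c → ∑-vectors-suc (vectors xs n) m _)) ⟨
    ∑ xs (λ x → ∑ (vectors xs m) (λ c → ∑ (vectors (vectors xs n) (suc m)) (λ t →
      f (zipWith _∷_ (x ∷ c) t))))
      ≈⟨ ∑-vectors-suc xs m _ ⟨
    ∑ (vectors xs (suc m)) (λ c → ∑ (vectors (vectors xs n) (suc m)) (λ t → f (zipWith _∷_ c t))) ∎

  -- Of the four pairs of bits joining 0 to a vertex, the pair without an edge has weight 0, and the
  -- three others are the three arcs.
  ∑-anyEdge : ∀ n (f : Vec Bool n → Vec Bool n → Carrier) →
    ∑ (vectors bits n) (λ r → ∑ (vectors bits n) (λ c → χ (anyEdge r c) * f r c)) ≈
    ∑ (vectors arcs n) (λ as → f (map out as) (map inn as))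
  ∑-anyEdge zero    f = trans (+-identityʳ _) (+-congʳ (*-identityˡ _))
  ∑-anyEdge (suc n) f = begin
    ∑ (vectors bits (suc n)) (λ r → ∑ (vectors bits (suc n)) (λ c → χ (anyEdge r c) * f r c))
      ≈⟨ ∑-vectors-suc bits n _ ⟩
    ∑ bits (λ x → ∑ (vectors bits n) (λ r → ∑ (vectors bits (suc n)) (λ c → χ (anyEdge (x ∷ r) c) * f (x ∷ r) c)))
      ≈⟨ ∑-cong bits (λ x → ∑-cong (vectors bits n) (λ r → ∑-vectors-suc bits n (λ c → χ (anyEdge (x ∷ r) c) * f (x ∷ r) c))) ⟩
    ∑ bits (λ x → ∑ (vectors bits n) (λ r → ∑ bits (λ y → ∑ (vectors bits n) (λ c → F x y r c))))
      ≈⟨ ∑-cong bits (λ x → ∑-swap (vectors bits n) bits (λ r y → ∑ (vectors bits n) (λ c → F x y r c))) ⟩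
    ∑ bits (λ x → ∑ bits (λ y → S x y))
      ≈⟨ +-cong (+-cong s₃ (+-congʳ s₁)) (+-congʳ (+-cong s₂ (+-congʳ s₀))) ⟩
    (z₃ + (z₁ + 0#)) + ((z₂ + (0# + 0#)) + 0#)
      ≈⟨ solve 3 (λ z₁ z₂ z₃ → (z₃ :+ (z₁ :+ :0)) :+ ((z₂ :+ (:0 :+ :0)) :+ :0) := z₁ :+ (z₂ :+ (z₃ :+ :0)))
           refl z₁ z₂ z₃ ⟩
    z₁ + (z₂ + (z₃ + 0#))
      ≈⟨ ∑-vectors-suc arcs n _ ⟨
    ∑ (vectors arcs (suc n)) (λ as → f (map out as) (map inn as)) ∎
    where
    F : Bool → Bool → Vec Bool n → Vec Bool n → Carrier
    F x y r c = χ (anyEdge (x ∷ r) (y ∷ c)) * f (x ∷ r) (y ∷ c)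
    S : Bool → Bool → Carrier
    S x y = ∑ (vectors bits n) (λ r → ∑ (vectors bits n) (λ c → F x y r c))
    z : Arc → Carrier
    z a = ∑ (vectors arcs n) (λ as → f (map out (a ∷ as)) (map inn (a ∷ as)))
    z₁ = z fwd
    z₂ = z bwd
    z₃ = z both
    s₁ : S true false ≈ z₁
    s₁ = ∑-anyEdge n (λ r c → f (true ∷ r) (false ∷ c))
    s₂ : S false true ≈ z₂
    s₂ = ∑-anyEdge n (λ r c → f (false ∷ r) (true ∷ c))
    s₃ : S true true ≈ z₃
    s₃ = ∑-anyEdge n (λ r c → f (true ∷ r) (true ∷ c))
    s₀ : S false false ≈ 0#
    s₀ = trans (∑-cong (vectors bits n) (λ r → trans (∑-cong (vectors bits n) (λ c → zeroˡ _)) (∑-0 (vectors bits n))))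
               (∑-0 (vectors bits n))

  -- Expresses that `toDigraph` is a bijection onto tournaments with ties as an equality of sums, so
  -- that the order of enumeration is irrelevant.
  ∑-digraphs : ∀ n f → ∑ (digraphs n) (λ t → χ (does (isTournamentWithTies? t)) * f t) ≈ ∑ (tours n) (f ∘ toDigraph)
  ∑-digraphs zero    f = +-congʳ (trans
    (*-congʳ (reflexive (≡.cong χ (dec-true (isTournamentWithTies? []) ((λ ()) , (λ ())))))) (*-identityˡ (f [])))
  ∑-digraphs (suc n) f = begin
    ∑ (digraphs (suc n)) F
      ≈⟨ ∑-vectors-suc (vectors bits (suc n)) n F ⟩
    ∑ (vectors bits (suc n)) (λ row → ∑ (vectors (vectors bits (suc n)) n) (λ rows → F (row ∷ rows)))
      ≈⟨ ∑-cong (vectors bits (suc n)) (λ row → ∑-columns bits n n (λ rows → F (row ∷ rows))) ⟩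
    ∑ (vectors bits (suc n)) (λ row → ∑ (vectors bits n) (λ c → ∑ (digraphs n) (λ t → F (row ∷ zipWith _∷_ c t))))
      ≈⟨ ∑-vectors-suc bits n _ ⟩
    S true + (S false + 0#)
      ≈⟨ +-cong S-true (+-congʳ S-false) ⟩
    0# + (∑ (tours (suc n)) (f ∘ toDigraph) + 0#)
      ≈⟨ trans (+-identityˡ _) (+-identityʳ _) ⟩
    ∑ (tours (suc n)) (f ∘ toDigraph) ∎
    where
    F : Digraph (suc n) → Carrier
    F t = χ (does (isTournamentWithTies? t)) * f t
    S : Bool → Carrier
    S d = ∑ (vectors bits n) (λ r → ∑ (vectors bits n) (λ c → ∑ (digraphs n) (λ t → F (cone d r c t))))
    F-true : ∀ r c t → F (cone true r c t) ≈ 0#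
    F-true r c t = trans (*-congʳ (reflexive (≡.cong χ (cone-tournament true r c t)))) (zeroˡ _)
    S-true : S true ≈ 0#
    S-true = trans (∑-cong (vectors bits n) λ r →
      trans (∑-cong (vectors bits n) λ c →
        trans (∑-cong (digraphs n) (F-true r c)) (∑-0 (digraphs n)))
        (∑-0 (vectors bits n)))
      (∑-0 (vectors bits n))
    F-false : ∀ r c t → F (cone false r c t)
                        ≈ χ (anyEdge r c) * (χ (does (isTournamentWithTies? t)) * f (cone false r c t))
    F-false r c t = trans (*-congʳ (reflexive (≡.cong χ (cone-tournament false r c t))))
                          (χ-∧-* (anyEdge r c) (does (isTournamentWithTies? t)) _)
    S-false : S false ≈ ∑ (tours (suc n)) (f ∘ toDigraph)
    S-false = begin
      S false
        ≈⟨ ∑-cong (vectors bits n) (λ r → ∑-cong (vectors bits n) (λ c →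
             trans (∑-cong (digraphs n) (F-false r c))
               (trans (∑-*ˡ (digraphs n) (χ (anyEdge r c)) _)
                      (*-congˡ (∑-digraphs n (λ t → f (cone false r c t))))))) ⟩
      ∑ (vectors bits n) (λ r → ∑ (vectors bits n) (λ c →
        χ (anyEdge r c) * ∑ (tours n) (λ t → f (cone false r c (toDigraph t)))))
        ≈⟨ ∑-anyEdge n (λ r c → ∑ (tours n) (λ t → f (cone false r c (toDigraph t)))) ⟩
      ∑ (vectors arcs n) (λ as → ∑ (tours n) (λ t → f (toDigraph (as ∷ t))))
        ≈⟨ ∑-cartesianProductWith _∷_ (vectors arcs n) (tours n) (f ∘ toDigraph) ⟨
      ∑ (tours (suc n)) (f ∘ toDigraph) ∎

  ∑-tournaments : ∀ {n p} {P : Digraph n → Set p} (P? : U.Decidable P) f →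
    ∑ (filter P? (tournaments n)) f ≈ ∑ (tours n) (λ t → χ (does (P? (toDigraph t))) * f (toDigraph t))
  ∑-tournaments {n} P? f = begin
    ∑ (filter P? (tournaments n)) f                             ≈⟨ ∑-filter P? (tournaments n) f ⟩
    ∑ (tournaments n) (λ t → χ (does (P? t)) * f t)             ≈⟨ ∑-filter isTournamentWithTies? (digraphs n) _ ⟩
    ∑ (digraphs n) (λ t → χ (does (isTournamentWithTies? t)) * (χ (does (P? t)) * f t))
      ≈⟨ ∑-digraphs n (λ t → χ (does (P? t)) * f t) ⟩
    ∑ (tours n) (λ t → χ (does (P? (toDigraph t))) * f (toDigraph t)) ∎

  module _ (v : Arc → Carrier) where

    arcsWeight : ∀ {n} → Vec Arc n → Carrier
    arcsWeight []       = 1#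
    arcsWeight (a ∷ as) = v a * arcsWeight as

    tourWeight : ∀ {n} → Tour n → Carrier
    tourWeight []       = 1#
    tourWeight (as ∷ t) = arcsWeight as * tourWeight t

    ∏-arcs : ∀ {n} (as : Vec Arc n) → ∏ (allFin n) (λ j → v (lookup as j)) ≈ arcsWeight as
    ∏-arcs []               = refl
    ∏-arcs {suc n} (a ∷ as) = trans (∏-allFin-suc n (λ j → v (lookup (a ∷ as) j))) (*-congˡ (∏-arcs as))

    ∑-arcsWeight : ∀ n → ∑ (vectors arcs n) arcsWeight ≈ ∑ arcs v ^ n
    ∑-arcsWeight zero    = +-identityʳ 1#
    ∑-arcsWeight (suc n) = begin
      ∑ (vectors arcs (suc n)) arcsWeight                     ≈⟨ ∑-vectors-suc arcs n arcsWeight ⟩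
      ∑ arcs (λ a → ∑ (vectors arcs n) (λ as → v a * arcsWeight as))
        ≈⟨ ∑-cong arcs (λ a → trans (∑-*ˡ (vectors arcs n) (v a) arcsWeight) (*-congˡ (∑-arcsWeight n))) ⟩
      ∑ arcs (λ a → v a * ∑ arcs v ^ n)                       ≈⟨ ∑-*ʳ arcs (∑ arcs v ^ n) v ⟩
      ∑ arcs v * ∑ arcs v ^ n                                 ∎

    ∑-tourWeight-suc : ∀ n → ∑ (tours (suc n)) tourWeight ≈ ∑ arcs v ^ n * ∑ (tours n) tourWeight
    ∑-tourWeight-suc n = begin
      ∑ (tours (suc n)) tourWeight
        ≈⟨ ∑-cartesianProductWith _∷_ (vectors arcs n) (tours n) tourWeight ⟩
      ∑ (vectors arcs n) (λ as → ∑ (tours n) (λ t → arcsWeight as * tourWeight t))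
        ≈⟨ ∑-cong (vectors arcs n) (λ as → ∑-*ˡ (tours n) (arcsWeight as) tourWeight) ⟩
      ∑ (vectors arcs n) (λ as → arcsWeight as * ∑ (tours n) tourWeight)
        ≈⟨ ∑-*ʳ (vectors arcs n) _ arcsWeight ⟩
      ∑ (vectors arcs n) arcsWeight * ∑ (tours n) tourWeight
        ≈⟨ *-congʳ (∑-arcsWeight n) ⟩
      ∑ arcs v ^ n * ∑ (tours n) tourWeight ∎

  ∏-pairs-toDigraph : ∀ (u : Bool → Bool → Carrier) {n} (t : Tour n) →
    ∏ (pairs n) (λ (i , j) → u (adj (toDigraph t) i j) (adj (toDigraph t) j i))
    ≈ tourWeight (λ a → u (out a) (inn a)) t
  ∏-pairs-toDigraph u []               = refl
  ∏-pairs-toDigraph u {suc n} (as ∷ t) = begin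
    ∏ (pairs (suc n)) (λ (i , j) → u (adj D i j) (adj D j i))
      ≈⟨ ∏-pairs-suc n _ ⟩
    ∏ (allFin n) (λ j → u (adj D zero (suc j)) (adj D (suc j) zero)) *
    ∏ (pairs n) (λ (i , j) → u (adj D (suc i) (suc j)) (adj D (suc j) (suc i)))
      ≈⟨ *-cong (∏-cong (allFin n) λ j → reflexive (≡.cong₂ u (adj-0s as t j) (adj-s0 as t j)))
                (∏-cong (pairs n) λ (i , j) → reflexive (≡.cong₂ u (adj-ss as t i j) (adj-ss as t j i))) ⟩
    ∏ (allFin n) (λ j → u (out (lookup as j)) (inn (lookup as j))) *
    ∏ (pairs n) (λ (i , j) → u (adj (toDigraph t) i j) (adj (toDigraph t) j i))
      ≈⟨ *-cong (∏-arcs (λ a → u (out a) (inn a)) as) (∏-pairs-toDigraph u t) ⟩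
    tourWeight (λ a → u (out a) (inn a)) (as ∷ t) ∎
    where D = toDigraph (as ∷ t)

  nc : ∀ {n} → Tour n → ℕ
  nc t = numComponents (toDigraph t)

  subsets : ∀ n → List (Vec Bool n)
  subsets = vectors bits

  open Hurwitz commutativeRing

  -- Leibniz' rule decides where the element 0 goes: differentiating `f` puts it into `S`,
  -- differentiating `h` into the complement.
  ⋆-subsets : ∀ f h n → (f ⋆ h) n ≈ ∑ (subsets n) (λ S → f (# S) * h (# (∁ S)))
  ⋆-subsets f h zero    = sym (+-identityʳ _)
  ⋆-subsets f h (suc n) = trans (+-cong (⋆-subsets (f ′) h n) (trans (⋆-subsets f (h ′) n) (sym (+-identityʳ _))))
    (sym (∑-vectors-suc bits n _))

  ∑-subsets-≡ : ∀ {n} (S₀ : Vec Bool n) z →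
    ∑ (subsets n) (λ S → χ (does (Vec.≡-dec Bool._≟_ S S₀)) * z) ≈ z
  ∑-subsets-≡ {n} S₀ z = trans (∑-*ʳ (subsets n) z _) (trans (*-congʳ (count S₀)) (*-identityˡ z))
    where
    _≟ˢ_ : ∀ {n} (S S′ : Vec Bool n) → Dec (S ≡ S′)
    _≟ˢ_ = Vec.≡-dec Bool._≟_
    count : ∀ {n} (S₀ : Vec Bool n) → ∑ (subsets n) (λ S → χ (does (S ≟ˢ S₀))) ≈ 1#
    count []                = +-identityʳ 1#
    count {suc n} (s ∷ S₀) = begin
      ∑ (subsets (suc n)) (λ S → χ (does (S ≟ˢ (s ∷ S₀))))
        ≈⟨ ∑-vectors-suc bits n _ ⟩
      ∑ bits (λ b → ∑ (subsets n) (λ S → χ (does ((b ∷ S) ≟ˢ (s ∷ S₀)))))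
        ≈⟨ ∑-cong bits (λ b → trans (∑-cong (subsets n) (λ S → χ-∧ (does (b Bool.≟ s)) (does (S ≟ˢ S₀))))
             (trans (∑-*ˡ (subsets n) _ _) (trans (*-congˡ (count S₀)) (*-identityʳ _)))) ⟩
      ∑ bits (λ b → χ (does (b Bool.≟ s)))
        ≈⟨ bit s ⟩
      1# ∎
      where
      bit : ∀ s → ∑ bits (λ b → χ (does (b Bool.≟ s))) ≈ 1#
      bit true  = solve 0 (:1 :+ (:0 :+ :0) := :1) refl
      bit false = solve 0 (:0 :+ (:1 :+ :0) := :1) refl

  -- Cutting off the first strong component.

  module Condensation (v : Arc → Carrier) (v-fwd : v fwd ≈ 1#) (v-bwd : v bwd ≈ 1#) where

    private
      W : ∀ {n} → Vec Arc n → Carrier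
      W = arcsWeight v
      V : ∀ {n} → Tour n → Carrier
      V = tourWeight v

    ∑-== : ∀ e → v e ≈ 1# → ∑ arcs (λ a → v a * χ (e == a)) ≈ 1#
    ∑-== fwd  p = trans (solve 3 (λ a b c → a :* :1 :+ (b :* :0 :+ (c :* :0 :+ :0)) := a) refl (v fwd) (v bwd) (v both)) p
    ∑-== bwd  p = trans (solve 3 (λ a b c → a :* :0 :+ (b :* :1 :+ (c :* :0 :+ :0)) := b) refl (v fwd) (v bwd) (v both)) p
    ∑-== both p = trans (solve 3 (λ a b c → a :* :0 :+ (b :* :0 :+ (c :* :1 :+ :0)) := c) refl (v fwd) (v bwd) (v both)) p

    -- The forced arcs weigh 1, so they disappear from the sum and only the arcs to `S` remain.
    ∑-fits : ∀ e → v e ≈ 1# → ∀ {n} (S : Vec Bool n) f →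
      ∑ (vectors arcs n) (λ as → W as * (χ (fits e S as) * f (pick S as)))
      ≈ ∑ (vectors arcs (# S)) (λ as → W as * f as)
    ∑-fits e p []         f = +-congʳ (*-congˡ (*-identityˡ (f [])))
    ∑-fits e p {suc n} (true ∷ S) f = begin
      ∑ (vectors arcs (suc n)) (λ as → W as * (χ (fits e (true ∷ S) as) * f (pick (true ∷ S) as)))
        ≈⟨ ∑-vectors-suc arcs n _ ⟩
      ∑ arcs (λ a → ∑ (vectors arcs n) (λ as → (v a * W as) * (χ (fits e S as) * f (a ∷ pick S as))))
        ≈⟨ ∑-cong arcs (λ a → trans (∑-cong (vectors arcs n) (λ as → *-assoc (v a) (W as) _))
             (trans (∑-*ˡ (vectors arcs n) (v a) _)
             (trans (*-congˡ (∑-fits e p S (λ as → f (a ∷ as))))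
             (trans (sym (∑-*ˡ (vectors arcs (# S)) (v a) _))
                    (∑-cong (vectors arcs (# S)) (λ as → sym (*-assoc (v a) (W as) _))))))) ⟩
      ∑ arcs (λ a → ∑ (vectors arcs (# S)) (λ as → (v a * W as) * f (a ∷ as)))
        ≈⟨ ∑-vectors-suc arcs (# S) _ ⟨
      ∑ (vectors arcs (suc (# S))) (λ as → W as * f as) ∎
    ∑-fits e p {suc n} (false ∷ S) f = begin
      ∑ (vectors arcs (suc n)) (λ as → W as * (χ (fits e (false ∷ S) as) * f (pick (false ∷ S) as)))
        ≈⟨ ∑-vectors-suc arcs n _ ⟩
      ∑ arcs (λ a → ∑ (vectors arcs n) (λ as → (v a * W as) * (χ ((e == a) ∧ fits e S as) * f (pick S as))))
        ≈⟨ ∑-cong arcs (λ a → trans (∑-cong (vectors arcs n) (λ as → trans (*-congˡ (χ-∧-* (e == a) (fits e S as) _))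
               (solve 4 (λ a b c d → (a :* b) :* (c :* d) := (a :* c) :* (b :* d)) refl (v a) (W as) (χ (e == a)) _)))
             (trans (∑-*ˡ (vectors arcs n) (v a * χ (e == a)) _) (*-congˡ (∑-fits e p S f)))) ⟩
      ∑ arcs (λ a → (v a * χ (e == a)) * ∑ (vectors arcs (# S)) (λ as → W as * f as))
        ≈⟨ ∑-*ʳ arcs _ (λ a → v a * χ (e == a)) ⟩
      ∑ arcs (λ a → v a * χ (e == a)) * ∑ (vectors arcs (# S)) (λ as → W as * f as)
        ≈⟨ trans (*-congʳ (∑-== e p)) (*-identityˡ _) ⟩
      ∑ (vectors arcs (# S)) (λ as → W as * f as) ∎

    ∑-tours-suc : ∀ n (f : Tour (suc n) → Carrier) → ∑ (tours (suc n)) (λ t → V t * f t)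
                        ≈ ∑ (vectors arcs n) (λ as → W as * ∑ (tours n) (λ t → V t * f (as ∷ t)))
    ∑-tours-suc n f = trans (∑-cartesianProductWith _∷_ (vectors arcs n) (tours n) _)
      (∑-cong (vectors arcs n) λ as → trans (∑-cong (tours n) λ t → *-assoc (W as) (V t) _) (∑-*ˡ (tours n) (W as) _))

    -- A closed set S cuts t into two arbitrary tournaments with ties; all arcs between them are forced.
    ∑-closed : ∀ {n} (S : Vec Bool n) (f : Tour (# S) → Tour (# (∁ S)) → Carrier) →
      ∑ (tours n) (λ t → V t * (χ (closed S t) * f (restrict S t) (restrict (∁ S) t)))
      ≈ ∑ (tours (# S)) (λ t₁ → V t₁ * ∑ (tours (# (∁ S))) (λ t₂ → V t₂ * f t₁ t₂))
    ∑-closed []         f = +-congʳ (*-congˡ (trans (*-identityˡ _) (sym (trans (+-identityʳ _) (*-identityˡ _)))))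
    ∑-closed {suc n} (true ∷ S) f = begin
      ∑ (tours (suc n)) (λ t → V t * (χ (closed (true ∷ S) t) * f (restrict (true ∷ S) t) (restrict (∁ (true ∷ S)) t)))
        ≈⟨ ∑-tours-suc n _ ⟩
      ∑ (vectors arcs n) (λ as → W as * ∑ (tours n) (λ t →
        V t * (χ (fits fwd S as ∧ closed S t) * f (pick S as ∷ restrict S t) (restrict (∁ S) t))))
        ≈⟨ ∑-cong (vectors arcs n) (λ as → *-congˡ (trans
             (∑-cong (tours n) (λ t → trans (*-congˡ (χ-∧-* (fits fwd S as) (closed S t) _)) (x∙yz≈y∙xz (V t) _ _)))
             (trans (∑-*ˡ (tours n) (χ (fits fwd S as)) _)
                    (*-congˡ (∑-closed S (λ t₁ t₂ → f (pick S as ∷ t₁) t₂)))))) ⟩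
      ∑ (vectors arcs n) (λ as → W as * (χ (fits fwd S as) * F (pick S as)))
        ≈⟨ ∑-fits fwd v-fwd S F ⟩
      ∑ (vectors arcs (# S)) (λ as → W as * F as)
        ≈⟨ ∑-tours-suc (# S) (λ t₁ → ∑ (tours (# (∁ S))) (λ t₂ → V t₂ * f t₁ t₂)) ⟨
      ∑ (tours (suc (# S))) (λ t₁ → V t₁ * ∑ (tours (# (∁ S))) (λ t₂ → V t₂ * f t₁ t₂)) ∎
      where
      open import Algebra.Properties.CommutativeSemigroup
        (CommutativeRing.*-commutativeSemigroup commutativeRing) using (x∙yz≈y∙xz)
      F : Vec Arc (# S) → Carrier
      F as = ∑ (tours (# S)) (λ t₁ → V t₁ * ∑ (tours (# (∁ S))) (λ t₂ → V t₂ * f (as ∷ t₁) t₂))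
    ∑-closed {suc n} (false ∷ S) f = begin
      ∑ (tours (suc n)) (λ t → V t * (χ (closed (false ∷ S) t) * f (restrict (false ∷ S) t) (restrict (∁ (false ∷ S)) t)))
        ≈⟨ ∑-tours-suc n _ ⟩
      ∑ (vectors arcs n) (λ as → W as * ∑ (tours n) (λ t →
        V t * (χ (fits bwd (∁ S) as ∧ closed S t) * f (restrict S t) (pick (∁ S) as ∷ restrict (∁ S) t))))
        ≈⟨ ∑-cong (vectors arcs n) (λ as → *-congˡ (trans
             (∑-cong (tours n) (λ t → trans (*-congˡ (χ-∧-* (fits bwd (∁ S) as) (closed S t) _)) (x∙yz≈y∙xz (V t) _ _)))
             (trans (∑-*ˡ (tours n) (χ (fits bwd (∁ S) as)) _)
                    (*-congˡ (∑-closed S (λ t₁ t₂ → f t₁ (pick (∁ S) as ∷ t₂))))))) ⟩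
      ∑ (vectors arcs n) (λ as → W as * (χ (fits bwd (∁ S) as) * F (pick (∁ S) as)))
        ≈⟨ ∑-fits bwd v-bwd (∁ S) F ⟩
      ∑ (vectors arcs (# (∁ S))) (λ as → W as * F as)
        ≈⟨ ∑-cong (vectors arcs (# (∁ S))) (λ as → trans (sym (∑-*ˡ (tours (# S)) (W as) _))
             (∑-cong (tours (# S)) λ t₁ → x∙yz≈y∙xz (W as) (V t₁) _)) ⟩
      ∑ (vectors arcs (# (∁ S))) (λ as → ∑ (tours (# S)) (λ t₁ →
        V t₁ * (W as * ∑ (tours (# (∁ S))) (λ t₂ → V t₂ * f t₁ (as ∷ t₂)))))
        ≈⟨ ∑-swap (vectors arcs (# (∁ S))) (tours (# S)) _ ⟩
      ∑ (tours (# S)) (λ t₁ → ∑ (vectors arcs (# (∁ S))) (λ as →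
        V t₁ * (W as * ∑ (tours (# (∁ S))) (λ t₂ → V t₂ * f t₁ (as ∷ t₂)))))
        ≈⟨ ∑-cong (tours (# S)) (λ t₁ → trans (∑-*ˡ (vectors arcs (# (∁ S))) (V t₁) _)
             (*-congˡ (sym (∑-tours-suc (# (∁ S)) (f t₁))))) ⟩
      ∑ (tours (# S)) (λ t₁ → V t₁ * ∑ (tours (suc (# (∁ S)))) (λ t₂ → V t₂ * f t₁ t₂)) ∎
      where
      open import Algebra.Properties.CommutativeSemigroup
        (CommutativeRing.*-commutativeSemigroup commutativeRing) using (x∙yz≈y∙xz)
      F : Vec Arc (# (∁ S)) → Carrier
      F as = ∑ (tours (# S)) (λ t₁ → V t₁ * ∑ (tours (# (∁ S))) (λ t₂ → V t₂ * f t₁ (as ∷ t₂)))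

    hasNC : ℕ → ℕ → Carrier
    hasNC m k = χ (does (k ℕ.≟ m))

    -- Only the source component is both closed and strongly connected.
    ∑-source : ∀ {n} (t : Tour (suc n)) (φ : ℕ → Carrier) →
      ∑ (subsets (suc n)) (λ S → χ (closed S t) * (hasNC 1 (nc (restrict S t)) * φ (suc (nc (restrict (∁ S) t)))))
      ≈ φ (nc t)
    ∑-source {n} t φ = trans (∑-cong (subsets (suc n)) term) (∑-subsets-≡ S₀ (φ (nc t)))
      where
      S₀ = sourceComponent (toDigraph t)
      F : Vec Bool (suc n) → Carrier
      F S = χ (closed S t) * (hasNC 1 (nc (restrict S t)) * φ (suc (nc (restrict (∁ S) t))))
      F-source : F S₀ ≈ φ (nc t)
      F-source = begin
        F S₀
          ≈⟨ *-cong (reflexive (≡.cong χ (Equivalence.to Bool.T-≡ (Closed⇒closed S₀ t cl))))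
                    (*-congʳ (reflexive (≡.cong χ (dec-true (_ ℕ.≟ 1) (source-connected t))))) ⟩
        1# * (1# * φ (suc (nc (restrict (∁ S₀) t))))  ≈⟨ trans (*-identityˡ _) (*-identityˡ _) ⟩
        φ (suc (nc (restrict (∁ S₀) t)))
          ≡⟨ ≡.cong φ (≡.sym (≡.trans (numComponents-split S₀ t cl)
                (≡.cong (ℕ._+ nc (restrict (∁ S₀) t)) (source-connected t)))) ⟩
        φ (nc t) ∎
        where cl = source-closed (toDigraph t)
      F-other : ∀ S → S ≢ S₀ → F S ≈ 0#
      F-other S S≢S₀ = by-cases (closed S t) ≡.refl (nc (restrict S t) ℕ.≟ 1)
        where
        by-cases : ∀ b → closed S t ≡ b → (d : Dec (nc (restrict S t) ≡ 1)) →
                   χ b * (χ (does d) * φ (suc (nc (restrict (∁ S) t)))) ≈ 0#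
        by-cases false _  _        = zeroˡ _
        by-cases true  _  (no _)   = trans (*-identityˡ _) (zeroˡ _)
        by-cases true  eq (yes e)  = contradiction
          (closed-connected⇒source S t (closed⇒Closed S t (Equivalence.from Bool.T-≡ eq)) e) S≢S₀
      term : ∀ S → F S ≈ χ (does (Vec.≡-dec Bool._≟_ S S₀)) * φ (nc t)
      term S with Vec.≡-dec Bool._≟_ S S₀
      ... | yes ≡.refl = trans F-source (sym (*-identityˡ _))
      ... | no  S≢S₀   = trans (F-other S S≢S₀) (sym (zeroˡ _))

    -- A general function of the number of components serves both recursions at once: `hasNC m`
    -- yields 𝔦𝔱⁽ᵐ⁾, and the constant 1 yields T.
    total : (ℕ → Carrier) → Seq
    total φ n = ∑ (tours n) (λ t → V t * φ (nc t))

    -- `∑-source` inserts a sum over the candidates `S` for the first component, and for each `S`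
    -- the weight factors by `∑-closed`. The index `suc n` ensures that a first component exists.
    total-source : ∀ φ n → total φ (suc n) ≈ (total (hasNC 1) ⋆ total (φ ∘ suc)) (suc n)
    total-source φ n = begin
      ∑ (tours (suc n)) (λ t → V t * φ (nc t))
        ≈⟨ ∑-cong (tours (suc n)) (λ t → *-congˡ (∑-source t φ)) ⟨
      ∑ (tours (suc n)) (λ t → V t * ∑ (subsets (suc n)) (λ S → F S t))
        ≈⟨ ∑-cong (tours (suc n)) (λ t → ∑-*ˡ (subsets (suc n)) (V t) _) ⟨
      ∑ (tours (suc n)) (λ t → ∑ (subsets (suc n)) (λ S → V t * F S t))
        ≈⟨ ∑-swap (tours (suc n)) (subsets (suc n)) _ ⟩
      ∑ (subsets (suc n)) (λ S → ∑ (tours (suc n)) (λ t → V t * F S t))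
        ≈⟨ ∑-cong (subsets (suc n)) (λ S → trans
             (∑-closed S (λ t₁ t₂ → hasNC 1 (nc t₁) * φ (suc (nc t₂))))
             (trans (∑-cong (tours (# S)) (λ t₁ → product S t₁)) (∑-*ʳ (tours (# S)) _ _))) ⟩
      ∑ (subsets (suc n)) (λ S → total (hasNC 1) (# S) * total (φ ∘ suc) (# (∁ S)))
        ≈⟨ ⋆-subsets (total (hasNC 1)) (total (φ ∘ suc)) (suc n) ⟨
      (total (hasNC 1) ⋆ total (φ ∘ suc)) (suc n) ∎
      where
      F : Vec Bool (suc n) → Tour (suc n) → Carrier
      F S t = χ (closed S t) * (hasNC 1 (nc (restrict S t)) * φ (suc (nc (restrict (∁ S) t))))
      product : ∀ (S : Vec Bool (suc n)) t₁ →
        V t₁ * ∑ (tours (# (∁ S))) (λ t₂ → V t₂ * (hasNC 1 (nc t₁) * φ (suc (nc t₂))))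
        ≈ (V t₁ * hasNC 1 (nc t₁)) * total (φ ∘ suc) (# (∁ S))
      product S t₁ = trans (*-congˡ (trans
          (∑-cong (tours (# (∁ S))) λ t₂ → solve 3 (λ a b c → a :* (b :* c) := b :* (a :* c)) refl (V t₂) _ _)
          (∑-*ˡ (tours (# (∁ S))) (hasNC 1 (nc t₁)) _)))
        (sym (*-assoc _ _ _))

    total-zero : ∀ φ → total φ 0 ≈ φ 0
    total-zero φ = trans (+-identityʳ _) (*-identityˡ (φ 0))

-- Application to the random model, and transfer to probabilities.

module Tournaments {c ℓ₁ ℓ₂} (ℝ : Reals c ℓ₁ ℓ₂) (p : Reals.Carrier ℝ)
                   (½≤p : Reals._≤_ ℝ (RealNotation.½ ℝ) p) (p<1 : Reals._<_ ℝ p (Reals.1# ℝ)) where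
  open Graph
  open import Data.Nat.Combinatorics using (_C_)
  open Reals ℝ
  open RealNotation ℝ
  open ErdősRényi ℝ p p<1
  open OrderedField ℝ
  open Hurwitz commutativeRing
  open Summation ℝ
  open RingSolver commutativeRing using (solve; _:=_; _:+_; _:*_; _:-_; :-_; :0; :1)
  open ≤-Reasoning

  -- Equal to 1/q = ρ+1, the total weight of the three arcs.
  x : Carrier
  x = recip q 0<q

  x*q≈1 : x * q ≈ 1#
  x*q≈1 = recip-inverse q 0<q

  1≤2p : 1# ≤ (1# + 1#) * p
  1≤2p = begin
    1#              ≈⟨ recip-inverse (1# + 1#) 0<2 ⟨
    ½ * (1# + 1#)   ≤⟨ *-monoʳ-≤ (<⇒≤ 0<2) ½≤p ⟩
    p * (1# + 1#)   ≈⟨ *-comm p (1# + 1#) ⟩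
    (1# + 1#) * p   ∎

  -- From 2 = 2xq = x(2-2p) and 2p ≥ 1.
  2≤x : fromℕ 2 ≤ x
  2≤x = begin
    1# + (1# + 0#)            ≈⟨ solve 0 (:1 :+ (:1 :+ :0) := (:1 :+ :1) :* :1) refl ⟩
    (1# + 1#) * 1#            ≈⟨ *-congˡ x*q≈1 ⟨
    (1# + 1#) * (x * q)       ≈⟨ solve 2 (λ x p → (:1 :+ :1) :* (x :* (:1 :- p)) := x :* ((:1 :+ :1) :- (:1 :+ :1) :* p)) refl x p ⟩
    x * ((1# + 1#) - (1# + 1#) * p) ≤⟨ *-monoˡ-≤ (0≤recip q 0<q) (+-monoʳ-≤ (1# + 1#) (-‿mono-≤ 1≤2p)) ⟩
    x * ((1# + 1#) - 1#)      ≈⟨ solve 1 (λ x → x :* ((:1 :+ :1) :- :1) := x) refl x ⟩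
    x                         ∎

  open Gargantuan ℝ x 2≤x
  open Powers ℝ x 2≤x

  ρ-1≈x-2 : ρ - 1# ≈ x - (1# + 1#)
  ρ-1≈x-2 = begin-equality
    p * x - 1#                  ≈⟨ +-congˡ (-‿cong x*q≈1) ⟨
    p * x - x * (1# - p)        ≈⟨ solve 2 (λ p x → p :* x :- x :* (:1 :- p) := x :- (:1 :+ :1) :* (x :* (:1 :- p))) refl p x ⟩
    x - (1# + 1#) * (x * q)     ≈⟨ +-congˡ (-‿cong (trans (*-congˡ x*q≈1) (*-identityʳ (1# + 1#)))) ⟩
    x - (1# + 1#)               ∎

  0≤ρ-1 : 0# ≤ ρ - 1#
  0≤ρ-1 = begin
    0#              ≤⟨ x≤y⇒0≤y-x 2≤x ⟩
    x - fromℕ 2     ≈⟨ solve 1 (λ x → x :- (:1 :+ (:1 :+ :0)) := x :- (:1 :+ :1)) refl x ⟩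
    x - (1# + 1#)   ≈⟨ ρ-1≈x-2 ⟨
    ρ - 1#          ∎

  tieWeight : Bool → Bool → Carrier
  tieWeight a b = if a ∧ b then ρ - 1# else 1#

  v : Arc → Carrier
  v a = tieWeight (out a) (inn a)

  open Condensation v refl refl

  V : ∀ {n} → Tour n → Carrier
  V = tourWeight v

  0≤v : ∀ a → 0# ≤ v a
  0≤v fwd  = 0≤1
  0≤v bwd  = 0≤1
  0≤v both = 0≤ρ-1

  0≤V : ∀ {n} (t : Tour n) → 0# ≤ V t
  0≤V []       = 0≤1
  0≤V (as ∷ t) = *-nonneg (0≤W as) (0≤V t)
    where
    0≤W : ∀ {n} (as : Vec Arc n) → 0# ≤ arcsWeight v as
    0≤W []       = 0≤1
    0≤W (a ∷ as) = *-nonneg (0≤v a) (0≤W as)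

  weight≈V : ∀ {n} (t : Tour n) → weight (toDigraph t) ≈ V t
  weight≈V {n} t = trans (^-length-filter _ (pairs n) (ρ - 1#)) (∏-pairs-toDigraph tieWeight t)

  it-suc : ∀ m → it (suc m) ≋ total (hasNC (suc m))
  it-suc m n = trans (∑-tournaments {n} (hasComponents? (suc m)) weight)
    (∑-cong (tours n) λ t → trans (*-congˡ (weight≈V t)) (*-comm _ (V t)))

  -- For m = 0 the convention agrees with counting, since only the empty tournament has no
  -- component.
  it-total : ∀ m → it m ≋ total (hasNC m)
  it-total (suc m) n       = it-suc m n
  it-total zero    zero    = sym (total-zero (hasNC 0))
  it-total zero    (suc n) = sym (trans (∑-cong (tours (suc n)) nc≢0) (∑-0 (tours (suc n))))
    where
    nc≢0 : ∀ (t : Tour (suc n)) → V t * hasNC 0 (nc t) ≈ 0#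
    nc≢0 t = trans (*-congˡ (reflexive (≡.cong χ (dec-false (nc t ℕ.≟ 0) λ eq →
      classes-suc-positive (mutuallyReachable? (toDigraph t))
        (≡.trans (≡.sym (numComponents≡classes (toDigraph t))) eq))))) (zeroʳ (V t))

  T≋total : T ≋ total (λ _ → 1#)
  T≋total n = trans (T≈ n) (∑-cong (tours n) λ t → sym (*-identityʳ (V t)))
    where
    ∑v≈x : ∑ arcs v ≈ x
    ∑v≈x = trans (+-congˡ (+-congˡ (+-congʳ ρ-1≈x-2)))
      (solve 1 (λ x → :1 :+ (:1 :+ ((x :- (:1 :+ :1)) :+ :0)) := x) refl x)
    T≈ : ∀ n → T n ≈ ∑ (tours n) V
    T≈ zero    = sym (+-identityʳ 1#)
    T≈ (suc n) = sym (trans (∑-tourWeight-suc v n) (*-cong (Exp.^-congˡ n ∑v≈x) (sym (T≈ n))))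

  it-zero : it 0 ≋ δ 0
  it-zero zero    = refl
  it-zero (suc n) = refl

  it1-0 : it 1 0 ≈ 0#
  it1-0 = trans (it-suc 0 0) (total-zero (hasNC 1))

  it-condensation : ∀ m → it (suc m) ≋ it 1 ⋆ it m
  it-condensation m zero    = trans (trans (it-suc m 0) (total-zero (hasNC (suc m))))
                                    (sym (trans (*-congʳ it1-0) (zeroˡ (it m 0))))
  it-condensation m (suc n) = trans (it-suc m (suc n)) (trans (total-source (hasNC (suc m)) n)
    (⋆-cong (λ k → sym (it-total 1 k)) (λ k → sym (it-total m k)) (suc n)))

  T-condensation : T ≋ δ 0 ⊕ it 1 ⋆ T
  T-condensation zero    = sym (trans (+-congˡ (trans (*-congʳ it1-0) (zeroˡ 1#))) (+-identityʳ 1#))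
  T-condensation (suc n) = begin-equality
    T (suc n)                                              ≈⟨ T≋total (suc n) ⟩
    total (λ _ → 1#) (suc n)                               ≈⟨ total-source (λ _ → 1#) n ⟩
    (total (hasNC 1) ⋆ total (λ _ → 1#)) (suc n)           ≈⟨ ⋆-cong (it-total 1) T≋total (suc n) ⟨
    (it 1 ⋆ T) (suc n)                                     ≈⟨ +-identityˡ _ ⟨
    0# + (it 1 ⋆ T) (suc n)                                ∎

  ∑-mono : ∀ {a} {A : Set a} (xs : List A) {f h : A → Carrier} → (∀ z → f z ≤ h z) → ∑ xs f ≤ ∑ xs h
  ∑-mono []       le = ≤-refl
  ∑-mono (z ∷ xs) le = +-mono-≤ (le z) (∑-mono xs le)

  χ-bounds : ∀ b → (0# ≤ χ b) × (χ b ≤ 1#)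
  χ-bounds true  = 0≤1 , ≤-refl
  χ-bounds false = ≤-refl , 0≤1

  -- The weights are nonnegative, so fixing the number of components can only decrease the total
  -- weight T.
  bounded-it : ∀ m → Bounded (it m)
  bounded-it m = bounded 1# 0≤1 λ n → begin
    ∣ it m n ∣                  ≈⟨ ∣∣-cong (it-total m n) ⟩
    ∣ total (hasNC m) n ∣       ≈⟨ 0≤x⇒∣x∣≈x (0≤total n) ⟩
    total (hasNC m) n
      ≤⟨ ∑-mono (tours n) (λ t → *-monoˡ-≤ (0≤V t) (proj₂ (χ-bounds (does (nc t ℕ.≟ m))))) ⟩
    total (λ _ → 1#) n          ≈⟨ T≋total n ⟨
    T n                         ≈⟨ *-identityˡ (T n) ⟨
    1# * T n                    ∎
    where
    0≤total : ∀ n → 0# ≤ total (hasNC m) n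
    0≤total n = ≤-trans (≤-reflexive (sym (∑-0 (tours n))))
      (∑-mono (tours n) λ t → *-nonneg (0≤V t) (proj₁ (χ-bounds (does (nc t ℕ.≟ m)))))

  expands-it : ∀ r m → Expands (suc r) (it (suc m)) (λ k → Q k (suc m))
  expands-it r m = expands-cong (suc r) (λ _ → refl)
    (λ n → *-congˡ (U⋆U⋆A it bounded-it it-zero it-condensation T-condensation m n))
    (expands-A it bounded-it it-zero it-condensation T-condensation r m)

  -- θ n = q ^ C(n,2).
  θ : ℕ → Carrier
  θ zero    = 1#
  θ (suc n) = q ^ n * θ n

  0≤θ : ∀ n → 0# ≤ θ n
  0≤θ zero    = 0≤1
  0≤θ (suc n) = *-nonneg (<⇒≤ (^-pos 0<q n)) (0≤θ n)

  θ*T≈1 : ∀ n → θ n * T n ≈ 1#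
  θ*T≈1 zero    = *-identityˡ 1#
  θ*T≈1 (suc n) = begin-equality
    (q ^ n * θ n) * (x ^ n * T n)   ≈⟨ solve 4 (λ a b c d → (a :* b) :* (c :* d) := (c :* a) :* (b :* d)) refl (q ^ n) (θ n) (x ^ n) (T n) ⟩
    (x ^ n * q ^ n) * (θ n * T n)   ≈⟨ *-cong (x^n*q^n≈1 n) (θ*T≈1 n) ⟩
    1# * 1#                         ≈⟨ *-identityˡ 1# ⟩
    1#                              ∎
    where
    x^n*q^n≈1 : ∀ n → x ^ n * q ^ n ≈ 1#
    x^n*q^n≈1 zero    = *-identityˡ 1#
    x^n*q^n≈1 (suc n) = trans (solve 4 (λ a b c d → (a :* b) :* (c :* d) := (a :* c) :* (b :* d)) refl x (x ^ n) q (q ^ n))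
      (trans (*-cong x*q≈1 (x^n*q^n≈1 n)) (*-identityˡ 1#))

  triangular-suc : ∀ k → suc k ℕ.* suc (suc k) ℕ./ 2 ≡ suc k ℕ.+ k ℕ.* suc k ℕ./ 2
  triangular-suc k = ≡.trans
    (≡.cong (ℕ._/ 2) (N.solve 1 (λ k → (N.con 1 N.:+ k) N.:* (N.con 2 N.:+ k)
                          N.:= (N.con 1 N.:+ k) N.:* N.con 2 N.:+ k N.:* (N.con 1 N.:+ k)) ≡.refl k))
    (≡.trans (ℕ.+-distrib-/-∣ˡ (k ℕ.* suc k) (n∣m*n (suc k)))
             (≡.cong (ℕ._+ k ℕ.* suc k ℕ./ 2) (ℕ.m*n/n≡m (suc k) 2)))
    where module N = Data.Nat.Solver.+-*-Solver

  -- On exponents this reads C(k+d,2) + k(k+1)/2 = (k+d)k + C(d,2).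
  θ-+ : ∀ k d → θ (k ℕ.+ d) * q ^ (k ℕ.* suc k ℕ./ 2) ≈ q ^ ((k ℕ.+ d) ℕ.* k) * θ d
  θ-+ zero    d = begin-equality
    θ d * 1#                        ≈⟨ *-comm (θ d) 1# ⟩
    1# * θ d                        ≡⟨ ≡.cong (λ i → q ^ i * θ d) (ℕ.*-zeroʳ d) ⟨
    q ^ (d ℕ.* 0) * θ d             ∎
  θ-+ (suc k) d = begin-equality
    (q ^ (k ℕ.+ d) * θ (k ℕ.+ d)) * q ^ (suc k ℕ.* suc (suc k) ℕ./ 2)
      ≡⟨ ≡.cong (λ i → (q ^ (k ℕ.+ d) * θ (k ℕ.+ d)) * q ^ i) (triangular-suc k) ⟩
    (q ^ (k ℕ.+ d) * θ (k ℕ.+ d)) * q ^ (suc k ℕ.+ k ℕ.* suc k ℕ./ 2)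
      ≈⟨ *-congˡ (Exp.^-homo-* q (suc k) (k ℕ.* suc k ℕ./ 2)) ⟩
    (q ^ (k ℕ.+ d) * θ (k ℕ.+ d)) * (q ^ suc k * q ^ (k ℕ.* suc k ℕ./ 2))
      ≈⟨ solve 4 (λ a b c d → (a :* b) :* (c :* d) := (a :* c) :* (b :* d)) refl (q ^ (k ℕ.+ d)) (θ (k ℕ.+ d)) (q ^ suc k) _ ⟩
    (q ^ (k ℕ.+ d) * q ^ suc k) * (θ (k ℕ.+ d) * q ^ (k ℕ.* suc k ℕ./ 2))
      ≈⟨ *-cong (sym (Exp.^-homo-* q (k ℕ.+ d) (suc k))) (θ-+ k d) ⟩
    q ^ ((k ℕ.+ d) ℕ.+ suc k) * (q ^ ((k ℕ.+ d) ℕ.* k) * θ d)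
      ≈⟨ *-assoc _ _ _ ⟨
    (q ^ ((k ℕ.+ d) ℕ.+ suc k) * q ^ ((k ℕ.+ d) ℕ.* k)) * θ d
      ≈⟨ *-congʳ (Exp.^-homo-* q ((k ℕ.+ d) ℕ.+ suc k) ((k ℕ.+ d) ℕ.* k)) ⟨
    q ^ (((k ℕ.+ d) ℕ.+ suc k) ℕ.+ (k ℕ.+ d) ℕ.* k) * θ d
      ≡⟨ ≡.cong (λ i → q ^ i * θ d) (N.solve 2 (λ k d →
           ((k N.:+ d) N.:+ (N.con 1 N.:+ k)) N.:+ (k N.:+ d) N.:* k
           N.:= ((N.con 1 N.:+ k) N.:+ d) N.:* (N.con 1 N.:+ k)) ≡.refl k d) ⟩
    q ^ ((suc k ℕ.+ d) ℕ.* suc k) * θ d ∎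
    where module N = Data.Nat.Solver.+-*-Solver

  -- Multiplying by q^(k(k+1)/2) clears the reciprocal in `g`; what remains is `θ-+` together with
  -- θ(d) T(d) = 1.
  g≈θG-+ : ∀ k d → g k (k ℕ.+ d) ≈ θ (k ℕ.+ d) * G k (k ℕ.+ d)
  g≈θG-+ k d = *-cancelˡ-≈ 0<Q $ begin-equality
    Qk * (B * (q ^ ((k ℕ.+ d) ℕ.* k) * recip Qk 0<Q))
      ≈⟨ solve 4 (λ a c e r → a :* (c :* (e :* r)) := (r :* a) :* (c :* e)) refl Qk B (q ^ ((k ℕ.+ d) ℕ.* k)) (recip Qk 0<Q) ⟩
    (recip Qk 0<Q * Qk) * (B * q ^ ((k ℕ.+ d) ℕ.* k))
      ≈⟨ *-cong (recip-inverse Qk 0<Q) (*-congˡ (sym (trans (*-congˡ (θ*T≈1 d)) (*-identityʳ _)))) ⟩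
    1# * (B * (q ^ ((k ℕ.+ d) ℕ.* k) * (θ d * T d)))
      ≈⟨ solve 4 (λ c e t u → :1 :* (c :* (e :* (t :* u))) := (e :* t) :* (c :* u)) refl B (q ^ ((k ℕ.+ d) ℕ.* k)) (θ d) (T d) ⟩
    (q ^ ((k ℕ.+ d) ℕ.* k) * θ d) * (B * T d)
      ≈⟨ *-cong (sym (θ-+ k d)) (sym (G-explicit k d)) ⟩
    (θ (k ℕ.+ d) * Qk) * G k (k ℕ.+ d)
      ≈⟨ solve 3 (λ t a g → (t :* a) :* g := a :* (t :* g)) refl (θ (k ℕ.+ d)) Qk (G k (k ℕ.+ d)) ⟩
    Qk * (θ (k ℕ.+ d) * G k (k ℕ.+ d)) ∎
    where
    B = fromℕ ((k ℕ.+ d) C k)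
    Qk = q ^ (k ℕ.* suc k ℕ./ 2)
    0<Q = ^-pos 0<q (k ℕ.* suc k ℕ./ 2)

  g≈θG : ∀ k n → g k n ≈ θ n * G k n
  g≈θG k n = by-cases (n ℕ.<? k)
    where
    by-cases : Dec (n ℕ.< k) → g k n ≈ θ n * G k n
    by-cases (yes n<k) = trans (C>⇒0 _ n<k) (sym (trans (*-congˡ (G-below k n n<k)) (zeroʳ (θ n))))
    by-cases (no  n≮k) = ≡.subst (λ n → g k n ≈ θ n * G k n)
      (proj₂ (ℕ.m≤n⇒∃[o]m+o≡n (ℕ.≮⇒≥ n≮k))) (g≈θG-+ k _)

  0≤g : ∀ k n → 0# ≤ g k n
  0≤g k n = ≤-trans (*-nonneg (0≤θ n) (0≤G k n)) (≤-reflexive (sym (g≈θG k n)))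

  ∑-upTo-suc : ∀ R f → ∑ (upTo (suc R)) f ≈ ∑ (upTo R) f + f R
  ∑-upTo-suc R f = begin-equality
    ∑ (upTo (suc R)) f             ≡⟨ ≡.cong (λ ks → ∑ ks f) (List.upTo-∷ʳ R) ⟨
    ∑ (upTo R List.∷ʳ R) f         ≈⟨ ∑-++ (upTo R) (R ∷ []) f ⟩
    ∑ (upTo R) f + (f R + 0#)      ≈⟨ +-congˡ (+-identityʳ (f R)) ⟩
    ∑ (upTo R) f + f R             ∎

  ∑-upTo-g : ∀ R a n → ∑ (upTo R) (λ k → a k * g k n) ≈ θ n * (τ R a ⋆ T) n
  ∑-upTo-g zero    a n = sym (trans (*-congˡ (⋆-zeroˡ T n)) (zeroʳ (θ n)))
  ∑-upTo-g (suc R) a n = begin-equality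
    ∑ (upTo (suc R)) (λ k → a k * g k n)             ≈⟨ ∑-upTo-suc R _ ⟩
    ∑ (upTo R) (λ k → a k * g k n) + a R * g R n     ≈⟨ +-cong (∑-upTo-g R a n) (*-congˡ (g≈θG R n)) ⟩
    θ n * (τ R a ⋆ T) n + a R * (θ n * G R n)
      ≈⟨ solve 4 (λ t s a g → t :* s :+ a :* (t :* g) := t :* (s :+ a :* g)) refl (θ n) ((τ R a ⋆ T) n) (a R) (G R n) ⟩
    θ n * ((τ R a ⋆ T) n + a R * G R n)              ≈⟨ *-congˡ (τ-suc-⋆ R a T n) ⟨
    θ n * (τ (suc R) a ⋆ T) n                        ∎

  -- The nonnegative factor θ(n) multiplies both the sequence and the scale, so bounds carry over
  -- unchanged. `N` accommodates strong connectivity, where the formula fails at n = 0.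
  asymptoticExpansion : ∀ N f F a → (∀ n → N ℕ.≤ n → f n ≈ θ n * F n) →
                        (∀ r → Expands (suc r) F a) → AsymptoticExpansion f a g
  asymptoticExpansion N f F a f≈θF expands = little-o , λ r → big-O r (expands r)
    where
    little-o : ∀ k → IsLittleO (g (suc k)) (g k)
    little-o k ε 0<ε = proj₁ (G-little-o k ε 0<ε) , λ n M≤n → begin
      ∣ g (suc k) n ∣         ≈⟨ 0≤x⇒∣x∣≈x (0≤g (suc k) n) ⟩
      g (suc k) n             ≈⟨ g≈θG (suc k) n ⟩
      θ n * G (suc k) n       ≤⟨ *-monoˡ-≤ (0≤θ n) (proj₂ (G-little-o k ε 0<ε) n M≤n) ⟩
      θ n * (ε * G k n)       ≈⟨ solve 3 (λ t e g → t :* (e :* g) := e :* (t :* g)) refl (θ n) ε (G k n) ⟩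
      ε * (θ n * G k n)       ≈⟨ *-congˡ (g≈θG k n) ⟨
      ε * g k n               ≤⟨ *-monoˡ-≤ (<⇒≤ 0<ε) (x≤∣x∣ (g k n)) ⟩
      ε * ∣ g k n ∣           ∎
    big-O : ∀ r → Expands (suc r) F a → IsBigO (λ n → f n - ∑ (upTo (suc r)) (λ k → a k * g k n)) (g (suc r))
    big-O r (negligible K 0≤K M bound) = K , N ℕ.+ M , λ n N+M≤n → begin
      ∣ f n - ∑ (upTo (suc r)) (λ k → a k * g k n) ∣
        ≈⟨ ∣∣-cong (+-cong (f≈θF n (ℕ.≤-trans (ℕ.m≤m+n N M) N+M≤n)) (-‿cong (∑-upTo-g (suc r) a n))) ⟩
      ∣ θ n * F n - θ n * (τ (suc r) a ⋆ T) n ∣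
        ≈⟨ ∣∣-cong (solve 3 (λ t a b → t :* a :- t :* b := t :* (a :- b)) refl (θ n) (F n) _) ⟩
      ∣ θ n * (F n - (τ (suc r) a ⋆ T) n) ∣      ≤⟨ ∣x*y∣≤∣x∣*∣y∣ (θ n) _ ⟩
      ∣ θ n ∣ * ∣ F n - (τ (suc r) a ⋆ T) n ∣    ≈⟨ *-congʳ (0≤x⇒∣x∣≈x (0≤θ n)) ⟩
      θ n * ∣ F n - (τ (suc r) a ⋆ T) n ∣
        ≤⟨ *-monoˡ-≤ (0≤θ n) (bound n (ℕ.≤-trans (ℕ.m≤n+m M N) N+M≤n)) ⟩
      θ n * (K * G (suc r) n)
        ≈⟨ solve 3 (λ t k g → t :* (k :* g) := k :* (t :* g)) refl (θ n) K (G (suc r) n) ⟩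
      K * (θ n * G (suc r) n)                    ≈⟨ *-congˡ (g≈θG (suc r) n) ⟨
      K * g (suc r) n                            ≤⟨ *-monoˡ-≤ 0≤K (x≤∣x∣ (g (suc r) n)) ⟩
      K * ∣ g (suc r) n ∣                        ∎

  -- Each arc has q times its weight as probability, by q(ρ-1) = p-q for a tie, and there are C(n,2)
  -- pairs.
  probability≈θV : ∀ {n} (t : Tour n) → probability (toDigraph t) ≈ θ n * V t
  probability≈θV t = trans (∏-pairs-toDigraph pairProbability t) (scale t)
    where
    u : Arc → Carrier
    u a = pairProbability (out a) (inn a)
    u≈qv : ∀ a → u a ≈ q * v a
    u≈qv fwd  = sym (*-identityʳ q)
    u≈qv bwd  = sym (*-identityʳ q)
    u≈qv both = sym (begin-equality
      q * (p * x - 1#)    ≈⟨ solve 3 (λ q p x → q :* (p :* x :- :1) := p :* (x :* q) :- q) refl q p x ⟩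
      p * (x * q) - q     ≈⟨ +-congʳ (trans (*-congˡ x*q≈1) (*-identityʳ p)) ⟩
      p - q               ∎)
    scaleArcs : ∀ {n} (as : Vec Arc n) → arcsWeight u as ≈ q ^ n * arcsWeight v as
    scaleArcs []               = sym (*-identityˡ 1#)
    scaleArcs {suc n} (a ∷ as) = trans (*-cong (u≈qv a) (scaleArcs as))
      (solve 4 (λ a b c d → (a :* b) :* (c :* d) := (a :* c) :* (b :* d)) refl q (v a) (q ^ n) _)
    scale : ∀ {n} (t : Tour n) → tourWeight u t ≈ θ n * V t
    scale []               = sym (*-identityˡ 1#)
    scale {suc n} (as ∷ t) = trans (*-cong (scaleArcs as) (scale t))
      (solve 4 (λ a b c d → (a :* b) :* (c :* d) := (a :* c) :* (b :* d)) refl (q ^ n) _ (θ n) _)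

  ℙ-tours : ∀ n {P : Digraph n → Set} (P? : U.Decidable P) →
            ℙ n P? ≈ θ n * ∑ (tours n) (λ t → V t * χ (does (P? (toDigraph t))))
  ℙ-tours n P? = begin-equality
    ℙ n P?                                                        ≈⟨ ∑-tournaments {n} P? probability ⟩
    ∑ (tours n) (λ t → χ (does (P? (toDigraph t))) * probability (toDigraph t))
      ≈⟨ ∑-cong (tours n) (λ t → trans (*-congˡ (probability≈θV t))
           (solve 3 (λ a b c → a :* (b :* c) := b :* (c :* a)) refl _ (θ n) (V t))) ⟩
    ∑ (tours n) (λ t → θ n * (V t * χ (does (P? (toDigraph t))))) ≈⟨ ∑-*ˡ (tours n) (θ n) _ ⟩
    θ n * ∑ (tours n) (λ t → V t * χ (does (P? (toDigraph t))))   ∎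

  ℙ-components : ∀ m n → ℙ n (hasComponents? m) ≈ θ n * it m n
  ℙ-components m n = trans (ℙ-tours n (hasComponents? m)) (*-congˡ (sym (it-total m n)))

  ℙ-stronglyConnected : ∀ n → 1 ℕ.≤ n → ℙ n stronglyConnected? ≈ θ n * it 1 n
  ℙ-stronglyConnected (suc n) _ = trans (ℙ-tours (suc n) stronglyConnected?) (*-congˡ (trans
    (∑-cong (tours (suc n)) λ t → *-congˡ (reflexive (≡.cong χ (does-⇔
      (mk⇔ (stronglyConnected⇒numComponents≡1 (toDigraph t)) (numComponents≡1⇒stronglyConnected (toDigraph t)))
      (stronglyConnected? (toDigraph t)) (hasComponents? 1 (toDigraph t))))))
    (sym (it-total 1 (suc n)))))

  -- The leading 1 of the second expansion is the convention 𝔦𝔱⁽⁰⁾₀ = 1, which affects only k = 0.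
  Q≈scCoefficient : ∀ k → Q k 1 ≈ scCoefficient k
  Q≈scCoefficient zero    = trans (*-congʳ fromℕ-1)
    (solve 3 (λ w a b → :1 :* (:1 :- w :* a :+ b) := :1 :- (w :* a :- b)) refl (fromℕ 2) (it 1 zero) (it 2 zero))
  Q≈scCoefficient (suc k) = trans (*-congʳ fromℕ-1)
    (solve 3 (λ w a b → :1 :* (:0 :- w :* a :+ b) := :- (w :* a :- b)) refl (fromℕ 2) (it 1 (suc k)) (it 2 (suc k)))

  components-expansion : ∀ m → .{{_ : NonZero m}} →
    AsymptoticExpansion (λ n → ℙ n (hasComponents? m)) (λ k → Q k m) g
  components-expansion (suc m) = asymptoticExpansion 0 _ (it (suc m)) _
    (λ n _ → ℙ-components (suc m) n) (λ r → expands-it r m)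

  stronglyConnected-expansion : AsymptoticExpansion (λ n → ℙ n stronglyConnected?) scCoefficient g
  stronglyConnected-expansion = asymptoticExpansion 1 _ (it 1) scCoefficient ℙ-stronglyConnected
    (λ r → expands-cong (suc r) (λ _ → refl) Q≈scCoefficient (expands-it r 0))

corollary4p10 : ∀ {c ℓ₁ ℓ₂} (ℝ : Reals c ℓ₁ ℓ₂) →
    let open Reals ℝ
        open RealNotation ℝ
    in (p : Carrier) → ½ ≤ p → (p<1 : p < 1#) →
    let open ErdősRényi ℝ p p<1
    in ((m : ℕ) → .{{_ : NonZero m}} →
          AsymptoticExpansion (λ n → ℙ n (hasComponents? m)) (λ k → Q k m) g)
       × AsymptoticExpansion (λ n → ℙ n stronglyConnected?) scCoefficient g
corollary4p10 ℝ p ½≤p p<1 = components-expansion , stronglyConnected-expansion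
  where open Tournaments ℝ p ½≤p p<1
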